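{- Consider dynamic bin packing with migration delays with delay cost $C\ge 1$, restricted to instances whose minimum item duration is $1$, and let $\mu$ be the ratio of the longest to the shortest item duration. There is an online algorithm that is $O(\min(\sqrt{C},\mu))$-competitive. Moreover, every randomized online algorithm has competitive ratio at least $\Omega(\min(\sqrt{C},\mu))$.
   Context: Dynamic bin packing with migration delays: bins have capacity $1$. Items $i$ arrive online at times $a_i\ge 0$ with size $s_i\in[0,1]$ and duration $d_i>0$; at arrival only the size is revealed (non-clairvoyant). Upon arrival an item must be placed into an open bin with enough remaining capacity or a new bin. The algorithm may migrate an already placed item to another bin; each time an item is migrated, its duration (time until it leaves the system) is increased by $C$, where $C$ is known to the algorithm. A bin is open while it contains an item; the cost is the total active time $\int_0^\infty(\text{number of open bins at } t)\,dt$. The benchmark $\mathrm{OPT}(I)=\int_0^\infty\mathrm{OPT}_t\,dt$, where $\mathrm{OPT}_t$ is the minimum number of unit bins needed to pack the items present at time $t$ in the original instance (the offline optimum that can repack arbitrarily at any time with no delay). An algorithm is $\beta$-competitive if its expected cost is at most $\beta\,\mathrm{OPT}(I)$ on every instance. The constants hidden in $O(\cdot)$ and $\Omega(\cdot)$ are absolute. -}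

module Defs where

open import Algebra.Structures using (IsCommutativeRing)
import Algebra.Construct.NaturalChoice.Min as NaturalMin
open import Data.Bool.Base using (Bool; true; not; if_then_else_)
open import Data.Fin.Base using (Fin; toℕ)
open import Data.Fin.Properties using (any?; all?)
open import Data.List.Base using (List; []; _∷_; _++_; map; foldr; filter; find; length; concatMap; zip; deduplicate; applyUpTo)
open import Data.List.Relation.Unary.All using (All)
open import Data.List.Relation.Unary.Any using (Any)
open import Data.List.Relation.Unary.Linked using (Linked)
import Data.List.Sort as Sort
open import Data.Maybe.Base using (Maybe; just; nothing)
open import Data.Nat.Base using (ℕ; zero; suc)
import Data.Nat.Properties as ℕ
open import Data.Product.Base using (∃; _×_; _,_; proj₁; proj₂)
open import Data.Vec.Base as Vec using (Vec; []; _∷_)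
open import Function.Bundles using (_⇔_)
open import Level using (0ℓ)
open import Relation.Binary.Bundles using (DecTotalOrder)
open import Relation.Binary.Definitions using (Decidable)
open import Relation.Binary.PropositionalEquality using (_≡_; _≢_; _≗_)
open import Relation.Binary.Structures using (IsDecTotalOrder)
import Relation.Binary.Construct.NonStrictToStrict as Strict
open import Relation.Nullary using (Dec; does)
open import Relation.Nullary.Decidable using (map′; ⌊_⌋)

-- The real numbers, characterised up to isomorphism as the complete ordered
-- field.  The order is decidable, as it is classically.  Least upper bounds are
-- given in the approximation form "every y < s is exceeded by a member of P",
-- classically the same as being ≤ every upper bound.  Together with decidability
-- of the order it yields excluded middle for Set (apply it to {0} ∪ {1 | φ}),
-- so the reasoning available below is classical.
record CompleteOrderedField : Set₁ where
  infix  8 -_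
  infixl 7 _*_
  infixl 6 _+_ _-_
  infix  4 _≤_ _<_
  field
    ℝ                 : Set
    _+_ _*_           : ℝ → ℝ → ℝ
    -_                : ℝ → ℝ
    0# 1#             : ℝ
    _≤_               : ℝ → ℝ → Set
    isCommutativeRing : IsCommutativeRing _≡_ _+_ _*_ -_ 0# 1#
    isDecTotalOrder   : IsDecTotalOrder _≡_ _≤_
    0≢1               : 0# ≢ 1#
    inverse           : ∀ x → x ≢ 0# → ∃ λ y → x * y ≡ 1#
    +-monoˡ-≤         : ∀ z {x y} → x ≤ y → x + z ≤ y + z
    *-nonNegative     : ∀ {x y} → 0# ≤ x → 0# ≤ y → 0# ≤ x * y

  _-_ : ℝ → ℝ → ℝ
  x - y = x + (- y)

  _<_ : ℝ → ℝ → Set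
  _<_ = Strict._<_ _≡_ _≤_

  IsUpperBound : (ℝ → Set) → ℝ → Set
  IsUpperBound P s = ∀ x → P x → x ≤ s

  IsSupremum : (ℝ → Set) → ℝ → Set
  IsSupremum P s = IsUpperBound P s × (∀ y → y < s → ∃ λ x → P x × y < x)

  field
    supremum : (P : ℝ → Set) → ∃ P → ∃ (IsUpperBound P) → ∃ (IsSupremum P)

  decTotalOrder : DecTotalOrder 0ℓ 0ℓ 0ℓ
  decTotalOrder = record { isDecTotalOrder = isDecTotalOrder }

  open IsDecTotalOrder isDecTotalOrder public using (_≤?_; _≟_)
  open NaturalMin (DecTotalOrder.totalOrder decTotalOrder) public using (_⊓_)

  _<?_ : Decidable _<_
  _<?_ = Strict.<-decidable _≡_ _≤_ _≟_ _≤?_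

  fromℕ : ℕ → ℝ
  fromℕ zero    = 0#
  fromℕ (suc n) = 1# + fromℕ n

  sum : List ℝ → ℝ
  sum = foldr _+_ 0#

module DynamicBinPacking (𝓡 : CompleteOrderedField) where
  open CompleteOrderedField 𝓡 public

  record Item : Set where
    field
      arrival size duration : ℝ
      0≤arrival  : 0# ≤ arrival
      0≤size     : 0# ≤ size
      size≤1     : size ≤ 1#
      0<duration : 0# < duration

    departure : ℝ
    departure = arrival + duration

  open Item public

  -- Items that arrive at the same time are revealed in list order.
  record Instance : Set where
    field
      items  : List Item
      sorted : Linked (λ x y → arrival x ≤ arrival y) items

  open Instance public

  ShortestDuration : Instance → ℝ → Set
  ShortestDuration I d =
    All (λ x → d ≤ duration x) (items I) × Any (λ x → duration x ≡ d) (items I)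

  LongestDuration : Instance → ℝ → Set
  LongestDuration I d =
    All (λ x → duration x ≤ d) (items I) × Any (λ x → duration x ≡ d) (items I)

  MinDurationOne : Instance → Set
  MinDurationOne I = ShortestDuration I 1#

  DurationRatio : Instance → ℝ → Set
  DurationRatio I μ =
    ∃ λ short → ∃ λ long →
      ShortestDuration I short × LongestDuration I long × long ≡ μ * short

  MinDurationOneWithRatio : ℝ → Instance → Set
  MinDurationOneWithRatio μ I = MinDurationOne I × DurationRatio I μ

  load : ℕ → List (ℕ × ℝ) → ℝ
  load b ps = sum (map proj₂ (filter (λ p → proj₁ p ℕ.≟ b) ps))

  IsPacking : (m : ℕ) (ss : List ℝ) → Vec (Fin m) (length ss) → Set
  IsPacking m ss bs =
    ∀ (b : Fin m) → load (toℕ b) (zip (map toℕ (Vec.toList bs)) ss) ≤ 1#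

  Packable : ℕ → List ℝ → Set
  Packable m ss = ∃ (IsPacking m ss)

  anyVec? : ∀ {m} n {P : Vec (Fin m) n → Set} → (∀ v → Dec (P v)) → Dec (∃ P)
  anyVec? zero    P? = map′ ([] ,_) (λ { ([] , p) → p }) (P? [])
  anyVec? (suc n) P? =
    map′ (λ { (i , v , p) → (i ∷ v) , p }) (λ { ((i ∷ v) , p) → i , v , p })
         (any? (λ i → anyVec? n (λ v → P? (i ∷ v))))

  packable? : ∀ m ss → Dec (Packable m ss)
  packable? m ss = anyVec? (length ss) (λ bs → all? (λ b → _ ≤? 1#))

  -- The least m with Packable m ss.  Sizes are at most 1, so m = length ss always
  -- works and the search need not go further.
  minBins : List ℝ → ℕ
  minBins ss = search (length ss) 0
    where
    search : ℕ → ℕ → ℕ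
    search zero       m = m
    search (suc fuel) m = if does (packable? m ss) then m else search fuel (suc m)

  -- An item is present on the half-open interval [arrival , departure).
  sizesAt : Instance → ℝ → List ℝ
  sizesAt I t =
    map size (filter (λ x → t <? departure x) (filter (λ x → arrival x ≤? t) (items I)))

  optAt : Instance → ℝ → ℕ
  optAt I t = minBins (sizesAt I t)

  -- ∫ f for an f that vanishes outside the span of the given increasing
  -- breakpoints and is constant on [p , q) for consecutive breakpoints p , q.
  stepIntegral : (ℝ → ℕ) → List ℝ → ℝ
  stepIntegral f (p ∷ q ∷ ps) = (q - p) * fromℕ (f p) + stepIntegral f (q ∷ ps)
  stepIntegral f _            = 0#

  open Sort decTotalOrder using (sort)

  OPT : Instance → ℝ
  OPT I =
    stepIntegral (optAt I) (sort (concatMap (λ x → arrival x ∷ departure x ∷ []) (items I)))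

  -- What the algorithm observes: note that durations do not occur.  Items are
  -- named by their position in the order of arrival, bins by arbitrary numbers;
  -- a bin that holds no item is a "new" bin.
  data Observation : Set where
    arrived  : (time size : ℝ)             → Observation
    departed : (time : ℝ) (items : List ℕ) → Observation
    alarmed  : (time : ℝ)                  → Observation
    placed   : (bin : ℕ)                   → Observation
    migrated : (item bin : ℕ)              → Observation

  -- `wait` lets time pass until the next arrival or departure, or until the
  -- given alarm time if that comes first.
  data Action : Set where
    place   : (bin : ℕ)      → Action
    migrate : (item bin : ℕ) → Action
    wait    : Maybe ℝ        → Action

  -- The history has its most recent entry first.
  Strategy : Set
  Strategy = List Observation → Action

  record Resident : Set where
    constructor resident
    field
      name   : ℕ
      weight : ℝ
      bin    : ℕ
      leaves : ℝ

  open Resident public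

  -- `pending` is the item that has just arrived and is not yet placed.
  record State : Set where
    constructor state
    field
      now      : ℝ
      active   : List Resident
      pending  : Maybe Item
      future   : List Item
      arrivals : ℕ
      history  : List Observation

  open State public

  initial : Instance → State
  initial I = state 0# [] nothing (items I) 0 []

  Fits : ℝ → ℕ → List Resident → Set
  Fits s b rs = load b (map (λ r → bin r , weight r) rs) + s ≤ 1#

  fits? : ∀ s b rs → Dec (Fits s b rs)
  fits? s b rs = _ ≤? 1#

  openBins : State → ℕ
  openBins st = length (deduplicate ℕ._≟_ (map bin (active st)))

  data Outcome : Set where
    finished illegal : Outcome
    next             : State → Outcome

  data Signal : Set where
    departure! : ℝ → Signal
    arrival!   : Item → List Item → Signal
    alarm!     : ℝ → Signal

  signalTime : Signal → ℝ
  signalTime (departure! t) = t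
  signalTime (arrival! x _) = arrival x
  signalTime (alarm! t)     = t

  -- Ties are resolved in favour of the earlier list position.
  earliest : Signal → List Signal → Signal
  earliest e []       = e
  earliest e (f ∷ fs) =
    if does (signalTime e ≤? signalTime f) then earliest e fs else earliest f fs

  -- At equal times departures precede arrivals, which precede alarms.
  signals : Maybe ℝ → State → List Signal
  signals alarm st =
    map (λ r → departure! (leaves r)) (active st) ++ arrivalSignal (future st) ++ alarmSignal alarm
    where
    arrivalSignal : List Item → List Signal
    arrivalSignal []       = []
    arrivalSignal (x ∷ xs) = arrival! x xs ∷ []

    alarmSignal : Maybe ℝ → List Signal
    alarmSignal (just t) = alarm! t ∷ []
    alarmSignal nothing  = []

  -- All items due at the same time leave together.
  occur : Signal → State → Outcome
  occur (departure! t) st =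
    next (record st
      { now     = t
      ; active  = filter (λ r → t <? leaves r) (active st)
      ; history = departed t (map name (filter (λ r → leaves r ≤? t) (active st))) ∷ history st
      })
  occur (arrival! x xs) st =
    next (record st
      { now      = arrival x
      ; pending  = just x
      ; future   = xs
      ; history  = arrived (arrival x) (size x) ∷ history st
      })
  occur (alarm! t) st =
    if does (now st <? t)
    then next (record st { now = t ; history = alarmed t ∷ history st })
    else illegal

  waitFor : Maybe ℝ → State → Outcome
  waitFor alarm st with signals alarm st
  ... | []     = illegal
  ... | e ∷ es = occur (earliest e es) st

  placeIn : ℕ → Item → State → Outcome
  placeIn b x st =
    if does (fits? (size x) b (active st))
    then next (record st
      { active   = resident (arrivals st) (size x) b (departure x) ∷ active st
      ; pending  = nothing
      ; arrivals = suc (arrivals st)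
      ; history  = placed b ∷ history st
      })
    else illegal

  -- Each migration goes to a different bin and delays the item's departure by C.
  migrateTo : (C : ℝ) → ℕ → ℕ → State → Outcome
  migrateTo C i b st with find (λ r → name r ℕ.≟ i) (active st)
  ... | nothing = illegal
  ... | just r  =
    if does (bin r ℕ.≟ b) then illegal
    else if does (fits? (weight r) b (active st))
    then next (record st
      { active  = map move (active st)
      ; history = migrated i b ∷ history st
      })
    else illegal
    where
    move : Resident → Resident
    move r′ = if does (name r′ ℕ.≟ i)
              then record r′ { bin = b ; leaves = leaves r′ + C }
              else r′

  -- Time does not advance while an item is pending.
  perform : (C : ℝ) → Action → State → Outcome
  perform C (migrate i b) st = migrateTo C i b st
  perform C (place b)     st with pending st
  ... | just x  = placeIn b x st
  ... | nothing = illegal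
  perform C (wait alarm)  st with pending st
  ... | just _  = illegal
  ... | nothing = waitFor alarm st

  step : (C : ℝ) → Strategy → State → Outcome
  step C σ (state _ [] nothing [] _ _) = finished
  step C σ st                          = perform C (σ (history st)) st

  data Run (C : ℝ) (σ : Strategy) (st : State) : Set where
    stop : step C σ st ≡ finished → Run C σ st
    _▸_  : ∀ {st′} → step C σ st ≡ next st′ → Run C σ st′ → Run C σ st

  -- ∫ (number of open bins) dt: the set of open bins is constant between steps.
  runCost : ∀ {C σ st} → Run C σ st → ℝ
  runCost           (stop _)        = 0#
  runCost {st = st} (_▸_ {st′} _ r) = (now st′ - now st) * fromℕ (openBins st) + runCost r

  -- A strategy that, on every instance of the class 𝓘, only takes legal actions
  -- and lets all items leave after finitely many steps.  Since `step` is a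
  -- function, the run is determined by the strategy and the instance.
  record OnlineAlgorithm (C : ℝ) (𝓘 : Instance → Set) : Set where
    field
      strategy : Strategy
      run      : ∀ I → 𝓘 I → Run C strategy (initial I)

    cost : ∀ I → 𝓘 I → ℝ
    cost I I∈𝓘 = runCost (run I I∈𝓘)

  open OnlineAlgorithm public

  -- Events are Bool-valued, which classically covers all subsets of Ω.
  IsUnion : {Ω : Set} → (ℕ → Ω → Bool) → (Ω → Bool) → Set
  IsUnion A U = ∀ ω → (U ω ≡ true) ⇔ (∃ λ n → A n ω ≡ true)

  Disjoint : {Ω : Set} → (ℕ → Ω → Bool) → Set
  Disjoint A = ∀ m n ω → A m ω ≡ true → A n ω ≡ true → m ≡ n

  -- The sum of a series with nonnegative terms.
  HasSum : (ℕ → ℝ) → ℝ → Set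
  HasSum a = IsSupremum (λ v → ∃ λ n → v ≡ sum (applyUpTo a n))

  -- The values of Pr outside the σ-algebra Measurable are irrelevant.
  record ProbabilitySpace : Set₁ where
    field
      Ω           : Set
      Measurable  : (Ω → Bool) → Set
      Pr          : (Ω → Bool) → ℝ
      measurable-resp : ∀ {A B} → A ≗ B → Measurable A → Measurable B
      Pr-resp         : ∀ {A B} → A ≗ B → Pr A ≡ Pr B
      whole       : Measurable (λ _ → true)
      complement  : ∀ {A} → Measurable A → Measurable (λ ω → not (A ω))
      union       : ∀ {A U} → (∀ n → Measurable (A n)) → IsUnion A U → Measurable U
      Pr-nonNegative : ∀ {A} → Measurable A → 0# ≤ Pr A
      Pr-whole       : Pr (λ _ → true) ≡ 1#
      Pr-additive    : ∀ {A U} → (∀ n → Measurable (A n)) → Disjoint A → IsUnion A U →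
                       HasSum (λ n → Pr (A n)) (Pr U)

    MeasurableFunction : (Ω → ℝ) → Set
    MeasurableFunction f = ∀ q → Measurable (λ ω → ⌊ f ω ≤? q ⌋)

    -- The nonnegative simple function Σ cᵢ · 1_{Aᵢ}, as the list of its (cᵢ , Aᵢ).
    Simple : Set
    Simple = List (ℝ × (Ω → Bool))

    IsSimple : Simple → Set
    IsSimple = All (λ { (c , A) → 0# ≤ c × Measurable A })

    value : Simple → Ω → ℝ
    value φ ω = sum (map (λ { (c , A) → if A ω then c else 0# }) φ)

    simpleIntegral : Simple → ℝ
    simpleIntegral φ = sum (map (λ { (c , A) → c * Pr A }) φ)

    -- The Lebesgue integral of a nonnegative measurable f, when finite.
    IsExpectation : (Ω → ℝ) → ℝ → Set
    IsExpectation f = IsSupremum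
      (λ v → ∃ λ φ → IsSimple φ × (∀ ω → value φ ω ≤ f ω) × v ≡ simpleIntegral φ)

  open ProbabilitySpace public using (Ω; MeasurableFunction; IsExpectation)

  record RandomizedAlgorithm (C : ℝ) (𝓘 : Instance → Set) : Set₁ where
    field
      space      : ProbabilitySpace
      algorithm  : Ω space → OnlineAlgorithm C 𝓘
      measurable : ∀ I (I∈𝓘 : 𝓘 I) →
                   MeasurableFunction space (λ ω → cost (algorithm ω) I I∈𝓘)

  open RandomizedAlgorithm public

  -- 𝓙 is a subclass of the class 𝓘 on which the algorithm operates.
  Competitive : ∀ {C 𝓘} → OnlineAlgorithm C 𝓘 → (𝓙 : Instance → Set) → ℝ → Set
  Competitive {𝓘 = 𝓘} A 𝓙 β = ∀ I (I∈𝓘 : 𝓘 I) → 𝓙 I → cost A I I∈𝓘 ≤ β * OPT I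

  -- An infinite expected cost is not competitive.
  CompetitiveInExpectation : ∀ {C 𝓘} → RandomizedAlgorithm C 𝓘 → ℝ → Set
  CompetitiveInExpectation {𝓘 = 𝓘} A β = ∀ I (I∈𝓘 : 𝓘 I) →
    ∃ λ e → IsExpectation (space A) (λ ω → cost (algorithm A ω) I I∈𝓘) e × e ≤ β * OPT I

{-# OPTIONS --safe #-}
-- Upper bound.  Run next-fit with two current bins, one for newly arrived items
-- and one for migrated ones.  When an item does not fit, the current bin is closed
-- and cleared later: all items still in it are migrated, √C after the closing of a
-- bin of new items and 2 C after the closing of a bin of migrated ones.  An item is
-- therefore migrated only at age ≥ √C and then at most once every 2 C, so that
-- migration stretches its stay by at most the factor ρ = 2 + √C, and by nothing at
-- all if all durations are < √C.  The current bins cost at most twice the measure of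
-- the union of the stretched intervals, which is at most ρ times the measure of the
-- union of the original ones.  Two consecutive bins of an area received a total size
-- > 1, so the closed bins are paid for by the total size of the items placed, and for
-- migrated items this is a fraction of the volume Σ size · duration.
--
-- Lower bound.  Let m = min(√C, μ) and g = ⌊m⌋ + 1.  At time 0 there arrive k ≥ μ
-- blocks of g items of size 1/g; in each block a random item lasts m and the others
-- last 1, and one more item lasts μ.  Then OPT ≤ 4 k.  All items are placed before any
-- duration is revealed, at most g to a bin, so on average at least k/2 bins contain an
-- item that lasts m.  Such a bin stays open for time m unless one of its items is
-- migrated, which adds a volume C/g ≥ m/2.
module Submission where

open import Defs
open import Algebra.Bundles using (CommutativeRing)
import Algebra.Construct.NaturalChoice.Max as NaturalMax
import Algebra.Construct.NaturalChoice.Min as NaturalMin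
open import Algebra.Solver.Ring.AlmostCommutativeRing using (fromCommutativeRing; _-Raw-AlmostCommutative⟶_)
open import Data.Bool.Base using (Bool; true; false; not; _∧_; _∨_; if_then_else_)
open import Data.Empty using (⊥; ⊥-elim)
open import Data.Fin.Base using (Fin; zero; suc; toℕ; fromℕ<)
import Data.Fin.Properties as Fin
open import Data.Integer.Base using (ℤ; +_; -[1+_]; _⊖_; _◃_)
import Data.Integer.Base as ℤ
import Data.Integer.Properties as ℤ
open import Data.List.Base hiding (sum)
open import Data.List.Membership.Propositional using (_∈_; _∉_) renaming (find to locate)
open import Data.List.Membership.Propositional.Properties
open import Data.List.Properties hiding (sum-++; ≡-dec)
open import Data.List.Relation.Binary.Permutation.Propositional using (↭-sym)
open import Data.List.Relation.Binary.Permutation.Propositional.Properties using (∈-resp-↭)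
open import Data.List.Relation.Binary.Pointwise using (Pointwise; []; _∷_; Pointwise-length)
open import Data.List.Relation.Unary.All as All using (All; []; _∷_)
import Data.List.Relation.Unary.All.Properties as All
open import Data.List.Relation.Unary.AllPairs as AllPairs using (AllPairs; []; _∷_)
import Data.List.Relation.Unary.AllPairs.Properties as AllPairs
open import Data.List.Relation.Unary.Any as Any using (Any; here; there)
open import Data.List.Relation.Unary.Any.Properties using (¬Any[]; reverse⁺)
open import Data.List.Relation.Unary.Linked using (Linked; []; [-]; _∷_)
open import Data.List.Relation.Unary.Linked.Properties using (Linked⇒AllPairs)
import Data.List.Relation.Unary.Unique.DecPropositional.Properties as DecUnique
open import Data.List.Relation.Unary.Unique.Propositional using (Unique)
import Data.List.Relation.Unary.Unique.Propositional.Properties as Unique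
import Data.List.Sort as Sort
open import Data.Maybe.Base as Maybe using (Maybe; just; nothing)
open import Data.Nat.Base using (ℕ; zero; suc; z≤n; s≤s)
import Data.Nat.Base as ℕ
import Data.Nat.DivMod as ℕ
import Data.Nat.Properties as ℕ
open import Data.Product using (∃; ∃₂; Σ; _×_; _,_; proj₁; proj₂)
import Data.Sign.Base as Sign
open import Data.Sum.Base using (_⊎_; inj₁; inj₂)
open import Data.Unit.Base using (⊤; tt)
open import Data.Vec.Base as Vec using (Vec; []; _∷_)
import Data.Vec.Properties as Vec
open import Function.Base using (_∘_; id; case_of_)
open import Function.Bundles using (mk⇔)
open import Level using (0ℓ)
open import Relation.Binary.Bundles using (DecTotalOrder)
open import Relation.Binary.PropositionalEquality
open import Relation.Binary.Structures using (IsDecTotalOrder)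
open import Relation.Nullary using (¬_; Dec; yes; no; does)
open import Relation.Nullary.Decidable using (⌊_⌋; ¬?; _×-dec_)
open import Data.List.Membership.DecPropositional ℕ._≟_ using (_∈?_)

-- The lifetime of a closed bin is paid for by the sizes it received. A new item can afford `T` per
-- unit of size because its duration is at least 1; only an item old enough to be migrated has the
-- volume to afford `2 C`. This is why the two kinds never share a current bin. Why `2 C`: each
-- migration delays the departure by `C`. An item still present at age `√C + 2 k C` after `k`
-- migrations has original duration at least `√C + k C`, so the number of migrations is bounded by
-- the duration. With a spacing of only `C` the delays would use up the whole spacing, and nothing
-- would bound that number. The strategy knows only `C`. The numbers `ρ` and `T` belong to the
-- analysis and are chosen by comparing `√C` with the longest duration. In the lower bound the
-- random choice is replaced by a sum over all choices, taken for a fixed outcome of the algorithm's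
-- randomness, where the algorithm is deterministic. Expectations are then compared by means of step
-- functions that lose at most half of the bound. The constant is `48 = 6 · 2 · 4`: `total-cost`,
-- this loss, and `OPT ≤ 4 k`.

module _ (𝓡 : CompleteOrderedField) where
  open DynamicBinPacking 𝓡

  -- Ordered fields

  open IsDecTotalOrder isDecTotalOrder using () renaming (refl to ≤-refl; reflexive to ≤-reflexive; trans to ≤-trans; antisym to ≤-antisym; total to ≤-total)

  open NaturalMin (DecTotalOrder.totalOrder decTotalOrder) using () renaming (x≤y⇒x⊓y≈x to ⊓-≤; x≤y⇒y⊓x≈x to ⊓-≥)
  open NaturalMax (DecTotalOrder.totalOrder decTotalOrder) using (_⊔_; x≤x⊔y; ⊔-lub) renaming (x≤y⊔x to y≤x⊔y; x≤y⇒x⊔y≈y to ⊔-≤; x≤y⇒y⊔x≈y to ⊔-≥)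

  commutativeRing : CommutativeRing 0ℓ 0ℓ
  commutativeRing = record { isCommutativeRing = isCommutativeRing }

  open CommutativeRing commutativeRing using (+-assoc; +-comm; +-identityˡ; +-identityʳ; *-comm; *-identityˡ; *-identityʳ; distribˡ; distribʳ; zeroˡ; zeroʳ; -‿inverseʳ)
  open import Algebra.Properties.Ring (CommutativeRing.ring commutativeRing) using (-‿distribˡ-*; -‿distribʳ-*; -‿involutive; -0#≈0#; -‿anti-homo-+)

  -- Naturals and integers in the field, for the ring solver

  fromℕ-+ : ∀ m n → fromℕ (m ℕ.+ n) ≡ fromℕ m + fromℕ n
  fromℕ-+ zero    n = sym (+-identityˡ _)
  fromℕ-+ (suc m) n = trans (cong (_+_ 1#) (fromℕ-+ m n)) (sym (+-assoc _ _ _))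

  fromℕ-* : ∀ m n → fromℕ (m ℕ.* n) ≡ fromℕ m * fromℕ n
  fromℕ-* zero    n = sym (zeroˡ _)
  fromℕ-* (suc m) n = begin
    fromℕ (n ℕ.+ m ℕ.* n)            ≡⟨ fromℕ-+ n (m ℕ.* n) ⟩
    fromℕ n + fromℕ (m ℕ.* n)        ≡⟨ cong₂ _+_ (sym (*-identityˡ _)) (fromℕ-* m n) ⟩
    1# * fromℕ n + fromℕ m * fromℕ n ≡⟨ distribʳ _ _ _ ⟨
    (1# + fromℕ m) * fromℕ n         ∎
    where open ≡-Reasoning

  -- Unlike fromℕ it sends 1 to 1# definitionally, so that numerals in ring-solver
  -- polynomials mean what they say.
  embed : ℕ → ℝ
  embed 0             = 0#
  embed 1             = 1#
  embed (suc (suc n)) = 1# + embed (suc n)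

  embed≡fromℕ : ∀ n → embed n ≡ fromℕ n
  embed≡fromℕ 0             = refl
  embed≡fromℕ 1             = sym (+-identityʳ _)
  embed≡fromℕ (suc (suc n)) = cong (_+_ 1#) (embed≡fromℕ (suc n))

  fromℤ : ℤ → ℝ
  fromℤ (+ n)    = embed n
  fromℤ -[1+ n ] = - embed (suc n)

  fromℤ-⊖ : ∀ m n → fromℤ (m ⊖ n) ≡ fromℕ m - fromℕ n
  fromℤ-⊖ m       zero    = trans (embed≡fromℕ m) (sym (trans (cong (_+_ _) -0#≈0#) (+-identityʳ _)))
  fromℤ-⊖ zero    (suc n) = trans (cong -_ (embed≡fromℕ (suc n))) (sym (+-identityˡ _))
  fromℤ-⊖ (suc m) (suc n) = begin
    fromℤ (suc m ⊖ suc n)                      ≡⟨ cong fromℤ (ℤ.[1+m]⊖[1+n]≡m⊖n m n) ⟩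
    fromℤ (m ⊖ n)                              ≡⟨ fromℤ-⊖ m n ⟩
    fromℕ m - fromℕ n                          ≡⟨ cong (_- fromℕ n)
        (sym (trans (cong (_+ fromℕ m) (-‿inverseʳ 1#)) (+-identityˡ _))) ⟩
    1# + - 1# + fromℕ m - fromℕ n              ≡⟨ cong (_- fromℕ n)
        (trans (+-assoc _ _ _) (cong (_+_ 1#) (+-comm _ _))) ⟩
    1# + (fromℕ m + - 1#) + - fromℕ n          ≡⟨ cong (_- fromℕ n) (sym (+-assoc _ _ _)) ⟩
    1# + fromℕ m + - 1# + - fromℕ n            ≡⟨ +-assoc _ _ _ ⟩
    1# + fromℕ m + (- 1# + - fromℕ n)          ≡⟨ cong (_+_ _) (trans (+-comm _ _)
        (sym (-‿anti-homo-+ 1# (fromℕ n)))) ⟩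
    1# + fromℕ m - (1# + fromℕ n)              ∎
    where open ≡-Reasoning

  fromℤ-+ : ∀ i j → fromℤ (i ℤ.+ j) ≡ fromℤ i + fromℤ j
  fromℤ-+ (+ m)    (+ n)    = trans (embed≡fromℕ (m ℕ.+ n)) (trans (fromℕ-+ m n)
      (sym (cong₂ _+_ (embed≡fromℕ m) (embed≡fromℕ n))))
  fromℤ-+ (+ m)    -[1+ n ] = trans (fromℤ-⊖ m (suc n)) (sym (cong₂ _-_ (embed≡fromℕ m) (embed≡fromℕ (suc n))))
  fromℤ-+ -[1+ m ] (+ n)    = trans (fromℤ-⊖ n (suc m)) (trans (+-comm _ _)
      (sym (cong₂ _+_ (cong -_ (embed≡fromℕ (suc m))) (embed≡fromℕ n))))
  fromℤ-+ -[1+ m ] -[1+ n ] = begin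
    - embed (suc (suc (m ℕ.+ n)))       ≡⟨ cong -_ (embed≡fromℕ (suc (suc (m ℕ.+ n)))) ⟩
    - fromℕ (suc (suc (m ℕ.+ n)))       ≡⟨ cong (-_ ∘ fromℕ ∘ suc) (sym (ℕ.+-suc m n)) ⟩
    - fromℕ (suc m ℕ.+ suc n)           ≡⟨ cong -_ (fromℕ-+ (suc m) (suc n)) ⟩
    - (fromℕ (suc m) + fromℕ (suc n))   ≡⟨ trans (-‿anti-homo-+ _ _) (+-comm _ _) ⟩
    - fromℕ (suc m) + - fromℕ (suc n)   ≡⟨ sym (cong₂ _-_ (cong -_ (embed≡fromℕ (suc m))) (embed≡fromℕ (suc n))) ⟩
    - embed (suc m) + - embed (suc n)   ∎
    where open ≡-Reasoning

  fromℤ-+◃ : ∀ n → fromℤ (Sign.+ ◃ n) ≡ fromℕ n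
  fromℤ-+◃ zero    = refl
  fromℤ-+◃ (suc n) = embed≡fromℕ (suc n)

  fromℤ--◃ : ∀ n → fromℤ (Sign.- ◃ n) ≡ - fromℕ n
  fromℤ--◃ zero    = sym -0#≈0#
  fromℤ--◃ (suc n) = cong -_ (embed≡fromℕ (suc n))

  fromℤ-* : ∀ i j → fromℤ (i ℤ.* j) ≡ fromℤ i * fromℤ j
  fromℤ-* (+ m)    (+ n)    = trans (fromℤ-+◃ (m ℕ.* n)) (trans (fromℕ-* m n)
      (sym (cong₂ _*_ (embed≡fromℕ m) (embed≡fromℕ n))))
  fromℤ-* (+ m)    -[1+ n ] = trans (fromℤ--◃ (m ℕ.* suc n)) (trans (cong -_ (fromℕ-* m (suc n)))
      (trans (-‿distribʳ-* _ _) (sym (cong₂ (λ x y → x * - y) (embed≡fromℕ m) (embed≡fromℕ (suc n))))))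
  fromℤ-* -[1+ m ] (+ n)    = trans (fromℤ--◃ (suc m ℕ.* n)) (trans (cong -_ (fromℕ-* (suc m) n))
      (trans (-‿distribˡ-* _ _) (sym (cong₂ (λ x y → - x * y) (embed≡fromℕ (suc m)) (embed≡fromℕ n)))))
  fromℤ-* -[1+ m ] -[1+ n ] = begin
    fromℤ (Sign.+ ◃ (suc m ℕ.* suc n))      ≡⟨ fromℤ-+◃ (suc m ℕ.* suc n) ⟩
    fromℕ (suc m ℕ.* suc n)                 ≡⟨ fromℕ-* (suc m) (suc n) ⟩
    fromℕ (suc m) * fromℕ (suc n)           ≡⟨ sym (-‿involutive _) ⟩
    - - (fromℕ (suc m) * fromℕ (suc n))     ≡⟨ cong -_ (-‿distribˡ-* _ _) ⟩
    - (- fromℕ (suc m) * fromℕ (suc n))     ≡⟨ -‿distribʳ-* _ _ ⟩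
    - fromℕ (suc m) * - fromℕ (suc n)       ≡⟨ sym (cong₂ (λ x y → - x * - y) (embed≡fromℕ (suc m))
        (embed≡fromℕ (suc n))) ⟩
    - embed (suc m) * - embed (suc n)       ∎
    where open ≡-Reasoning

  fromℤ-neg : ∀ i → fromℤ (ℤ.- i) ≡ - fromℤ i
  fromℤ-neg (+ zero)  = sym -0#≈0#
  fromℤ-neg (+ suc n) = refl
  fromℤ-neg -[1+ n ]  = sym (-‿involutive _)

  -- Cancellation of terms in normal forms needs coefficients whose equality can be computed; the
  -- field is abstract, so the coefficients are integers interpreted in it.
  integers : ℤ.+-*-rawRing -Raw-AlmostCommutative⟶ fromCommutativeRing commutativeRing
  integers = record
    { ⟦_⟧ = fromℤ ; +-homo = fromℤ-+ ; *-homo = fromℤ-* ; -‿homo = fromℤ-neg ; 0-homo = refl ; 1-homo = refl }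

  fromℤ-weaklyDecidable : ∀ i j → Maybe (fromℤ i ≡ fromℤ j)
  fromℤ-weaklyDecidable i j with i ℤ.≟ j
  ... | yes i≡j = just (cong fromℤ i≡j)
  ... | no  _   = nothing

  open import Algebra.Solver.Ring ℤ.+-*-rawRing (fromCommutativeRing commutativeRing) integers fromℤ-weaklyDecidable
    using (Polynomial; con; _:+_; _:*_; _:-_; :-_; _:=_; solve)

  -- Built from ones and a final 0, so that it denotes `fromℕ` of the numeral definitionally, as the
  -- constants in the goals are written.
  num : ∀ {n} → ℕ → Polynomial n
  num zero    = con (+ 0)
  num (suc n) = con (+ 1) :+ num n

  -- Rules for inequalities

  infixl 6 _⊕_
  _⊕_ : ∀ {a b c d} → a ≤ b → c ≤ d → a + c ≤ b + d
  _⊕_ {a} {b} {c} {d} a≤b c≤d =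
    ≤-trans (+-monoˡ-≤ c a≤b) (subst₂ _≤_ (+-comm c b) (+-comm d b) (+-monoˡ-≤ b c≤d))

  0≤⇒≤ : ∀ {a b} → 0# ≤ b - a → a ≤ b
  0≤⇒≤ {a} {b} p = subst₂ _≤_ (+-identityˡ a) (solve 2 (λ a b → a :- b :+ b := a) refl b a) (+-monoˡ-≤ a p)

  ≤⇒0≤ : ∀ {a b} → a ≤ b → 0# ≤ b - a
  ≤⇒0≤ {a} {b} p = subst (_≤ b - a) (-‿inverseʳ a) (+-monoˡ-≤ (- a) p)

  -- The form of nearly every estimate below: known inequalities are added up with `⊕` to `l ≤ r`,
  -- and the ring solver checks that the slack is the same as in the goal.
  ≤-by : ∀ {a b l r} → l ≤ r → r - l ≡ b - a → a ≤ b
  ≤-by l≤r eq = 0≤⇒≤ (subst (0# ≤_) eq (≤⇒0≤ l≤r))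

  ≡-≤-trans : ∀ {a b c} → a ≡ b → b ≤ c → a ≤ c
  ≡-≤-trans refl b≤c = b≤c

  ≤-≡-trans : ∀ {a b c} → a ≤ b → b ≡ c → a ≤ c
  ≤-≡-trans a≤b refl = a≤b

  ≰⇒≥ : ∀ {a b} → ¬ (a ≤ b) → b ≤ a
  ≰⇒≥ {a} {b} a≰b with ≤-total a b
  ... | inj₁ a≤b = ⊥-elim (a≰b a≤b)
  ... | inj₂ b≤a = b≤a

  ≰⇒> : ∀ {a b} → ¬ (a ≤ b) → b < a
  ≰⇒> a≰b = ≰⇒≥ a≰b , λ b≡a → a≰b (≤-reflexive (sym b≡a))

  <⇒≱ : ∀ {a b} → a < b → ¬ (b ≤ a)
  <⇒≱ (a≤b , a≢b) b≤a = a≢b (≤-antisym a≤b b≤a)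

  ≮⇒≥ : ∀ {a b} → ¬ (a < b) → b ≤ a
  ≮⇒≥ {a} {b} a≮b with b ≤? a
  ... | yes b≤a = b≤a
  ... | no  b≰a = ⊥-elim (a≮b (≰⇒> b≰a))

  ≤-<-trans : ∀ {a b c} → a ≤ b → b < c → a < c
  ≤-<-trans a≤b b<c = ≰⇒> λ c≤a → <⇒≱ b<c (≤-trans c≤a a≤b)

  <-≤-trans : ∀ {a b c} → a < b → b ≤ c → a < c
  <-≤-trans a<b b≤c = ≰⇒> λ c≤a → <⇒≱ a<b (≤-trans b≤c c≤a)

  0≤1 : 0# ≤ 1#
  0≤1 with ≤-total 0# 1#
  ... | inj₁ 0≤1 = 0≤1
  ... | inj₂ 1≤0 = subst (0# ≤_) (solve 0 ((:- (con (+ 1))) :* (:- (con (+ 1))) := con (+ 1)) refl)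
      (*-nonNegative 0≤-1 0≤-1)
    where
    0≤-1 : 0# ≤ - 1#
    0≤-1 = (≤-by (1≤0) (solve 0 ((con (+ 0)) :- (con (+ 1)) := :- (con (+ 1)) :- (con (+ 0))) refl))

  0<1 : 0# < 1#
  0<1 = 0≤1 , 0≢1

  *-monoʳ-≤ : ∀ {a b c} → 0# ≤ c → a ≤ b → c * a ≤ c * b
  *-monoʳ-≤ {a} {b} {c} 0≤c a≤b =
    (≤-by (*-nonNegative 0≤c (≤⇒0≤ a≤b)) (solve 3 (λ a b c → a :* (b :- c) :- (con (+ 0)) := a :* b :- a :* c) refl c
        b a))

  *-mono-≤ : ∀ {a b c d} → 0# ≤ b → 0# ≤ c → a ≤ b → c ≤ d → a * c ≤ b * d
  *-mono-≤ {a} {b} {c} {d} 0≤b 0≤c a≤b c≤d = ≤-trans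
    (subst₂ _≤_ (*-comm c a) (*-comm c b) (*-monoʳ-≤ 0≤c a≤b)) (*-monoʳ-≤ 0≤b c≤d)

  *-positive : ∀ {a b} → 0# < a → 0# < b → 0# < a * b
  *-positive {a} {b} (0≤a , 0≢a) (0≤b , 0≢b) = *-nonNegative 0≤a 0≤b , λ 0≡ab →
    let a⁻¹ , aa⁻¹≡1 = inverse a (0≢a ∘ sym) in
    0≢b (begin
      0#             ≡⟨ sym (zeroʳ a⁻¹) ⟩
      a⁻¹ * 0#       ≡⟨ cong (_*_ a⁻¹) 0≡ab ⟩
      a⁻¹ * (a * b)  ≡⟨ (solve 3 (λ a b c → a :* (b :* c) := b :* a :* c) refl a⁻¹ a b) ⟩
      a * a⁻¹ * b    ≡⟨ cong (_* b) aa⁻¹≡1 ⟩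
      1# * b         ≡⟨ *-identityˡ b ⟩
      b              ∎)
    where open ≡-Reasoning

  *-cancelˡ-≤ : ∀ {a b c} → 0# < c → c * a ≤ c * b → a ≤ b
  *-cancelˡ-≤ {a} {b} {c} 0<c ca≤cb with a ≤? b
  ... | yes a≤b = a≤b
  ... | no  a≰b = ⊥-elim (<⇒≱ (*-positive 0<c 0<a-b) (≤-by (ca≤cb)
      (solve 3 (λ a b c → a :* b :- a :* c := (con (+ 0)) :- a :* (c :- b)) refl c b a)))
    where
    0<a-b : 0# < a - b
    0<a-b = ≤⇒0≤ (≰⇒≥ a≰b) , λ 0≡a-b → a≰b (≤-by (≤-reflexive (sym 0≡a-b))
        (solve 2 (λ a b → (con (+ 0)) :- (a :- b) := b :- a) refl a b))

  positiveInverse : ∀ {a} → 0# < a → ∃ λ b → 0# < b × a * b ≡ 1#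
  positiveInverse {a} 0<a@(0≤a , 0≢a) with inverse a (0≢a ∘ sym)
  ... | b , ab≡1 = b , (≰⇒> b≰0) , ab≡1
    where
    b≰0 : ¬ (b ≤ 0#)
    b≰0 b≤0 = <⇒≱ 0<1 (subst₂ _≤_ ab≡1 (zeroʳ a) (*-monoʳ-≤ 0≤a b≤0))

  1≤√ : ∀ {C √C} → 1# ≤ C → 0# ≤ √C → √C * √C ≡ C → 1# ≤ √C
  1≤√ {C} {√C} 1≤C 0≤√C √C²≡C with 1# ≤? √C
  ... | yes p = p
  ... | no ¬p = ⊥-elim (¬p (≤-trans 1≤C (≡-≤-trans (sym √C²≡C)
    (≤-≡-trans (*-monoʳ-≤ 0≤√C (≰⇒≥ ¬p)) (*-identityʳ √C)))))

  0≤fromℕ : ∀ n → 0# ≤ fromℕ n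
  0≤fromℕ zero    = ≤-refl
  0≤fromℕ (suc n) = (≤-by (0≤1 ⊕ 0≤fromℕ n) (solve 1 (λ a → (con (+ 1)) :+ a :- ((con (+ 0)) :+ (con (+ 0))) :=
      (con (+ 1)) :+ a :- (con (+ 0))) refl (fromℕ n)))

  fromℕ-mono-≤ : ∀ {m n} → m ℕ.≤ n → fromℕ m ≤ fromℕ n
  fromℕ-mono-≤ {n = n} z≤n = 0≤fromℕ n
  fromℕ-mono-≤ (s≤s m≤n)   = ≤-refl ⊕ fromℕ-mono-≤ m≤n

  -- The supremum of {0} ∪ {1 | φ} exceeds 0 exactly when φ holds.
  excludedMiddle : (φ : Set) → Dec φ
  excludedMiddle φ with supremum (λ v → v ≡ 0# ⊎ (v ≡ 1# × φ)) (0# , inj₁ refl)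
                          (1# , λ { _ (inj₁ refl) → 0≤1 ; _ (inj₂ (refl , _)) → ≤-refl })
  ... | s , upper , approached with 0# <? s
  ...   | no  0≮s = no λ p → 0≮s (<-≤-trans 0<1 (upper 1# (inj₂ (refl , p))))
  ...   | yes 0<s with approached 0# 0<s
  ...     | _ , inj₁ refl , 0<0 = ⊥-elim (proj₂ 0<0 refl)
  ...     | _ , inj₂ (_ , p) , _ = yes p

  archimedean : ∀ x → ∃ λ n → x ≤ fromℕ n
  archimedean x with excludedMiddle (∃ λ n → x ≤ fromℕ n)
  ... | yes p = p
  ... | no ¬p with supremum (λ v → ∃ λ n → v ≡ fromℕ n) (0# , 0 , refl)
                     (x , λ { _ (n , refl) → ≰⇒≥ λ x≤n → ¬p (n , x≤n) })
  ...   | s , upper , approached with approached (s - 1#) (≰⇒> λ s≤s-1 → <⇒≱ 0<1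
      (≤-by (s≤s-1) (solve 1 (λ a → a :- (con (+ 1)) :- a := (con (+ 0)) :- (con (+ 1))) refl s)))
  ...     | _ , (n , refl) , s-1<n = ⊥-elim (<⇒≱ s-1<n
              (≤-by (upper (fromℕ (suc n)) (suc n , refl)) (solve 2
                  (λ a b → a :- ((con (+ 1)) :+ b) := a :- (con (+ 1)) :- b) refl s (fromℕ n))))

  -- Descends from an Archimedean bound to the floor `n` of `x`. The strict bound `suc n` becomes
  -- the number of items per block in the lower bound.
  ceiling : ∀ x → 0# ≤ x → ∃ λ n → x < fromℕ (suc n) × fromℕ n ≤ x
  ceiling x 0≤x = let n , x≤n = archimedean x in search n x≤n
    where
    search : ∀ n → x ≤ fromℕ n → ∃ λ n → x < fromℕ (suc n) × fromℕ n ≤ x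
    search n x≤n with fromℕ n ≤? x
    ... | yes n≤x = n , (≰⇒> λ n+1≤x → <⇒≱ 0<1 (≤-by (x≤n ⊕ n+1≤x)
        (solve 2 (λ a b → a :+ b :- (b :+ ((con (+ 1)) :+ a)) := (con (+ 0)) :- (con (+ 1))) refl (fromℕ n) x))) , n≤x
    search zero    x≤n | no 0≰x = ⊥-elim (0≰x 0≤x)
    search (suc n) x≤n | no n≰x with x ≤? fromℕ n
    ... | yes x≤n′ = search n x≤n′
    ... | no  x≰n′ = n , ≰⇒> n≰x , ≰⇒≥ x≰n′

  if-yes : {P A : Set} (d : Dec P) → P → {x y : A} → (if does d then x else y) ≡ x
  if-yes (yes _) _ = refl
  if-yes (no ¬p) p = ⊥-elim (¬p p)

  if-no : {P A : Set} (d : Dec P) → ¬ P → {x y : A} → (if does d then x else y) ≡ y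
  if-no (yes p) ¬p = ⊥-elim (¬p p)
  if-no (no _)  _  = refl

  -- Finite sums

  ∑ : {A : Set} → List A → (A → ℝ) → ℝ
  ∑ xs f = sum (map f xs)

  ∑-mono : {A : Set} {f g : A → ℝ} (xs : List A) → (∀ {x} → x ∈ xs → f x ≤ g x) → ∑ xs f ≤ ∑ xs g
  ∑-mono []       f≤g = ≤-refl
  ∑-mono (x ∷ xs) f≤g = f≤g (here refl) ⊕ ∑-mono xs (f≤g ∘ there)

  ∑-cong : {A : Set} {f g : A → ℝ} (xs : List A) → (∀ {x} → x ∈ xs → f x ≡ g x) → ∑ xs f ≡ ∑ xs g
  ∑-cong []       f≡g = refl
  ∑-cong (x ∷ xs) f≡g = cong₂ _+_ (f≡g (here refl)) (∑-cong xs (f≡g ∘ there))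

  ∑-nonNegative : {A : Set} {f : A → ℝ} (xs : List A) → (∀ {x} → x ∈ xs → 0# ≤ f x) → 0# ≤ ∑ xs f
  ∑-nonNegative []               0≤f = ≤-refl
  ∑-nonNegative {f = f} (x ∷ xs) 0≤f =
    (≤-by (0≤f (here refl) ⊕ ∑-nonNegative xs (0≤f ∘ there)) (solve 2
        (λ a b → a :+ b :- ((con (+ 0)) :+ (con (+ 0))) := a :+ b :- (con (+ 0))) refl (f x) (∑ xs f)))

  ∑-+ : {A : Set} (f g : A → ℝ) (xs : List A) → ∑ xs (λ x → f x + g x) ≡ ∑ xs f + ∑ xs g
  ∑-+ f g []       = sym (+-identityˡ _)
  ∑-+ f g (x ∷ xs) = trans (cong (_+_ _) (∑-+ f g xs)) (solve 4 (λ a b c d → a :+ b :+ (c :+ d) := a :+ c :+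
      (b :+ d)) refl (f x) (g x) (∑ xs f) (∑ xs g))

  ∑-* : {A : Set} (c : ℝ) (f : A → ℝ) (xs : List A) → ∑ xs (λ x → c * f x) ≡ c * ∑ xs f
  ∑-* c f []       = sym (zeroʳ c)
  ∑-* c f (x ∷ xs) = trans (cong (_+_ _) (∑-* c f xs)) (sym (distribˡ c _ _))

  ∑-const : {A : Set} (c : ℝ) (xs : List A) → ∑ xs (λ _ → c) ≡ c * fromℕ (length xs)
  ∑-const c []       = sym (zeroʳ c)
  ∑-const c (x ∷ xs) = trans (cong (_+_ _) (∑-const c xs)) (solve 2 (λ a b → a :+ a :* b := a :* ((con (+ 1)) :+ b))
      refl c (fromℕ (length xs)))

  ∑-++ : {A : Set} (f : A → ℝ) (xs ys : List A) → ∑ (xs ++ ys) f ≡ ∑ xs f + ∑ ys f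
  ∑-++ f []       ys = sym (+-identityˡ _)
  ∑-++ f (x ∷ xs) ys = trans (cong (_+_ _) (∑-++ f xs ys)) (sym (+-assoc _ _ _))

  ∑-map : {A B : Set} (f : B → ℝ) (h : A → B) (xs : List A) → ∑ (map h xs) f ≡ ∑ xs (f ∘ h)
  ∑-map f h xs = cong sum (sym (map-∘ xs))

  ∑-concatMap : {A B : Set} (f : B → ℝ) (h : A → List B) (xs : List A) →
                ∑ (concatMap h xs) f ≡ ∑ xs (λ x → ∑ (h x) f)
  ∑-concatMap f h []       = refl
  ∑-concatMap f h (x ∷ xs) = trans (∑-++ f (h x) (concatMap h xs)) (cong (_+_ _) (∑-concatMap f h xs))

  ∑-filter-≤ : {A : Set} {P : A → Set} (P? : ∀ x → Dec (P x)) {f : A → ℝ} (xs : List A) →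
               (∀ {x} → x ∈ xs → 0# ≤ f x) → ∑ (filter P? xs) f ≤ ∑ xs f
  ∑-filter-≤ P? []       0≤f = ≤-refl
  ∑-filter-≤ P? {f} (x ∷ xs) 0≤f with does (P? x)
  ... | true  = ≤-refl ⊕ ∑-filter-≤ P? xs (0≤f ∘ there)
  ... | false = (≤-by (0≤f (here refl) ⊕ ∑-filter-≤ P? xs (0≤f ∘ there))
      (solve 3 (λ a b c → a :+ b :- ((con (+ 0)) :+ c) := a :+ b :- c) refl (f x) (∑ xs f) (∑ (filter P? xs) f)))

  -- For the effect of a migration on a sum over residents: as the keys are distinct, only one
  -- summand changes and `Δ` is incurred once.
  ∑-change-at : {A : Set} (key : A → ℕ) {f f′ : A → ℝ} {Δ : ℝ} {x : A} (xs : List A) → AllPairs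
      (λ y z → key y ≢ key z) xs → x ∈ xs →
                (∀ {y} → y ∈ xs → key y ≢ key x → f′ y ≤ f y) → f′ x ≤ f x + Δ → ∑ xs f′ ≤ ∑ xs f + Δ
  ∑-change-at key {f} {f′} {Δ} {x} (_ ∷ xs) (x≢ ∷ _) (here refl) same changed =
    (≤-by (changed ⊕ ∑-mono xs (λ y∈ → same (there y∈) (λ eq → All.lookup x≢ y∈ (sym eq))))
        (solve 5 (λ a b c d e → a :+ b :+ c :- (d :+ e) := a :+ c :+ b :- (d :+ e)) refl (f x) Δ (∑ xs f) (f′ x)
        (∑ xs f′)))
  ∑-change-at key {f} {f′} {Δ} {x} (y ∷ xs) (y≢ ∷ uxs) (there x∈) same changed =
    (≤-by (same (here refl) (All.lookup y≢ x∈) ⊕ ∑-change-at key xs uxs x∈ (same ∘ there) changed)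
        (solve 5 (λ a b c d e → a :+ (b :+ c) :- (d :+ e) := a :+ b :+ c :- (d :+ e)) refl (f y) (∑ xs f) Δ (f′ y)
        (∑ xs f′)))

  ∑-gap : {A : Set} {f g : A → ℝ} {Δ : ℝ} {x : A} (xs : List A) → (∀ {y} → y ∈ xs → f y ≤ g y) → x ∈ xs → f x + Δ ≤ g
      x →
          ∑ xs f + Δ ≤ ∑ xs g
  ∑-gap {f = f} {g} {Δ} {x} (_ ∷ xs) f≤g (here refl) gap =
    (≤-by (gap ⊕ ∑-mono xs (f≤g ∘ there)) (solve 5 (λ a b c d e → a :+ b :- (c :+ d :+ e) := a :+ b :- (c :+ e :+ d))
        refl (g x) (∑ xs g) (f x) Δ (∑ xs f)))
  ∑-gap {f = f} {g} {Δ} (y ∷ xs) f≤g (there x∈) gap =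
    (≤-by (f≤g (here refl) ⊕ ∑-gap xs (f≤g ∘ there) x∈ gap) (solve 5
        (λ a b c d e → a :+ b :- (c :+ (d :+ e)) := a :+ b :- (c :+ d :+ e)) refl (g y) (∑ xs g) (f y) (∑ xs f) Δ))

  ∑-filter : {A : Set} {P : A → Set} (P? : ∀ x → Dec (P x)) (f : A → ℝ) (xs : List A) →
             ∑ (filter P? xs) f ≡ ∑ xs (λ x → if does (P? x) then f x else 0#)
  ∑-filter P? f []       = refl
  ∑-filter P? f (x ∷ xs) with does (P? x)
  ... | true  = cong (_+_ (f x)) (∑-filter P? f xs)
  ... | false = trans (∑-filter P? f xs) (sym (+-identityˡ _))

  ∑-filter-drop : {A : Set} {P : A → Set} (P? : ∀ x → Dec (P x)) {f : A → ℝ} {Δ : ℝ} {x : A} (xs : List A) →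
                  (∀ {y} → y ∈ xs → 0# ≤ f y) → x ∈ xs → ¬ P x → Δ ≤ f x → ∑ (filter P? xs) f + Δ ≤ ∑ xs f
  ∑-filter-drop P? {f} {Δ} {x} xs 0≤f x∈ ¬px Δ≤fx = ≡-≤-trans (cong (_+ Δ) (∑-filter P? f xs)) (∑-gap xs below x∈
    (≡-≤-trans (trans (cong (_+ Δ) (if-no (P? x) ¬px)) (+-identityˡ Δ)) Δ≤fx))
    where
    below : ∀ {y} → y ∈ xs → (if does (P? y) then f y else 0#) ≤ f y
    below {y} y∈ with does (P? y)
    ... | true  = ≤-refl
    ... | false = 0≤f y∈

  length-filter≡∑ : {A : Set} {P : A → Set} (P? : ∀ x → Dec (P x)) (xs : List A) →
                    fromℕ (length (filter P? xs)) ≡ ∑ xs (λ x → if does (P? x) then 1# else 0#)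
  length-filter≡∑ P? xs = trans (sym (trans (∑-const 1# (filter P? xs)) (*-identityˡ _))) (∑-filter P? (λ _ → 1#) xs)

  0<fromℕ : ∀ n → 0# < fromℕ (suc n)
  0<fromℕ n = <-≤-trans 0<1 (≤-by (0≤fromℕ n) (solve 1 (λ a → a :- (con (+ 0)) := (con (+ 1)) :+ a :- (con (+ 1)))
      refl (fromℕ n)))

  -- Bin loads

  ∈-delete : {A : Set} {x : A} (ys : List A) → x ∈ ys → ∃ λ zs → length ys ≡ suc (length zs) ×
      (∀ {y} → y ∈ ys → y ≢ x → y ∈ zs)
  ∈-delete (_ ∷ ys) (here refl) = ys , refl , λ { (here refl) y≢x → ⊥-elim (y≢x refl) ; (there y∈) _ → y∈ }
  ∈-delete (z ∷ ys) (there x∈) with ∈-delete ys x∈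
  ... | zs , eq , keep = z ∷ zs , cong suc eq , λ { (here refl) _ → here refl ; (there y∈) y≢x → there (keep y∈ y≢x) }

  Unique-⊆-length : {A : Set} {xs ys : List A} → Unique xs → (∀ {x} → x ∈ xs → x ∈ ys) → length xs ℕ.≤ length ys
  Unique-⊆-length []                             xs⊆ys = z≤n
  Unique-⊆-length {xs = x ∷ xs} {ys} (x∉ ∷ uxs) xs⊆ys with ∈-delete ys (xs⊆ys (here refl))
  ... | zs , eq , keep = subst (suc (length xs) ℕ.≤_) (sym eq)
          (s≤s (Unique-⊆-length uxs λ y∈ → keep (xs⊆ys (there y∈)) λ { refl → All.lookup x∉ y∈ refl }))

  dedup : List ℕ → List ℕ
  dedup = deduplicate ℕ._≟_

  dedup-⊆-length : ∀ {xs ys} → (∀ {x} → x ∈ xs → x ∈ ys) → length (dedup xs) ℕ.≤ length ys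
  dedup-⊆-length {xs} xs⊆ys =
    Unique-⊆-length (DecUnique.deduplicate-! ℕ._≟_ xs) (xs⊆ys ∘ ∈-deduplicate⁻ ℕ._≟_ xs)

  weightIn : ℕ → ℕ → ℝ → ℝ
  weightIn b b′ w = if does (b′ ℕ.≟ b) then w else 0#

  weightIn-same : ∀ b w → weightIn b b w ≡ w
  weightIn-same b w = if-yes (b ℕ.≟ b) refl

  weightIn-other : ∀ {b b′} w → b′ ≢ b → weightIn b b′ w ≡ 0#
  weightIn-other {b} {b′} w b′≢b = if-no (b′ ℕ.≟ b) b′≢b

  0≤weightIn : ∀ b b′ {w} → 0# ≤ w → 0# ≤ weightIn b b′ w
  0≤weightIn b b′ 0≤w with does (b′ ℕ.≟ b)
  ... | true  = 0≤w
  ... | false = ≤-refl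

  load≡∑ : ∀ b ps → load b ps ≡ ∑ ps (λ p → weightIn b (proj₁ p) (proj₂ p))
  load≡∑ b []       = refl
  load≡∑ b (p ∷ ps) with does (proj₁ p ℕ.≟ b)
  ... | true  = cong (_+_ _) (load≡∑ b ps)
  ... | false = trans (load≡∑ b ps) (sym (+-identityˡ _))

  ∑-weightIn : ∀ {bs b} w → Unique bs → b ∈ bs → ∑ bs (λ b′ → weightIn b′ b w) ≡ w
  ∑-weightIn {b ∷ bs} w (b∉ ∷ ubs) (here refl) = trans
    (cong₂ _+_ (weightIn-same b w)
      (trans (∑-cong bs (λ b′∈ → weightIn-other w (All.lookup b∉ b′∈))) (trans (∑-const 0# bs) (zeroˡ _))))
    (+-identityʳ w)
  ∑-weightIn {b ∷ bs} w (b∉ ∷ ubs) (there b∈) = trans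
    (cong₂ _+_ (weightIn-other w (λ b≡ → All.lookup b∉ b∈ (sym b≡))) (∑-weightIn w ubs b∈)) (+-identityˡ w)

  -- Double counting: every size is counted in exactly one of the distinct bins.
  ∑-load : ∀ {bs} → Unique bs → ∀ ps → All (λ p → proj₁ p ∈ bs) ps → ∑ bs (λ b → load b ps) ≡ ∑ ps proj₂
  ∑-load {bs} ubs []       []       = trans (∑-const 0# bs) (zeroˡ _)
  ∑-load {bs} ubs (p ∷ ps) (p∈ ∷ ps∈) = begin
    ∑ bs (λ b → load b (p ∷ ps))
      ≡⟨ ∑-cong bs (λ {b} _ → trans (load≡∑ b (p ∷ ps)) (cong (_+_ _) (sym (load≡∑ b ps)))) ⟩
    ∑ bs (λ b → weightIn b (proj₁ p) (proj₂ p) + load b ps)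
      ≡⟨ ∑-+ _ _ bs ⟩
    ∑ bs (λ b → weightIn b (proj₁ p) (proj₂ p)) + ∑ bs (λ b → load b ps)
      ≡⟨ cong₂ _+_ (∑-weightIn (proj₂ p) ubs p∈) (∑-load ubs ps ps∈) ⟩
    proj₂ p + ∑ ps proj₂ ∎
    where open ≡-Reasoning

  ∑≤length : {A : Set} {f : A → ℝ} (xs : List A) → (∀ {x} → x ∈ xs → f x ≤ 1#) → ∑ xs f ≤ fromℕ (length xs)
  ∑≤length xs f≤1 = ≤-≡-trans (∑-mono xs f≤1) (trans (∑-const 1# xs) (*-identityˡ _))

  total-load≤ : ∀ {bs} → Unique bs → ∀ ps → All (λ p → proj₁ p ∈ bs) ps →
                (∀ {b} → b ∈ bs → load b ps ≤ 1#) → ∑ ps proj₂ ≤ fromℕ (length bs)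
  total-load≤ {bs} ubs ps ps∈ load≤1 = subst (_≤ fromℕ (length bs)) (∑-load ubs ps ps∈) (∑≤length bs load≤1)

  load-skip : ∀ {b p} ps → proj₁ p ≢ b → load b (p ∷ ps) ≡ load b ps
  load-skip {b} ps p≢b = cong (sum ∘ map proj₂) (filter-reject (λ p → proj₁ p ℕ.≟ b) p≢b)

  load-take : ∀ {b p} ps → proj₁ p ≡ b → load b (p ∷ ps) ≡ proj₂ p + load b ps
  load-take {b} ps p≡b = cong (sum ∘ map proj₂) (filter-accept (λ p → proj₁ p ℕ.≟ b) p≡b)

  -- The offline optimum

  open Sort decTotalOrder using (sort; sort-↭; sort-↗)

  Sorted : List ℝ → Set
  Sorted = Linked _≤_

  Sorted-tail : ∀ {p ps} → Sorted (p ∷ ps) → Sorted ps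
  Sorted-tail [-]       = []
  Sorted-tail (_ ∷ sps) = sps

  Sorted-head≤ : ∀ {p ps x} → Sorted (p ∷ ps) → x ∈ p ∷ ps → p ≤ x
  Sorted-head≤ sps         (here refl) = ≤-refl
  Sorted-head≤ (p≤q ∷ sps) (there x∈)  = ≤-trans p≤q (Sorted-head≤ sps x∈)

  -- `stepIntegral` for real-valued integrands, which makes it linear and allows rectangles of
  -- fractional height.
  stepSum : (ℝ → ℝ) → List ℝ → ℝ
  stepSum h (p ∷ q ∷ ps) = (q - p) * h p + stepSum h (q ∷ ps)
  stepSum h _            = 0#

  stepIntegral≡stepSum : ∀ f ps → stepIntegral f ps ≡ stepSum (fromℕ ∘ f) ps
  stepIntegral≡stepSum f []           = refl
  stepIntegral≡stepSum f (p ∷ [])     = refl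
  stepIntegral≡stepSum f (p ∷ q ∷ ps) = cong (_+_ _) (stepIntegral≡stepSum f (q ∷ ps))

  stepSum-mono : ∀ {f h} ps → Sorted ps → (∀ t → f t ≤ h t) → stepSum f ps ≤ stepSum h ps
  stepSum-mono []           _           f≤h = ≤-refl
  stepSum-mono (p ∷ [])     _           f≤h = ≤-refl
  stepSum-mono (p ∷ q ∷ ps) (p≤q ∷ sps) f≤h =
    *-monoʳ-≤ (≤⇒0≤ p≤q) (f≤h p) ⊕ stepSum-mono (q ∷ ps) sps f≤h

  stepSum-+ : ∀ c f h ps → stepSum (λ t → c * f t + h t) ps ≡ c * stepSum f ps + stepSum h ps
  stepSum-+ c f h []           = (solve 1 (λ a → con (+ 0) := a :* (con (+ 0)) :+ (con (+ 0))) refl c)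
  stepSum-+ c f h (p ∷ [])     = (solve 1 (λ a → con (+ 0) := a :* (con (+ 0)) :+ (con (+ 0))) refl c)
  stepSum-+ c f h (p ∷ q ∷ ps) = trans (cong (_+_ _) (stepSum-+ c f h (q ∷ ps)))
    (solve 7 (λ a b c d e f g → (a :- b) :* (c :* d :+ e) :+ (c :* f :+ g) := c :* ((a :- b) :* d :+ f) :+
        ((a :- b) :* e :+ g)) refl q p c (f p) (h p) (stepSum f (q ∷ ps)) (stepSum h (q ∷ ps)))

  stepSum-0 : ∀ ps → stepSum (λ _ → 0#) ps ≡ 0#
  stepSum-0 []           = refl
  stepSum-0 (p ∷ [])     = refl
  stepSum-0 (p ∷ q ∷ ps) = trans (cong (_+_ _) (stepSum-0 (q ∷ ps)))
      (solve 2 (λ a b → (a :- b) :* (con (+ 0)) :+ (con (+ 0)) := con (+ 0)) refl q p)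

  indicator : ℝ → ℝ → ℝ → ℝ
  indicator u v t = if does (u ≤? t) then (if does (t <? v) then 1# else 0#) else 0#

  indicator-in : ∀ {u v t} → u ≤ t → t < v → indicator u v t ≡ 1#
  indicator-in {u} {v} {t} u≤t t<v = trans (if-yes (u ≤? t) u≤t) (if-yes (t <? v) t<v)

  indicator-before : ∀ {u v t} → t < u → indicator u v t ≡ 0#
  indicator-before {u} {v} {t} t<u = if-no (u ≤? t) (<⇒≱ t<u)

  indicator-after : ∀ {u v t} → v ≤ t → indicator u v t ≡ 0#
  indicator-after {u} {v} {t} v≤t with does (u ≤? t)
  ... | false = refl
  ... | true  = if-no (t <? v) (λ t<v → <⇒≱ t<v v≤t)

  stepSum-after : ∀ {u v} ps → Sorted ps → All (v ≤_) ps → stepSum (indicator u v) ps ≡ 0#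
  stepSum-after []           _   _           = refl
  stepSum-after (p ∷ [])     _   _           = refl
  stepSum-after {u} {v} (p ∷ q ∷ ps) sps (v≤p ∷ v≤ps) = begin
    (q - p) * indicator u v p + stepSum (indicator u v) (q ∷ ps)
      ≡⟨ cong₂ (λ x y → (q - p) * x + y) (indicator-after v≤p) (stepSum-after (q ∷ ps) (Sorted-tail sps) v≤ps) ⟩
    (q - p) * 0# + 0# ≡⟨ (solve 2 (λ a b → (a :- b) :* (con (+ 0)) :+ (con (+ 0)) := con (+ 0)) refl q p) ⟩
    0# ∎
    where open ≡-Reasoning

  stepSum-until : ∀ {u v} p ps → Sorted (p ∷ ps) → u ≤ p → v ∈ p ∷ ps → stepSum (indicator u v) (p ∷ ps) ≡ v - p
  stepSum-until {u} {v} p ps sps u≤p v∈ with v ≟ p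
  ... | yes refl = trans (stepSum-after {u} {v} (p ∷ ps) sps (All.tabulate (Sorted-head≤ sps))) (sym (-‿inverseʳ v))
  stepSum-until         p ps       sps         u≤p (here v≡p) | no v≢p = ⊥-elim (v≢p v≡p)
  stepSum-until {u} {v} p (q ∷ ps) (p≤q ∷ sps) u≤p (there v∈) | no v≢p = begin
    (q - p) * indicator u v p + stepSum (indicator u v) (q ∷ ps)
      ≡⟨ cong₂ (λ x y → (q - p) * x + y) (indicator-in u≤p (≤-trans p≤q (Sorted-head≤ sps v∈) , v≢p ∘ sym))
               (stepSum-until q ps sps (≤-trans u≤p p≤q) v∈) ⟩
    (q - p) * 1# + (v - q) ≡⟨ (solve 3 (λ a b c → (a :- b) :* (con (+ 1)) :+ (c :- a) := c :- b) refl q p v) ⟩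
    v - p ∎
    where open ≡-Reasoning

  -- The sum samples the function at left ends of gaps, so it is exact because both ends of the
  -- interval are breakpoints.
  stepSum-indicator : ∀ {u v} ps → Sorted ps → u ≤ v → u ∈ ps → v ∈ ps → stepSum (indicator u v) ps ≡ v - u
  stepSum-indicator {u} {v} (p ∷ ps) sps u≤v u∈ v∈ with u ≟ p
  ... | yes refl = stepSum-until p ps sps ≤-refl v∈
  stepSum-indicator         (p ∷ ps) sps u≤v (here u≡p) v∈ | no u≢p = ⊥-elim (u≢p u≡p)
  stepSum-indicator {u} {v} (p ∷ ps) sps u≤v (there u∈) (here refl) | no u≢p =
    ⊥-elim (u≢p (≤-antisym u≤v (Sorted-head≤ sps (there u∈))))
  stepSum-indicator {u} {v} (p ∷ q ∷ ps) (p≤q ∷ sps) u≤v (there u∈) (there v∈) | no u≢p = begin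
    (q - p) * indicator u v p + stepSum (indicator u v) (q ∷ ps)
      ≡⟨ cong₂ (λ x y → (q - p) * x + y) (indicator-before (≤-trans p≤q (Sorted-head≤ sps u∈) , u≢p ∘ sym))
               (stepSum-indicator (q ∷ ps) sps u≤v u∈ v∈) ⟩
    (q - p) * 0# + (v - u) ≡⟨ (solve 4 (λ a b c d → (a :- b) :* (con (+ 0)) :+ (c :- d) := c :- d) refl q p v u) ⟩
    v - u ∎
    where open ≡-Reasoning

  -- A rectangle over a time interval. Functions of time that are compared with `optAt` pointwise
  -- are sums of such rectangles, and their integrals are then total areas.
  record Bar : Set where
    constructor bar
    field
      height start end : ℝ

  open Bar

  area : List Bar → ℝ
  area bs = ∑ bs (λ b → height b * (end b - start b))

  heightAt : List Bar → ℝ → ℝ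
  heightAt bs t = ∑ bs (λ b → height b * indicator (start b) (end b) t)

  breakpoints : Instance → List ℝ
  breakpoints I = sort (concatMap (λ x → arrival x ∷ departure x ∷ []) (items I))

  WellPlaced : Instance → Bar → Set
  WellPlaced I b = start b ≤ end b × start b ∈ breakpoints I × end b ∈ breakpoints I

  arrival≤departure : ∀ x → arrival x ≤ departure x
  arrival≤departure x = (≤-by (proj₁ (0<duration x)) (solve 2 (λ a b → a :- (con (+ 0)) := b :+ a :- b) refl
      (duration x) (arrival x)))

  arrival-breakpoint : ∀ I {x} → x ∈ items I → arrival x ∈ breakpoints I
  arrival-breakpoint I x∈ = ∈-resp-↭ (↭-sym (sort-↭ _))
    (∈-concatMap⁺ (λ x → arrival x ∷ departure x ∷ []) (Any.map (λ { refl → here refl }) x∈))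

  departure-breakpoint : ∀ I {x} → x ∈ items I → departure x ∈ breakpoints I
  departure-breakpoint I x∈ = ∈-resp-↭ (↭-sym (sort-↭ _))
    (∈-concatMap⁺ (λ x → arrival x ∷ departure x ∷ []) (Any.map (λ { refl → there (here refl) }) x∈))

  stepSum-bars : ∀ I bs → All (WellPlaced I) bs → stepSum (heightAt bs) (breakpoints I) ≡ area bs
  stepSum-bars I []       []               = stepSum-0 (breakpoints I)
  stepSum-bars I (b ∷ bs) ((u≤v , u∈ , v∈) ∷ wbs) = trans
    (stepSum-+ (height b) (indicator (start b) (end b)) (heightAt bs) (breakpoints I))
    (cong₂ (λ x y → height b * x + y) (stepSum-indicator _ (sort-↗ _) u≤v u∈ v∈) (stepSum-bars I bs wbs))

  area≤OPT : ∀ I bs → All (WellPlaced I) bs → (∀ t → heightAt bs t ≤ fromℕ (optAt I t)) → area bs ≤ OPT I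
  area≤OPT I bs wbs below = subst₂ _≤_ (stepSum-bars I bs wbs)
    (sym (stepIntegral≡stepSum (optAt I) (breakpoints I))) (stepSum-mono (breakpoints I) (sort-↗ _) below)

  OPT≤area : ∀ I bs → All (WellPlaced I) bs → (∀ t → fromℕ (optAt I t) ≤ heightAt bs t) → OPT I ≤ area bs
  OPT≤area I bs wbs above = subst₂ _≤_ (sym (stepIntegral≡stepSum (optAt I) (breakpoints I)))
    (stepSum-bars I bs wbs) (stepSum-mono (breakpoints I) (sort-↗ _) above)

  -- The graph of the search in the definition of minBins.
  data Search (ss : List ℝ) : ℕ → ℕ → ℕ → Set where
    exhausted : ∀ {m} → Search ss zero m m
    hit       : ∀ {n m} → Packable m ss → Search ss (suc n) m m
    miss      : ∀ {n m r} → ¬ Packable m ss → Search ss n (suc m) r → Search ss (suc n) m r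

  -- The search is local to minBins and cannot be named: abstracting its two
  -- arguments lets unification put it for the underscore.
  mutual
    minBins-search : ∀ ss → Search ss (length ss) 0 (minBins ss)
    minBins-search ss with length ss
    ... | n with 0
    ...   | m = search-graph ss n m

    search-graph : ∀ ss n m → Search ss n m _
    search-graph ss zero    m = exhausted
    search-graph ss (suc n) m with packable? m ss
    ... | yes p = hit p
    ... | no ¬p = miss ¬p (search-graph ss n (suc m))

  Search-bound : ∀ {ss n m r k} → Search ss n m r → Packable k ss → m ℕ.≤ k → r ℕ.≤ k
  Search-bound exhausted   p m≤k = m≤k
  Search-bound (hit _)     p m≤k = m≤k
  Search-bound {ss} (miss ¬p s) p m≤k = Search-bound s p (ℕ.≤∧≢⇒< m≤k λ { refl → ¬p p })

  minBins-minimal : ∀ {k} ss → Packable k ss → minBins ss ℕ.≤ k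
  minBins-minimal ss p = Search-bound (minBins-search ss) p z≤n

  Search-result : ∀ {ss n m r} → Search ss n m r → Packable r ss ⊎ r ≡ n ℕ.+ m
  Search-result exhausted             = inj₂ refl
  Search-result (hit p)               = inj₁ p
  Search-result {n = suc n} {m} (miss _ s) with Search-result s
  ... | inj₁ p  = inj₁ p
  ... | inj₂ eq = inj₂ (trans eq (ℕ.+-suc n m))

  -- When the fuel runs out the search returns the length without testing it. Both alternatives
  -- bound the total size by `minBins`: the first by the loads, the second because sizes are at most
  -- 1.
  minBins-result : ∀ ss → Packable (minBins ss) ss ⊎ minBins ss ≡ length ss
  minBins-result ss with Search-result (minBins-search ss)
  ... | inj₁ p  = inj₁ p
  ... | inj₂ eq = inj₂ (trans eq (ℕ.+-identityʳ _))

  zip-bins : ∀ {m} (ss : List ℝ) (v : Vec (Fin m) (length ss)) → All (λ p → proj₁ p ∈ upTo m)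
      (zip (map toℕ (Vec.toList v)) ss)
  zip-bins []       []      = []
  zip-bins (s ∷ ss) (i ∷ v) = ∈-upTo⁺ (Fin.toℕ<n i) ∷ zip-bins ss v

  zip-sizes : ∀ {m} ss (v : Vec (Fin m) (length ss)) → ∑ (zip (map toℕ (Vec.toList v)) ss) proj₂ ≡ sum ss
  zip-sizes []       []      = refl
  zip-sizes (s ∷ ss) (i ∷ v) = cong (_+_ s) (zip-sizes ss v)

  Packable⇒sum≤ : ∀ {m} ss → Packable m ss → sum ss ≤ fromℕ m
  Packable⇒sum≤ {m} ss (v , fits) = subst₂ _≤_ (zip-sizes ss v) (cong fromℕ (length-upTo m))
    (total-load≤ (Unique.upTo⁺ m) (zip (map toℕ (Vec.toList v)) ss) (zip-bins ss v) λ b∈ →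
      let b<m = ∈-upTo⁻ b∈ in
      subst (λ b → load b (zip (map toℕ (Vec.toList v)) ss) ≤ 1#) (Fin.toℕ-fromℕ< b<m) (fits (fromℕ< b<m)))

  sum≤minBins : ∀ ss → All (_≤ 1#) ss → sum ss ≤ fromℕ (minBins ss)
  sum≤minBins ss ss≤1 with minBins-result ss
  ... | inj₁ p  = Packable⇒sum≤ ss p
  ... | inj₂ eq = subst₂ _≤_ (cong sum (map-id ss)) (cong fromℕ (sym eq)) (∑≤length {f = id} ss (All.lookup ss≤1))

  1≤minBins : ∀ {s} ss → s ∈ ss → 1 ℕ.≤ minBins ss
  1≤minBins ss@(_ ∷ _) _ with minBins ss | minBins-result ss
  ... | suc _ | _             = s≤s z≤n
  ... | zero  | inj₁ ((() ∷ _) , _)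

  -- g′ + 1 items per bin, where r more items go into bin b before the next bin is
  -- opened.
  fill : ℕ → ℕ → ℕ → ℕ → List ℕ
  fill g′ b r       zero    = []
  fill g′ b (suc r) (suc n) = b ∷ fill g′ b r n
  fill g′ b zero    (suc n) = suc b ∷ fill g′ (suc b) g′ n

  load-fill-before : ∀ {g′ b c} r (ss : List ℝ) → c ℕ.< b → load c (zip (fill g′ b r (length ss)) ss) ≡ 0#
  load-fill-before r       []       c<b = refl
  load-fill-before (suc r) (s ∷ ss) c<b =
    trans (load-skip (zip (fill _ _ r (length ss)) ss) (ℕ.<⇒≢ c<b ∘ sym)) (load-fill-before r ss c<b)
  load-fill-before {g′} zero (s ∷ ss) c<b =
    trans (load-skip (zip (fill g′ _ g′ (length ss)) ss) (ℕ.<⇒≢ (ℕ.m<n⇒m<1+n c<b) ∘ sym))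
        (load-fill-before g′ ss (ℕ.m<n⇒m<1+n c<b))

  fill-vec : ∀ g′ {m} b r j (ss : List ℝ) → length ss ℕ.≤ r ℕ.+ j ℕ.* suc g′ → b ℕ.+ j ℕ.< m →
             ∃ λ (v : Vec (Fin m) (length ss)) → map toℕ (Vec.toList v) ≡ fill g′ b r (length ss)
  fill-vec g′ b r j [] _ _ = [] , refl
  fill-vec g′ b (suc r) j (s ∷ ss) (s≤s n≤) b+j<m with fill-vec g′ b r j ss n≤ b+j<m
  ... | v , eq = (fromℕ< b<m ∷ v) , cong₂ _∷_ (Fin.toℕ-fromℕ< b<m) eq
    where b<m = ℕ.≤-<-trans (ℕ.m≤m+n b j) b+j<m
  fill-vec g′ {m} b zero (suc j) (s ∷ ss) (s≤s n≤) b+j<m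
    with fill-vec g′ {m} (suc b) g′ j ss n≤ (subst (ℕ._< m) (ℕ.+-suc b j) b+j<m)
  ... | v , eq = (fromℕ< b<m ∷ v) , cong₂ _∷_ (Fin.toℕ-fromℕ< b<m) eq
    where b<m = ℕ.≤-<-trans (ℕ.m≤m+n (suc b) j) (subst (ℕ._< m) (ℕ.+-suc b j) b+j<m)

  module _ {w : ℝ} (0≤w : 0# ≤ w) where

    load-fill-at : ∀ {g′ b} r ss → All (_≡ w) ss → load b (zip (fill g′ b r (length ss)) ss) ≤ fromℕ r * w
    load-fill-at r [] _ = *-nonNegative (0≤fromℕ r) 0≤w
    load-fill-at {g′} {b} (suc r) (s ∷ ss) (refl ∷ ss≡) = ≡-≤-trans
        ((load-take {b} (zip (fill g′ b r (length ss)) ss) refl))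
      ((≤-by (load-fill-at r ss ss≡) (solve 3 (λ a b c → a :* b :- c := ((con (+ 1)) :+ a) :* b :- (b :+ c)) refl
          (fromℕ r) w (load b (zip (fill g′ b r (length ss)) ss)))))
    load-fill-at {g′} {b} zero (s ∷ ss) _ = ≤-reflexive (trans
      (trans (load-skip (zip (fill g′ (suc b) g′ (length ss)) ss) (ℕ.<⇒≢ (ℕ.n<1+n b) ∘ sym))
          (load-fill-before {g′} g′ ss (ℕ.n<1+n b)))
      (sym (zeroˡ w)))

    load-fill-after : ∀ {g′ b c} r ss → All (_≡ w) ss → b ℕ.< c →
                      load c (zip (fill g′ b r (length ss)) ss) ≤ fromℕ (suc g′) * w
    load-fill-after {g′} r [] _ _ = *-nonNegative (0≤fromℕ (suc g′)) 0≤w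
    load-fill-after (suc r) (s ∷ ss) (_ ∷ ss≡) b<c =
      ≡-≤-trans ((load-skip (zip (fill _ _ r (length ss)) ss) (ℕ.<⇒≢ b<c))) (load-fill-after r ss ss≡ b<c)
    load-fill-after {g′} {b} {c} zero (s ∷ ss) (refl ∷ ss≡) b<c with suc b ℕ.≟ c
    ... | yes refl = ≡-≤-trans ((load-take {suc b} (zip (fill g′ (suc b) g′ (length ss)) ss) refl))
      ((≤-by (load-fill-at {g′} g′ ss ss≡) (solve 3 (λ a b c → a :* b :- c := ((con (+ 1)) :+ a) :* b :- (b :+ c))
          refl (fromℕ g′) w (load (suc b) (zip (fill g′ (suc b) g′ (length ss)) ss)))))
    ... | no  b+1≢c = ≡-≤-trans ((load-skip (zip (fill g′ (suc b) g′ (length ss)) ss) b+1≢c))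
      (load-fill-after g′ ss ss≡ (ℕ.≤∧≢⇒< b<c b+1≢c))

    Packable-equal : ∀ g′ j ss → All (_≡ w) ss → fromℕ (suc g′) * w ≤ 1# →
                     length ss ℕ.≤ suc j ℕ.* suc g′ → Packable (suc j) ss
    Packable-equal g′ j ss ss≡ gw≤1 n≤ with fill-vec g′ {suc j} 0 (suc g′) j ss n≤ (ℕ.n<1+n j)
    ... | v , eq = v , λ b → subst (λ ks → load (toℕ b) (zip ks ss) ≤ 1#) (sym eq) (≤-trans (bound (toℕ b)) gw≤1)
      where
      bound : ∀ c → load c (zip (fill g′ 0 (suc g′) (length ss)) ss) ≤ fromℕ (suc g′) * w
      bound zero    = load-fill-at (suc g′) ss ss≡
      bound (suc c) = load-fill-after (suc g′) ss ss≡ (s≤s z≤n)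

  -- The volume as a lower bound on the optimum

  volume : Instance → ℝ
  volume I = ∑ (items I) (λ x → size x * duration x)

  itemBar : (Item → ℝ) → Item → Bar
  itemBar h x = bar (h x) (arrival x) (departure x)

  itemBar-wellPlaced : ∀ I h {x} → x ∈ items I → WellPlaced I (itemBar h x)
  itemBar-wellPlaced I h {x} x∈ = arrival≤departure x , arrival-breakpoint I x∈ , departure-breakpoint I x∈

  present : ℝ → List Item → List Item
  present t xs = filter (λ x → t <? departure x) (filter (λ x → arrival x ≤? t) xs)

  heightAt-items : ∀ h t xs → heightAt (map (itemBar h) xs) t ≡ sum (map h (present t xs))
  heightAt-items h t []       = refl
  heightAt-items h t (x ∷ xs) = by-cases (arrival x ≤? t) (t <? departure x)
    where
    open ≡-Reasoning
    by-cases : Dec (arrival x ≤ t) → Dec (t < departure x) →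
               heightAt (map (itemBar h) (x ∷ xs)) t ≡ sum (map h (present t (x ∷ xs)))
    by-cases (no a≰t)  _ = begin
      h x * indicator (arrival x) (departure x) t + heightAt (map (itemBar h) xs) t
        ≡⟨ cong₂ (λ i y → h x * i + y) (indicator-before (≰⇒> a≰t)) (heightAt-items h t xs) ⟩
      h x * 0# + sum (map h (present t xs)) ≡⟨ (solve 2 (λ a b → a :* (con (+ 0)) :+ b := b) refl (h x)
          (sum (map h (present t xs)))) ⟩
      sum (map h (present t xs))
        ≡⟨ cong (λ ys → sum (map h (filter (λ y → t <? departure y) ys)))
            (sym (filter-reject (λ y → arrival y ≤? t) a≰t)) ⟩
      sum (map h (present t (x ∷ xs))) ∎
    by-cases (yes a≤t) (no t≮d) = begin
      h x * indicator (arrival x) (departure x) t + heightAt (map (itemBar h) xs) t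
        ≡⟨ cong₂ (λ i y → h x * i + y) (indicator-after (≮⇒≥ t≮d)) (heightAt-items h t xs) ⟩
      h x * 0# + sum (map h (present t xs)) ≡⟨ (solve 2 (λ a b → a :* (con (+ 0)) :+ b := b) refl (h x)
          (sum (map h (present t xs)))) ⟩
      sum (map h (present t xs))
        ≡⟨ cong (sum ∘ map h) (sym (trans (cong (filter (λ y → t <? departure y))
            (filter-accept (λ y → arrival y ≤? t) a≤t))
                                          (filter-reject (λ y → t <? departure y) t≮d))) ⟩
      sum (map h (present t (x ∷ xs))) ∎
    by-cases (yes a≤t) (yes t<d) = begin
      h x * indicator (arrival x) (departure x) t + heightAt (map (itemBar h) xs) t
        ≡⟨ cong₂ (λ i y → h x * i + y) (indicator-in a≤t t<d) (heightAt-items h t xs) ⟩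
      h x * 1# + sum (map h (present t xs)) ≡⟨ cong (_+ sum (map h (present t xs))) (*-identityʳ _) ⟩
      h x + sum (map h (present t xs))
        ≡⟨ cong (sum ∘ map h) (sym (trans (cong (filter (λ y → t <? departure y))
            (filter-accept (λ y → arrival y ≤? t) a≤t))
                                          (filter-accept (λ y → t <? departure y) t<d))) ⟩
      sum (map h (present t (x ∷ xs))) ∎

  area-items : ∀ h xs → area (map (itemBar h) xs) ≡ ∑ xs (λ x → h x * duration x)
  area-items h xs = trans (∑-map _ (itemBar h) xs)
    (∑-cong xs λ {x} _ → cong (_*_ (h x)) (solve 2 (λ a b → a :+ b :- a := b) refl (arrival x) (duration x)))

  -- At every time the items present need at least as many bins as their total size. Each item
  -- contributes a rectangle with its size as height and its stay as width.
  volume≤OPT : ∀ I → volume I ≤ OPT I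
  volume≤OPT I = subst (_≤ OPT I) (area-items size (items I))
    (area≤OPT I (map (itemBar size) (items I)) (All.map⁺ (All.tabulate (itemBar-wellPlaced I size))) λ t →
      subst (_≤ fromℕ (optAt I t)) (sym (heightAt-items size t (items I)))
        (sum≤minBins (sizesAt I t) (All.map⁺ (All.universal size≤1 _))))

  1≤optAt : ∀ I {x t} → x ∈ items I → arrival x ≤ t → t < departure x → 1# ≤ fromℕ (optAt I t)
  1≤optAt I x∈ a≤t t<d = ≡-≤-trans (sym (+-identityʳ 1#)) (fromℕ-mono-≤
    (1≤minBins (sizesAt I _) (∈-map⁺ size (∈-filter⁺ (λ x → _ <? departure x)
        (∈-filter⁺ (λ x → arrival x ≤? _) x∈ a≤t) t<d))))

  0≤OPT : ∀ I → 0# ≤ OPT I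
  0≤OPT I = ≤-trans (∑-nonNegative (items I) (λ {x} _ → *-nonNegative (0≤size x) (proj₁ (0<duration x))))
      (volume≤OPT I)

  -- Time covered by stretched items

  reach : ℝ → Item → ℝ
  reach ρ x = arrival x + ρ * duration x

  -- The measure of what the intervals [arrival , reach) of items in order of
  -- arrival cover beyond the horizon h.
  sweep : ℝ → ℝ → List Item → ℝ
  sweep ρ h []       = 0#
  sweep ρ h (x ∷ xs) = (h ⊔ reach ρ x) - (h ⊔ arrival x) + sweep ρ (h ⊔ reach ρ x) xs

  InOrder : List Item → Set
  InOrder = AllPairs (λ x y → arrival x ≤ arrival y)

  inOrder : ∀ I → InOrder (items I)
  inOrder I = Linked⇒AllPairs ≤-trans (sorted I)

  arrival≤reach : ∀ {ρ} → 0# ≤ ρ → ∀ x → arrival x ≤ reach ρ x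
  arrival≤reach {ρ} 0≤ρ x =
    (≤-by (*-nonNegative 0≤ρ (proj₁ (0<duration x))) (solve 3 (λ a b c → a :* b :- (con (+ 0)) := c :+ a :* b :- c)
        refl ρ (duration x) (arrival x)))

  -- c is the start of the current component of the union of the unstretched
  -- intervals, which so far reaches up to h; z is the credit from earlier components.
  sweep-stretch : ∀ {ρ} → 1# ≤ ρ → ∀ xs {h hρ c z} → InOrder xs → All (λ x → c ≤ arrival x) xs → c ≤ h → h ≤ hρ → 0#
      ≤ z →
                  c + ρ * (h - c) ≤ hρ + z → sweep ρ hρ xs ≤ ρ * sweep 1# h xs + z
  sweep-stretch {ρ} 1≤ρ [] {z = z} _ _ _ _ 0≤z _ = (≤-by (0≤z) (solve 2
      (λ a b → a :- (con (+ 0)) := b :* (con (+ 0)) :+ a :- (con (+ 0))) refl z ρ))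
  sweep-stretch {ρ} 1≤ρ (x ∷ xs) {h} {hρ} {c} {z} (x≤xs ∷ ixs) (c≤a ∷ c≤as) c≤h h≤hρ 0≤z bound = by-cases (a ≤? h)
    where
    a = arrival x
    d = duration x
    e = reach ρ x
    e₁ = reach 1# x
    0≤ρ : 0# ≤ ρ
    0≤ρ = ≤-trans 0≤1 1≤ρ
    e₁≤e : e₁ ≤ e
    e₁≤e = (≤-by (*-nonNegative (≤⇒0≤ 1≤ρ) (proj₁ (0<duration x)))
        (solve 3 (λ a b c → (a :- (con (+ 1))) :* b :- (con (+ 0)) := c :+ a :* b :- (c :+ (con (+ 1)) :* b)) refl ρ
        d a))
    S = sweep ρ (hρ ⊔ e) xs
    S₁ = λ h → sweep 1# h xs

    by-cases : Dec (a ≤ h) → sweep ρ hρ (x ∷ xs) ≤ ρ * sweep 1# h (x ∷ xs) + z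
    by-cases (yes a≤h) = subst₂ (λ u v → (hρ ⊔ e) - u + S ≤ ρ * (h′ - v + S₁ h′) + z)
      (sym (⊔-≥ (≤-trans a≤h h≤hρ))) (sym (⊔-≥ a≤h))
      (≤-by (rest) (solve 8 (λ a b c d e f g h → a :* b :+ (c :+ a :* (d :- e) :- (f :- g)) :- h := a :*
          (d :- e :+ b) :+ c :- (f :- g :+ h)) refl ρ s z h′ h hρ′ hρ S))
      where
      h′ = h ⊔ e₁
      hρ′ = hρ ⊔ e
      s = S₁ h′
      h≤h′ : h ≤ h′
      h≤h′ = x≤x⊔y h e₁
      0≤ρ[h′-h] : 0# ≤ ρ * (h′ - h)
      0≤ρ[h′-h] = *-nonNegative 0≤ρ (≤⇒0≤ h≤h′)
      credit : hρ′ ≤ z + ρ * (h′ - h) + hρ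
      credit = ⊔-lub
        (≤-by (0≤z ⊕ 0≤ρ[h′-h]) (solve 5 (λ a b c d e → a :+ b :* (c :- d) :- ((con (+ 0)) :+ (con (+ 0))) := a :+ b
            :* (c :- d) :+ e :- e) refl z ρ h′ h hρ))
        -- The stretched end `a + ρ d` is at most `c + ρ (a + d - c)`, the end after stretching the
        -- whole component from its start `c`, because `c ≤ a` and `1 ≤ ρ`.
        (≤-by (bound ⊕ *-monoʳ-≤ 0≤ρ (y≤x⊔y h e₁) ⊕ *-nonNegative (≤⇒0≤ 1≤ρ) (≤⇒0≤ c≤a))
            (solve 8 (λ a b c d e f g h → a :+ b :+ c :* d :+ (c :- (con (+ 1))) :* (e :- f) :-
            (f :+ c :* (g :- f) :+ c :* (e :+ (con (+ 1)) :* h) :+ (con (+ 0))) := b :+ c :* (d :- g) :+ a :-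
            (e :+ c :* h)) refl hρ z ρ h′ a c h d))
      rest : S ≤ ρ * s + (z + ρ * (h′ - h) - (hρ′ - hρ))
      rest = sweep-stretch 1≤ρ xs ixs c≤as (≤-trans c≤h h≤h′)
        (⊔-lub (≤-trans h≤hρ (x≤x⊔y hρ e)) (≤-trans e₁≤e (y≤x⊔y hρ e)))
        (≤-by (credit) (solve 6 (λ a b c d e f → a :+ b :* (c :- d) :+ e :- f := a :+ b :* (c :- d) :- (f :- e) :-
            (con (+ 0))) refl z ρ h′ h hρ hρ′))
        (≤-by (bound) (solve 7 (λ a b c d e f g → a :+ b :- (c :+ d :* (e :- c)) := f :+
            (b :+ d :* (g :- e) :- (f :- a)) :- (c :+ d :* (g :- c))) refl hρ z c ρ h hρ′ h′))
    -- A new component starts at `a`, whatever the stretched horizon is; overlap of the stretched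
    -- components only adds to the credit.
    by-cases (no a≰h) = subst₂ (λ u v → hρ′ - p + S ≤ ρ * (u - v + S₁ u) + z)
      (sym (⊔-≤ (≤-trans h≤a (arrival≤reach 0≤1 x)))) (sym (⊔-≤ h≤a))
      (≤-by (rest) (solve 8 (λ a b c d e f g h → a :* b :+ (c :+ a :* d :- (e :- f)) :- g := a :*
          (h :+ (con (+ 1)) :* d :- h :+ b) :+ c :- (e :- f :+ g)) refl ρ s z d hρ′ p S a))
      where
      h≤a = ≰⇒≥ a≰h
      p = hρ ⊔ a
      hρ′ = hρ ⊔ e
      s = S₁ e₁
      credit : hρ′ ≤ z + ρ * d + p
      credit = ⊔-lub
        (≤-by (0≤z ⊕ *-nonNegative 0≤ρ (proj₁ (0<duration x)) ⊕ x≤x⊔y hρ a)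
            (solve 5 (λ a b c d e → a :+ b :* c :+ d :- ((con (+ 0)) :+ (con (+ 0)) :+ e) := a :+ b :* c :+ d :- e)
            refl z ρ d p hρ))
        (≤-by (0≤z ⊕ y≤x⊔y hρ a) (solve 5 (λ a b c d e → a :+ b :- ((con (+ 0)) :+ c) := a :+ d :* e :+ b :-
            (c :+ d :* e)) refl z p a ρ d))
      rest : S ≤ ρ * s + (z + ρ * d - (hρ′ - p))
      rest = sweep-stretch 1≤ρ xs {c = a} ixs x≤xs (arrival≤reach 0≤1 x) (≤-trans e₁≤e (y≤x⊔y hρ e))
        (≤-by (credit) (solve 5 (λ a b c d e → a :+ b :* c :+ d :- e := a :+ b :* c :- (e :- d) :- (con (+ 0))) refl
            z ρ d p hρ′))
        (≤-by (0≤z ⊕ y≤x⊔y hρ a) (solve 6 (λ a b c d e f → a :+ b :- ((con (+ 0)) :+ c) := d :+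
            (a :+ e :* f :- (d :- b)) :- (c :+ e :* (c :+ (con (+ 1)) :* f :- c))) refl z p a hρ′ ρ d))

  -- Rectangles of height 1 over consecutive disjoint pieces of the union that `sweep` with `ρ = 1`
  -- measures; pieces may be empty.
  coverBars : ℝ → List Item → List Bar
  coverBars h []       = []
  coverBars h (x ∷ xs) = bar 1# (h ⊔ arrival x) (h ⊔ reach 1# x) ∷ coverBars (h ⊔ reach 1# x) xs

  area-coverBars : ∀ h xs → area (coverBars h xs) ≡ sweep 1# h xs
  area-coverBars h []       = refl
  area-coverBars h (x ∷ xs) = cong₂ _+_ (*-identityˡ _) (area-coverBars _ xs)

  reach-1 : ∀ x → reach 1# x ≡ departure x
  reach-1 x = cong (_+_ (arrival x)) (*-identityˡ _)

  ⊔-∈ : ∀ {x y zs} → x ∈ zs → y ∈ zs → x ⊔ y ∈ zs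
  ⊔-∈ {x} {y} {zs} x∈ y∈ with ≤-total x y
  ... | inj₁ x≤y = subst (_∈ zs) (sym (⊔-≤ x≤y)) y∈
  ... | inj₂ y≤x = subst (_∈ zs) (sym (⊔-≥ y≤x)) x∈

  coverBars-wellPlaced : ∀ I {h} xs → (∀ {x} → x ∈ xs → x ∈ items I) → h ∈ breakpoints I → All (WellPlaced I)
      (coverBars h xs)
  coverBars-wellPlaced I {h} []       xs⊆ h∈ = []
  coverBars-wellPlaced I {h} (x ∷ xs) xs⊆ h∈ =
    (⊔-lub (x≤x⊔y h _) (≤-trans (arrival≤reach 0≤1 x) (y≤x⊔y h _)) , ⊔-∈ h∈ (arrival-breakpoint I (xs⊆ (here refl)))
        , end∈)
    ∷ coverBars-wellPlaced I xs (xs⊆ ∘ there) end∈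
    where
    end∈ : h ⊔ reach 1# x ∈ breakpoints I
    end∈ = ⊔-∈ h∈ (subst (_∈ breakpoints I) (sym (reach-1 x)) (departure-breakpoint I (xs⊆ (here refl))))

  coverBars-before : ∀ {h t} xs → t < h → heightAt (coverBars h xs) t ≡ 0#
  coverBars-before         []       t<h = refl
  coverBars-before {h} {t} (x ∷ xs) t<h = trans
    (cong₂ (λ i y → 1# * i + y) (indicator-before (<-≤-trans t<h (x≤x⊔y h _)))
        (coverBars-before xs (<-≤-trans t<h (x≤x⊔y h _))))
    (solve 0 ((con (+ 1)) :* (con (+ 0)) :+ (con (+ 0)) := con (+ 0)) refl)

  -- At most one bar covers `t`, since later bars start only at the horizon set by the end of this
  -- one. Beyond the horizon `h` the bar of an item lies within the item's own stay, so that a bin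
  -- is needed there.
  coverBars≤optAt : ∀ I t h xs → (∀ {x} → x ∈ xs → x ∈ items I) → heightAt (coverBars h xs) t ≤ fromℕ (optAt I t)
  coverBars≤optAt I t h []       xs⊆ = 0≤fromℕ (optAt I t)
  coverBars≤optAt I t h (x ∷ xs) xs⊆ = by-cases (t <? (h ⊔ reach 1# x)) ((h ⊔ arrival x) ≤? t)
    where
    H = heightAt (coverBars (h ⊔ reach 1# x) xs) t
    by-cases : Dec (t < h ⊔ reach 1# x) → Dec (h ⊔ arrival x ≤ t) → heightAt (coverBars h (x ∷ xs)) t ≤ fromℕ
        (optAt I t)
    by-cases (no t≮e) _ = ≡-≤-trans
      (trans (cong (λ i → 1# * i + H) (indicator-after (≮⇒≥ t≮e)))
          (solve 1 (λ a → (con (+ 1)) :* (con (+ 0)) :+ a := a) refl H))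
      (coverBars≤optAt I t _ xs (xs⊆ ∘ there))
    by-cases (yes t<e) (no a≰t) = ≡-≤-trans
      (trans (cong₂ (λ i y → 1# * i + y) (indicator-before (≰⇒> a≰t)) (coverBars-before xs t<e))
          (solve 0 ((con (+ 1)) :* (con (+ 0)) :+ (con (+ 0)) := con (+ 0)) refl))
      (0≤fromℕ (optAt I t))
    by-cases (yes t<e) (yes a≤t) = ≡-≤-trans
      (trans (cong₂ (λ i y → 1# * i + y) (indicator-in a≤t t<e) (coverBars-before xs t<e))
          (solve 0 ((con (+ 1)) :* (con (+ 1)) :+ (con (+ 0)) := con (+ 1)) refl))
      (1≤optAt I (xs⊆ (here refl)) (≤-trans (y≤x⊔y h _) a≤t) t<d)
      where
      t<d : t < departure x
      t<d = ≰⇒> λ d≤t → <⇒≱ t<e (⊔-lub (≤-trans (x≤x⊔y h _) a≤t) (≡-≤-trans (reach-1 x) d≤t))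

  sweep≤OPT : ∀ I → sweep 1# 0# (items I) ≤ OPT I
  sweep≤OPT I = by-items (items I) refl
    where
    by-items : ∀ xs → items I ≡ xs → sweep 1# 0# xs ≤ OPT I
    by-items []       eq = area≤OPT I [] [] (λ t → 0≤fromℕ (optAt I t))
    -- Bars must start at breakpoints, and 0 need not be one. Moving the horizon to the first
    -- arrival does not change what is swept.
    by-items (x ∷ xs) eq = ≡-≤-trans (trans shift (sym (area-coverBars (arrival x) (x ∷ xs))))
      (area≤OPT I (coverBars (arrival x) (x ∷ xs))
        (coverBars-wellPlaced I (x ∷ xs) xs⊆ (arrival-breakpoint I (xs⊆ (here refl))))
        (λ t → coverBars≤optAt I t _ (x ∷ xs) xs⊆))
      where
      xs⊆ : ∀ {y} → y ∈ x ∷ xs → y ∈ items I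
      xs⊆ {y} = subst (y ∈_) (sym eq)
      shift : sweep 1# 0# (x ∷ xs) ≡ sweep 1# (arrival x) (x ∷ xs)
      shift = cong₂ (λ u v → v - u + sweep 1# v xs)
        (trans (⊔-≤ (0≤arrival x)) (sym (⊔-≤ ≤-refl)))
        (trans (⊔-≤ (≤-trans (0≤arrival x) (arrival≤reach 0≤1 x))) (sym (⊔-≤ (arrival≤reach 0≤1 x))))

  sweep-shift : ∀ {ρ h h′} → 0# ≤ ρ → ∀ xs → h ≤ h′ → All (λ x → h′ ≤ arrival x) xs → sweep ρ h′ xs ≡ sweep ρ h xs
  sweep-shift 0≤ρ []       h≤h′ []         = refl
  sweep-shift {ρ} 0≤ρ (x ∷ xs) h≤h′ (h′≤a ∷ _) = cong₂ (λ u v → v - u + sweep ρ v xs)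
    (trans (⊔-≤ h′≤a) (sym (⊔-≤ (≤-trans h≤h′ h′≤a))))
    (trans (⊔-≤ h′≤e) (sym (⊔-≤ (≤-trans h≤h′ h′≤e))))
    where h′≤e = ≤-trans h′≤a (arrival≤reach 0≤ρ x)

  -- Runs

  find-cases : {A : Set} {P : A → Set} (P? : ∀ x → Dec (P x)) (xs : List A) →
               (∃ λ x → x ∈ xs × P x × find P? xs ≡ just x) ⊎ ((∀ {x} → x ∈ xs → ¬ P x) × find P? xs ≡ nothing)
  find-cases P? []       = inj₂ ((λ ()) , refl)
  find-cases P? (x ∷ xs) with P? x
  ... | yes px = inj₁ (x , here refl , px , refl)
  ... | no ¬px with find-cases P? xs
  ...   | inj₁ (y , y∈ , py , eq) = inj₁ (y , there y∈ , py , eq)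
  ...   | inj₂ (none , eq)        = inj₂ ((λ { (here refl) → ¬px ; (there y∈) → none y∈ }) , eq)

  filter-map : {A B : Set} {P : B → Set} (P? : ∀ y → Dec (P y)) (f : A → B) (xs : List A) →
               filter P? (map f xs) ≡ map f (filter (P? ∘ f) xs)
  filter-map P? f []       = refl
  filter-map P? f (x ∷ xs) with does (P? (f x))
  ... | true  = cong (f x ∷_) (filter-map P? f xs)
  ... | false = filter-map P? f xs

  filter-cong : {A : Set} {P Q : A → Set} (P? : ∀ x → Dec (P x)) (Q? : ∀ x → Dec (Q x)) (xs : List A) →
                (∀ {x} → x ∈ xs → P x → Q x) → (∀ {x} → x ∈ xs → Q x → P x) → filter P? xs ≡ filter Q? xs
  filter-cong P? Q? []       to from = refl
  filter-cong P? Q? (x ∷ xs) to from with P? x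
  ... | yes p = trans (cong (x ∷_) (filter-cong P? Q? xs (to ∘ there) (from ∘ there)))
      (sym (filter-accept Q? (to (here refl) p)))
  ... | no ¬p = trans (filter-cong P? Q? xs (to ∘ there) (from ∘ there))
      (sym (filter-reject Q? (¬p ∘ from (here refl))))

  earliest-∈ : ∀ e es → earliest e es ∈ e ∷ es
  earliest-∈ e []       = here refl
  earliest-∈ e (f ∷ fs) with does (signalTime e ≤? signalTime f)
  ... | false = there (earliest-∈ f fs)
  ... | true with earliest-∈ e fs
  ...   | here eq = here eq
  ...   | there p = there (there p)

  earliest-≤ : ∀ e es {f} → f ∈ e ∷ es → signalTime (earliest e es) ≤ signalTime f
  earliest-≤ e []       (here refl) = ≤-refl
  earliest-≤ e (f ∷ fs) p with signalTime e ≤? signalTime f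
  earliest-≤ e (f ∷ fs) (here refl)         | yes _   = earliest-≤ e fs (here refl)
  earliest-≤ e (f ∷ fs) (there (here refl)) | yes e≤f = ≤-trans (earliest-≤ e fs (here refl)) e≤f
  earliest-≤ e (f ∷ fs) (there (there p))   | yes _   = earliest-≤ e fs (there p)
  earliest-≤ e (f ∷ fs) (here refl)         | no e≰f  = ≤-trans (earliest-≤ f fs (here refl)) (≰⇒≥ e≰f)
  earliest-≤ e (f ∷ fs) (there p)           | no _    = earliest-≤ f fs p

  data Candidate (alarm : Maybe ℝ) (st : State) : Signal → Set where
    departs : ∀ {r} → r ∈ active st → Candidate alarm st (departure! (leaves r))
    arrives : ∀ {x xs} → future st ≡ x ∷ xs → Candidate alarm st (arrival! x xs)
    alarms  : ∀ {t} → alarm ≡ just t → Candidate alarm st (alarm! t)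

  candidate : ∀ alarm st {s} → s ∈ signals alarm st → Candidate alarm st s
  candidate alarm st@(state _ rs _ fut _ _) s∈ with ∈-++⁻ (map (λ r → departure! (leaves r)) rs) s∈
  ... | inj₁ s∈rs with ∈-map⁻ (λ r → departure! (leaves r)) s∈rs
  ...   | _ , r∈ , refl = departs r∈
  candidate alarm    st@(state _ rs _ (x ∷ xs) _ _) s∈ | inj₂ (here refl) = arrives refl
  candidate (just t) st@(state _ rs _ (x ∷ xs) _ _) s∈ | inj₂ (there (here refl)) = alarms refl
  candidate (just t) st@(state _ rs _ []       _ _) s∈ | inj₂ (here refl) = alarms refl

  candidate-∈ : ∀ {alarm st s} → Candidate alarm st s → s ∈ signals alarm st
  candidate-∈ (departs r∈) = ∈-++⁺ˡ (∈-map⁺ (λ r → departure! (leaves r)) r∈)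
  candidate-∈ {st = state _ rs _ _ _ _} (arrives refl) = ∈-++⁺ʳ (map (λ r → departure! (leaves r)) rs) (here refl)
  candidate-∈ {st = state _ rs _ [] _ _} (alarms refl) = ∈-++⁺ʳ (map (λ r → departure! (leaves r)) rs) (here refl)
  candidate-∈ {st = state _ rs _ (_ ∷ _) _ _} (alarms refl) = ∈-++⁺ʳ (map (λ r → departure! (leaves r)) rs)
      (there (here refl))

  -- What both bounds use about the next event: it is one of the possible signals and none of them
  -- is earlier.
  record Upcoming (alarm : Maybe ℝ) (st : State) (s : Signal) : Set where
    field
      isCandidate : Candidate alarm st s
      isFirst     : ∀ {s′} → Candidate alarm st s′ → signalTime s ≤ signalTime s′

  open Upcoming

  WaitResult : Maybe ℝ → State → Set
  WaitResult alarm st = (∃ λ s → Upcoming alarm st s × waitFor alarm st ≡ occur s st) ⊎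
                        (waitFor alarm st ≡ illegal × (∀ {s} → ¬ Candidate alarm st s))

  waitFor-upcoming : ∀ alarm st → WaitResult alarm st
  waitFor-upcoming alarm st = by-cases (signals alarm st) refl
    where
    waitFor-∷ : ∀ {e es} → signals alarm st ≡ e ∷ es → waitFor alarm st ≡ occur (earliest e es) st
    waitFor-∷ eq with signals alarm st
    waitFor-∷ refl | _ ∷ _ = refl
    waitFor-[] : signals alarm st ≡ [] → waitFor alarm st ≡ illegal
    waitFor-[] eq with signals alarm st
    waitFor-[] refl | [] = refl
    by-cases : ∀ ss → signals alarm st ≡ ss → WaitResult alarm st
    by-cases [] eq = inj₂ (waitFor-[] eq , λ {s} c → case subst (s ∈_) eq (candidate-∈ c) of λ ())
    by-cases (e ∷ es) eq = inj₁ (earliest e es , record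
      { isCandidate = candidate alarm st (subst (earliest e es ∈_) (sym eq) (earliest-∈ e es))
      ; isFirst     = λ {s′} c → earliest-≤ e es (subst (s′ ∈_) eq (candidate-∈ c))
      } , waitFor-∷ eq)

  guestLoad : ℕ → List Resident → ℝ
  guestLoad b rs = ∑ rs (λ r → weightIn b (bin r) (weight r))

  load≡guestLoad : ∀ b rs → load b (map (λ r → bin r , weight r) rs) ≡ guestLoad b rs
  load≡guestLoad b rs = trans (load≡∑ b (map (λ r → bin r , weight r) rs))
    (∑-map (λ p → weightIn b (proj₁ p) (proj₂ p)) (λ r → bin r , weight r) rs)

  -- A copy, accessible by name, of the function `move` that is local to `migrateTo`.
  reassign : ℝ → ℕ → ℕ → Resident → Resident
  reassign C i b r = if does (name r ℕ.≟ i) then record r { bin = b ; leaves = leaves r + C } else r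

  migrateTo-next : ∀ {C i b st r} → find (λ r → name r ℕ.≟ i) (active st) ≡ just r → bin r ≢ b → Fits (weight r) b
      (active st) →
                   migrateTo C i b st ≡ next (record st { active = map (reassign C i b) (active st) ; history =
                       migrated i b ∷ history st })
  migrateTo-next {C} {i} {b} {st} {r} found r≢b fits rewrite found =
    trans (if-no (bin r ℕ.≟ b) r≢b) (if-yes (fits? (weight r) b (active st)) fits)

  Over : State → Set
  Over st = active st ≡ [] × pending st ≡ nothing × future st ≡ []

  over? : ∀ st → Dec (Over st)
  over? (state _ []      nothing  []      _ _) = yes (refl , refl , refl)
  over? (state _ (_ ∷ _) _        _       _ _) = no λ { (() , _) }
  over? (state _ []      (just _) _       _ _) = no λ { (_ , () , _) }
  over? (state _ []      nothing  (_ ∷ _) _ _) = no λ { (_ , _ , ()) }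

  step-busy : ∀ {C σ} st → ¬ Over st → step C σ st ≡ perform C (σ (history st)) st
  step-busy (state _ []      nothing  []      _ _) busy = ⊥-elim (busy (refl , refl , refl))
  step-busy (state _ (_ ∷ _) _        _       _ _) busy = refl
  step-busy (state _ []      (just _) _       _ _) busy = refl
  step-busy (state _ []      nothing  (_ ∷ _) _ _) busy = refl

  step-over : ∀ {C σ} st → Over st → step C σ st ≡ finished
  step-over (state _ [] nothing [] _ _) (refl , refl , refl) = refl

  -- The algorithm

  soonest : List ℝ → Maybe ℝ
  soonest []       = nothing
  soonest (t ∷ ts) = just (Maybe.maybe′ (t ⊓_) t (soonest ts))

  soonest-cases : ∀ ts → (ts ≡ [] × soonest ts ≡ nothing) ⊎ (∃ λ u → soonest ts ≡ just u × u ∈ ts ×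
      (∀ {v} → v ∈ ts → u ≤ v))
  soonest-cases []       = inj₁ (refl , refl)
  soonest-cases (t ∷ ts) with soonest ts | soonest-cases ts
  ... | _ | inj₁ (refl , refl) = inj₂ (t , refl , here refl , λ { (here refl) → ≤-refl })
  ... | _ | inj₂ (u , refl , u∈ , u≤) with ≤-total t u
  ...   | inj₁ t≤u = inj₂ (t , refl , here refl , λ { (here refl) → ≤-refl ; (there v∈) → ≤-trans t≤u (u≤ v∈) })
  ...   | inj₂ u≤t = inj₂ (u , refl , there u∈ , λ { (here refl) → u≤t ; (there v∈) → u≤ v∈ })

  module Algorithm (C √C : ℝ) where

    -- Residents are stored with leaving time 0, closed bins with the time at which
    -- they are to be cleared.
    data Memory : Set where
      memory : (time : ℝ) (waiting : Maybe ℝ) (count : ℕ) (stock : List Resident) (short long fresh : ℕ)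
          (closed : List (ℕ × ℝ)) → Memory

    rebin : ℕ → ℕ → Resident → Resident
    rebin i b r = if does (name r ℕ.≟ i) then record r { bin = b } else r

    update : Observation → Memory → Memory
    update (arrived t s)   (memory _ _ n rs sh lo fr cl) = memory t (just s) n rs sh lo fr cl
    update (departed t ns) (memory _ w n rs sh lo fr cl) = memory t w n (filter (λ r → ¬? (name r ∈? ns)) rs) sh lo
        fr cl
    update (alarmed t)     (memory _ w n rs sh lo fr cl) = memory t w n rs sh lo fr cl
    update (placed b)      (memory t w n rs sh lo fr cl) =
      let rs′ = resident n (Maybe.fromMaybe 0# w) b 0# ∷ rs in
      -- The decision is read off from the observed bin: the strategy leaves the current bin only on
      -- overflow, and this closes it.
      if does (b ℕ.≟ sh) then memory t nothing (suc n) rs′ sh lo fr cl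
                         else memory t nothing (suc n) rs′ b lo (suc fr) ((sh , t + √C) ∷ cl)
    update (migrated i b)  (memory t w n rs sh lo fr cl) =
      if does (b ℕ.≟ lo) then memory t w n (map (rebin i b) rs) sh lo fr cl
                         else memory t w n (map (rebin i b) rs) sh b (suc fr) ((lo , t + fromℕ 2 * C) ∷ cl)

    recall : List Observation → Memory
    recall []      = memory 0# nothing 0 [] 0 1 2 []
    recall (o ∷ h) = update o (recall h)

    Due : ℝ → List (ℕ × ℝ) → Resident → Set
    Due t cl r = Any (λ p → bin r ≡ proj₁ p × proj₂ p ≤ t) cl

    due? : ∀ t cl r → Dec (Due t cl r)
    due? t cl r = Any.any? (λ p → (bin r ℕ.≟ proj₁ p) ×-dec (proj₂ p ≤? t)) cl

    -- Strictly in the future, since an alarm at the present time is illegal.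
    deadlines : ℝ → List (ℕ × ℝ) → List ℝ
    deadlines t cl = filter (t <?_) (map proj₂ cl)

    clear : ℝ → List Resident → ℕ → ℕ → List (ℕ × ℝ) → Maybe Resident → Action
    clear t rs lo fr cl (just r) = migrate (name r) (if does (fits? (weight r) lo rs) then lo else fr)
    clear t rs lo fr cl nothing  = wait (soonest (deadlines t cl))

    decide : Memory → Action
    decide (memory t (just s) n rs sh lo fr cl) = place (if does (fits? s sh rs) then sh else fr)
    decide (memory t nothing  n rs sh lo fr cl) = clear t rs lo fr cl (find (due? t cl) rs)

    strategy′ : Strategy
    strategy′ h = decide (recall h)

    -- The common source of a resident of the actual state and of its copy in the memory. It records
    -- the original item and the number of migrations, which the analysis needs; `toView` erases
    -- what depends on the duration.
    record Guest : Set where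
      constructor guest
      field
        who        : Item
        moves      : ℕ
        label slot : ℕ

      leave : ℝ
      leave = departure who + fromℕ moves * C

    open Guest

    toResident : Guest → Resident
    toResident g = resident (label g) (size (who g)) (slot g) (leave g)

    toView : Guest → Resident
    toView g = resident (label g) (size (who g)) (slot g) 0#

    loadIn : ℕ → List Guest → ℝ
    loadIn b gs = ∑ gs (λ g → weightIn b (slot g) (size (who g)))

    -- State and memory in one, together with `horizon`, which exists for the analysis: no stretched
    -- interval of a guest extends beyond it, and time is paid for up to it.
    record Configuration : Set where
      constructor conf
      field
        time             : ℝ
        guests           : List Guest
        arriving         : Maybe Item
        later            : List Item
        count            : ℕ
        log              : List Observation
        short long fresh : ℕ
        closed           : List (ℕ × ℝ)
        horizon          : ℝ

    toState : Configuration → State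
    toState (conf t gs w xs n h _ _ _ _ _) = state t (map toResident gs) w xs n h

    toMemory : Configuration → Memory
    toMemory (conf t gs w xs n h sh lo fr cl _) = memory t (Maybe.map size w) n (map toView gs) sh lo fr cl

    -- The earliest time of the (k + 1)-st migration.
    ready : Item → ℕ → ℝ
    ready x k = arrival x + √C + fromℕ 2 * C * fromℕ k

    -- Migration stretches stays at most by the factor ρ, and a closed bin of new items
    -- is empty within time T.
    module Analysis (ρ T : ℝ) (1≤C : 1# ≤ C) (0≤T : 0# ≤ T) (T≤√C : T ≤ √C) (1≤ρ : 1# ≤ ρ) where

      -- From time `u - δ` on, a closed bin due at `u` causes no further cost.
      δ : ℝ
      δ = √C - T

      0≤C : 0# ≤ C
      0≤C = ≤-trans 0≤1 1≤C

      0≤ρ : 0# ≤ ρ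
      0≤ρ = ≤-trans 0≤1 1≤ρ

      -- The first part: an item old enough for its next migration can afford another delay. The
      -- second part gives the two ways in which a closed bin becomes empty in time: it is cleared
      -- at its deadline, or its items have left by themselves.
      Admissible : Item → Set
      Admissible x = (∀ k → √C + fromℕ k * C ≤ duration x → fromℕ (suc k) * C ≤ (ρ - 1#) * duration x) ×
                     (δ ≡ 0# ⊎ ρ * duration x ≤ T)

      -- `unmoved` and `moved` keep the two areas apart. This makes `deadline` true when a bin is
      -- closed: an unmoved item is ready `√C` after its arrival, and a moved one `2 C` after the
      -- time at which it was ready before.
      record Welcome (t H : ℝ) (sh lo fr : ℕ) (cl : List (ℕ × ℝ)) (g : Guest) : Set where
        field
          stays    : t ≤ leave g
          modest   : fromℕ (moves g) * C ≤ (ρ - 1#) * duration (who g)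
          within   : reach ρ (who g) ≤ H
          fine     : Admissible (who g)
          known    : slot g ℕ.< fr
          located  : slot g ∈ sh ∷ lo ∷ map proj₁ cl
          unmoved  : moves g ≡ 0 → slot g ≢ lo × arrival (who g) ≤ t
          moved    : ∀ {k} → moves g ≡ suc k → slot g ≢ sh × ready (who g) k ≤ t
          deadline : ∀ {b u} → (b , u) ∈ cl → slot g ≡ b → ready (who g) (moves g) ≤ u

      Arriving : ℝ → ℝ → Maybe Item → Set
      Arriving t H nothing  = ⊤
      Arriving t H (just x) = Admissible x × arrival x ≡ t × reach ρ x ≤ H

      -- `remembers` ties the strategy to the configuration: its decisions, computed from `log`,
      -- become functions of `toMemory`.
      record Invariant (c : Configuration) : Set where
        open Configuration c
        field
          remembers : recall log ≡ toMemory c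
          labels    : All (λ g → label g ℕ.< count) guests
          distinct  : AllPairs (λ g g′ → label g ≢ label g′) guests
          welcome   : All (Welcome time horizon short long fresh closed) guests
          now≤H     : time ≤ horizon
          admitted  : All Admissible later
          ordered   : InOrder later
          upcoming  : All (λ x → time ≤ arrival x) later
          newcomer  : Arriving time horizon arriving
          short<    : short ℕ.< fresh
          long<     : long ℕ.< fresh
          short≢long : short ≢ long
          closed<   : All (λ p → proj₁ p ℕ.< fresh × proj₁ p ≢ short × proj₁ p ≢ long) closed

      spare : Guest → ℝ
      spare g = (ρ - 1#) * duration (who g) - fromℕ (moves g) * C

      -- A size can enter two overflow inequalities `load + size > 1`: once as the item that
      -- overflows and once as part of the load. A closed bin lives for `T` or `2 C`; hence `2 T`
      -- per unit of size for the placement and `4 C` for every migration, of which `(ρ - 1) d / C`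
      -- are possible.
      charge : Item → ℝ
      charge x = fromℕ 2 * (T * size x) + fromℕ 4 * (size x * ((ρ - 1#) * duration x))

      remaining : ℝ → ℝ → ℝ
      remaining t u = 0# ⊔ (u - δ - t)

      onItem : (Item → ℝ) → Maybe Item → ℝ
      onItem f nothing  = 0#
      onItem f (just x) = f x

      -- The potential pays for the open bins: 2 for the two bins being filled, while
      -- any item is present, and the remaining lifetime of every closed bin.
      potential : Configuration → ℝ
      potential (conf t gs w xs n h sh lo fr cl H) =
        fromℕ 2 * (H - t + sweep ρ H xs) + ∑ cl (λ p → remaining t (proj₂ p)) + T * loadIn sh gs + fromℕ 2 * C *
            loadIn lo gs
        + ∑ xs charge + onItem charge w + ∑ gs (λ g → fromℕ 4 * (size (who g) * spare g))

      ringing : ℝ → ℝ → ℝ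
      ringing t u = if does (t <? u) then 1# else 0#

      -- The 3 stands for the placement, the departure and the alarm of a bin closed by the
      -- placement. A migration uses up `C ≥ 1` of `spare`; the factor 2 counts it and the alarm of
      -- a bin that it may close.
      effort : Item → ℝ
      effort x = fromℕ 3 + fromℕ 2 * ((ρ - 1#) * duration x)

      -- Bounds the number of steps to come.
      measure : Configuration → ℝ
      measure (conf t gs w xs n h sh lo fr cl H) =
        ∑ xs (λ x → 1# + effort x) + onItem effort w + ∑ gs (λ g → 1# + fromℕ 2 * spare g) + ∑ cl
            (λ p → ringing t (proj₂ p))

      record Step (c : Configuration) : Set where
        constructor stepTo
        field
          target  : Configuration
          goes    : step C strategy′ (toState c) ≡ next (toState target)
          keeps   : Invariant target
          pays    : (now (toState target) - now (toState c)) * fromℕ (openBins (toState c)) + potential target ≤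
              potential c
          shrinks : measure target + 1# ≤ measure c

      stretched : ∀ {t H sh lo fr cl g} → Welcome t H sh lo fr cl g → leave g ≤ reach ρ (who g)
      stretched {g = g} ok = (≤-by (Welcome.modest ok) (solve 5 (λ a b c d e → (a :- (con (+ 1))) :* b :- c :* d := e
          :+ a :* b :- (e :+ b :+ c :* d)) refl ρ d k C a))
        where
        a = arrival (who g)
        d = duration (who g)
        k = fromℕ (moves g)

      0≤spare : ∀ {t H sh lo fr cl g} → Welcome t H sh lo fr cl g → 0# ≤ spare g
      0≤spare ok = ≤⇒0≤ (Welcome.modest ok)

      0≤spareItem : ∀ x → 0# ≤ (ρ - 1#) * duration x
      0≤spareItem x = *-nonNegative (≤⇒0≤ 1≤ρ) (proj₁ (0<duration x))

      loadIn-fresh : ∀ b gs → All (λ g → slot g ℕ.< b) gs → loadIn b gs ≡ 0#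
      loadIn-fresh b gs gs< = trans (∑-cong gs (λ {g} g∈ → weightIn-other (size (who g)) (ℕ.<⇒≢ (All.lookup gs< g∈))))
                                    (trans (∑-const 0# gs) (zeroˡ _))

      fits-residents : ∀ {s} b gs → loadIn b gs + s ≤ 1# → Fits s b (map toResident gs)
      fits-residents b gs p = ≡-≤-trans (cong (_+ _) (trans (load≡guestLoad b (map toResident gs))
          (∑-map _ toResident gs))) p

      fits-views : ∀ {s} b gs → loadIn b gs + s ≤ 1# → Fits s b (map toView gs)
      fits-views b gs p = ≡-≤-trans (cong (_+ _) (trans (load≡guestLoad b (map toView gs)) (∑-map _ toView gs))) p

      views-fit : ∀ {s} b gs → Fits s b (map toView gs) → loadIn b gs + s ≤ 1#
      views-fit b gs p = ≡-≤-trans (cong (_+ _) (sym (trans (load≡guestLoad b (map toView gs)) (∑-map _ toView gs))))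
          p

      goes-by : ∀ {st a} → ¬ Over st → strategy′ (history st) ≡ a → step C strategy′ st ≡ perform C a st
      goes-by {st} busy eq = trans (step-busy st busy) (cong (λ a → perform C a st) eq)

      placeIn-next : ∀ {b x t rs xs n h} → Fits (size x) b rs →
                     placeIn b x (state t rs (just x) xs n h) ≡ next
                         (state t (resident n (size x) b (departure x) ∷ rs) nothing xs (suc n) (placed b ∷ h))
      placeIn-next {b} {x} {rs = rs} fits = if-yes (fits? (size x) b rs) fits

      ringing≤1 : ∀ t u → ringing t u ≤ 1#
      ringing≤1 t u with does (t <? u)
      ... | true  = ≤-refl
      ... | false = 0≤1

      0≤ringing : ∀ t u → 0# ≤ ringing t u
      0≤ringing t u with does (t <? u)
      ... | true  = 0≤1
      ... | false = ≤-refl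

      remaining-short : ∀ t → remaining t (t + √C) ≡ T
      remaining-short t = trans (cong (0# ⊔_) (solve 3 (λ a b c → a :+ b :- (b :- c) :- a := c) refl t √C T))
          (⊔-≤ 0≤T)

      remaining-long : ∀ t → remaining t (t + fromℕ 2 * C) ≤ fromℕ 2 * C
      remaining-long t = ⊔-lub (*-nonNegative (0≤fromℕ 2) 0≤C) (≤-by (T≤√C)
          (solve 4 (λ a b c d → a :- b := (num 2) :* c :- (d :+ (num 2) :* c :- (a :- b) :- d)) refl √C T C t))

      fresh-guest : Item → ℕ → ℕ → Guest
      fresh-guest x n b = guest x 0 n b

      leave-fresh : ∀ x n b → leave (fresh-guest x n b) ≡ departure x
      leave-fresh x n b = (solve 2 (λ a b → a :+ (con (+ 0)) :* b := a) refl (departure x) C)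

      -- The step that places a new item

      module Placing {t gs x xs n h sh lo fr cl H} (inv : Invariant (conf t gs (just x) xs n h sh lo fr cl H)) where
        open Invariant inv
        c = conf t gs (just x) xs n h sh lo fr cl H
        s = size x
        e = (ρ - 1#) * duration x
        o = fromℕ (openBins (toState c))
        V = H - t + sweep ρ H xs
        W = ∑ cl (λ p → remaining t (proj₂ p))
        L₁ = loadIn sh gs
        L₂ = loadIn lo gs
        F = ∑ xs charge
        R = ∑ gs (λ g → fromℕ 4 * (size (who g) * spare g))

        slots< : All (λ g → slot g ℕ.< fr) gs
        slots< = All.map Welcome.known welcome

        0≤T*s : 0# ≤ T * s
        0≤T*s = *-nonNegative 0≤T (0≤size x)

        new : ℕ → Guest
        new = fresh-guest x n

        placement : ∀ b → Fits s b (map toResident gs) → decide (toMemory c) ≡ place b →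
                    step C strategy′ (toState c) ≡ next (state t (toResident (new b) ∷ map toResident gs) nothing xs
                        (suc n) (placed b ∷ h))
        placement b fits eq = trans (goes-by (λ { (_ , () , _) }) (trans (cong decide remembers) eq))
          (trans (placeIn-next {b} {x} fits)
            (cong (λ l → next (state t (resident n s b l ∷ map toResident gs) nothing xs (suc n) (placed b ∷ h)))
                (sym (leave-fresh x n b))))

        labels′ : ∀ b → All (λ g → label g ℕ.< suc n) (new b ∷ gs)
        labels′ b = ℕ.n<1+n n ∷ All.map ℕ.m<n⇒m<1+n labels

        distinct′ : ∀ b → AllPairs (λ g g′ → label g ≢ label g′) (new b ∷ gs)
        distinct′ b = All.map (λ g<n → ℕ.<⇒≢ g<n ∘ sym) labels ∷ distinct

        new-welcome : ∀ {sh′ fr′ cl′ b} → b ℕ.< fr′ → b ∈ sh′ ∷ lo ∷ map proj₁ cl′ → b ≢ lo →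
            (∀ {b′ u} → (b′ , u) ∈ cl′ → b ≢ b′) →
                      Welcome t H sh′ lo fr′ cl′ (new b)
        new-welcome b<fr b∈ b≢lo open′ = record
          { stays    = (≤-by (≤-reflexive (sym (proj₁ (proj₂ newcomer))) ⊕ proj₁ (0<duration x))
              (solve 4 (λ a b c d → a :+ b :- (c :+ (con (+ 0))) := a :+ b :+ (con (+ 0)) :* d :- c) refl (arrival x)
              (duration x) t C))
          ; modest   = ≡-≤-trans (zeroˡ C) (0≤spareItem x)
          ; within   = proj₂ (proj₂ newcomer)
          ; fine     = proj₁ newcomer
          ; known    = b<fr
          ; located  = b∈
          ; unmoved  = λ _ → b≢lo , ≤-reflexive (proj₁ (proj₂ newcomer))
          ; moved    = λ ()
          ; deadline = λ p∈ b≡ → ⊥-elim (open′ p∈ b≡)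
          }

        current : loadIn sh gs + s ≤ 1# → Step c
        current fits = stepTo (conf t (new sh ∷ gs) nothing xs (suc n) (placed sh ∷ h) sh lo fr cl H)
          (placement sh (fits-residents sh gs fits) (cong place (if-yes (fits? s sh (map toView gs))
              (fits-views sh gs fits))))
          (record
            { remembers  = trans (cong (update (placed sh)) remembers) (if-yes (sh ℕ.≟ sh) refl)
            ; labels     = labels′ sh
            ; distinct   = distinct′ sh
            ; welcome    = new-welcome short< (here refl) short≢long
                (λ p∈ b≡ → proj₁ (proj₂ (All.lookup closed< p∈)) (sym b≡)) ∷ welcome
            ; now≤H      = now≤H
            ; admitted   = admitted
            ; ordered    = ordered
            ; upcoming   = upcoming
            ; newcomer   = tt
            ; short<     = short<
            ; long<      = long<
            ; short≢long = short≢long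
            ; closed<    = closed<
            })
          (≡-≤-trans (cong₂ (λ u v → (t - t) * o + (fromℕ 2 * V + W + T * (u + L₁) + fromℕ 2 * C * (v + L₂) + F + 0#
              + (fromℕ 4 * (s * (e - 0# * C)) + R)))
                       (weightIn-same sh s) (weightIn-other s short≢long))
            -- One `T * s` of the charge is kept as load of the current bin; the other one is
            -- surplus here.
            (≤-by (0≤T*s) (solve 12 (λ a b c d e f g h i j k l → a :* b :- (con (+ 0)) := (num 2) :* c :+ d :+ a :* e
                :+ (num 2) :* f :* g :+ h :+ ((num 2) :* (a :* b) :+ (num 4) :* (b :* i)) :+ j :-
                ((k :- k) :* l :+ ((num 2) :* c :+ d :+ a :* (b :+ e) :+ (num 2) :* f :* ((con (+ 0)) :+ g) :+ h :+
                (con (+ 0)) :+ ((num 4) :* (b :* (i :- (con (+ 0)) :* f)) :+ j)))) refl T s V W L₁ C L₂ F e R t o)))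
          (≤-by (0≤1) (solve 5 (λ a b c d e → (con (+ 1)) :- (con (+ 0)) := a :+ ((num 3) :+ (num 2) :* b) :+ c :+ d
              :- (a :+ (con (+ 0)) :+ ((con (+ 1)) :+ (num 2) :* (b :- (con (+ 0)) :* e) :+ c) :+ d :+ (con (+ 1))))
              refl N e G A C))
          where
          N = ∑ xs (λ y → 1# + effort y)
          G = ∑ gs (λ g → 1# + fromℕ 2 * spare g)
          A = ∑ cl (λ p → ringing t (proj₂ p))

        overflow : ¬ (loadIn sh gs + s ≤ 1#) → Step c
        overflow full = stepTo (conf t (new fr ∷ gs) nothing xs (suc n) (placed fr ∷ h) fr lo (suc fr)
            ((sh , t + √C) ∷ cl) H)
          (placement fr (fits-residents fr gs (≡-≤-trans (cong (_+ s) empty) (≡-≤-trans (+-identityˡ s) (size≤1 x))))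
            (cong place (if-no (fits? s sh (map toView gs)) (full ∘ views-fit sh gs))))
          (record
            { remembers  = trans (cong (update (placed fr)) remembers) (if-no (fr ℕ.≟ sh) (ℕ.<⇒≢ short< ∘ sym))
            ; labels     = labels′ fr
            ; distinct   = distinct′ fr
            ; welcome    = new-welcome (ℕ.n<1+n fr) (here refl) (ℕ.<⇒≢ long< ∘ sym)
                             (λ { (here refl) fr≡sh → ℕ.<⇒≢ short< (sym fr≡sh) ; (there p∈) fr≡b → ℕ.<⇒≢
                                 (proj₁ (All.lookup closed< p∈)) (sym fr≡b) })
                           ∷ All.map old-welcome welcome
            ; now≤H      = now≤H
            ; admitted   = admitted
            ; ordered    = ordered
            ; upcoming   = upcoming
            ; newcomer   = tt
            ; short<     = ℕ.n<1+n fr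
            ; long<      = ℕ.m<n⇒m<1+n long<
            ; short≢long = ℕ.<⇒≢ long< ∘ sym
            ; closed<    = (ℕ.m<n⇒m<1+n short< , ℕ.<⇒≢ short< , short≢long)
                           ∷ All.map (λ { (b<fr , _ , b≢lo) → ℕ.m<n⇒m<1+n b<fr , ℕ.<⇒≢ b<fr , b≢lo }) closed<
            })
          (≡-≤-trans (trans
            (cong₂ (λ r u → E r u (loadIn fr gs) (weightIn lo fr s)) (remaining-short t) (weightIn-same fr s))
            (cong₂ (E T s) empty (weightIn-other s (ℕ.<⇒≢ long< ∘ sym))))
            -- The load of the old bin and one `T * s` together exceed the `T` that the closed bin
            -- costs; the other `T * s` is kept as load of the new bin.
            (≤-by (*-nonNegative 0≤T (≤⇒0≤ (≰⇒≥ full))) (solve 12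
                (λ a b c d e f g h i j k l → a :* (b :+ c :- (con (+ 1))) :- (con (+ 0)) := (num 2) :* d :+ e :+ a :*
                b :+ (num 2) :* f :* g :+ h :+ ((num 2) :* (a :* c) :+ (num 4) :* (c :* i)) :+ j :-
                ((k :- k) :* l :+ ((num 2) :* d :+ (a :+ e) :+ a :* (c :+ (con (+ 0))) :+ (num 2) :* f :*
                ((con (+ 0)) :+ g) :+ h :+ (con (+ 0)) :+ ((num 4) :* (c :* (i :- (con (+ 0)) :* f)) :+ j)))) refl T
                L₁ s V W C L₂ F e R t o)))
          (≤-by (ringing≤1 t (t + √C)) (solve 6 (λ a b c d e f → (con (+ 1)) :- a := b :+ ((num 3) :+ (num 2) :* c)
              :+ d :+ e :- (b :+ (con (+ 0)) :+ ((con (+ 1)) :+ (num 2) :* (c :- (con (+ 0)) :* f) :+ d) :+ (a :+ e)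
              :+ (con (+ 1)))) refl r N e G A C))
          where
          N = ∑ xs (λ y → 1# + effort y)
          G = ∑ gs (λ g → 1# + fromℕ 2 * spare g)
          A = ∑ cl (λ p → ringing t (proj₂ p))
          r = ringing t (t + √C)
          empty : loadIn fr gs ≡ 0#
          empty = loadIn-fresh fr gs slots<
          E : ℝ → ℝ → ℝ → ℝ → ℝ
          E r u l v = (t - t) * o + (fromℕ 2 * V + (r + W) + T * (u + l) + fromℕ 2 * C * (v + L₂) + F + 0# +
              (fromℕ 4 * (s * (e - 0# * C)) + R))
          old-welcome : ∀ {g} → Welcome t H sh lo fr cl g → Welcome t H fr lo (suc fr) ((sh , t + √C) ∷ cl) g
          old-welcome {g} ok = record
            { stays    = stays
            ; modest   = modest
            ; within   = within
            ; fine     = fine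
            ; known    = ℕ.m<n⇒m<1+n known
            ; located  = relocate located
            ; unmoved  = unmoved
            ; moved    = λ eq → ℕ.<⇒≢ known , proj₂ (moved eq)
            ; deadline = λ { (here refl) slot≡sh → short-deadline (moves g) refl slot≡sh ; (there p∈) → deadline p∈ }
            }
            where
            open Welcome ok
            relocate : slot g ∈ sh ∷ lo ∷ map proj₁ cl → slot g ∈ fr ∷ lo ∷ sh ∷ map proj₁ cl
            relocate (here eq)          = there (there (here eq))
            relocate (there (here eq))  = there (here eq)
            relocate (there (there p∈)) = there (there (there p∈))
            short-deadline : ∀ k → moves g ≡ k → slot g ≡ sh → ready (who g) (moves g) ≤ t + √C
            short-deadline (suc k) eq slot≡sh = ⊥-elim (proj₁ (moved eq) slot≡sh)
            short-deadline zero    eq slot≡sh = ≡-≤-trans (cong (ready (who g)) eq)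
              (≤-by (proj₂ (unmoved eq)) (solve 4 (λ a b c d → a :- b := a :+ c :-
                  (b :+ c :+ (num 2) :* d :* (con (+ 0)))) refl t (arrival (who g)) √C C))

        proceed : Step c
        proceed with (loadIn sh gs + s) ≤? 1#
        ... | yes fits = current fits
        ... | no full  = overflow full

      relocated : ℕ → ℕ → Guest → Guest
      relocated i b g = if does (label g ℕ.≟ i) then guest (who g) (suc (moves g)) (label g) b else g

      relocated-same : ∀ {i b} g → label g ≡ i → relocated i b g ≡ guest (who g) (suc (moves g)) (label g) b
      relocated-same {i} g eq = if-yes (label g ℕ.≟ i) eq

      relocated-other : ∀ {i b} g → label g ≢ i → relocated i b g ≡ g
      relocated-other {i} g neq = if-no (label g ℕ.≟ i) neq

      relocated-label : ∀ i b g → label (relocated i b g) ≡ label g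
      relocated-label i b g with does (label g ℕ.≟ i)
      ... | true  = refl
      ... | false = refl

      residents-relocated : ∀ i b gs → map (reassign C i b) (map toResident gs) ≡ map toResident
          (map (relocated i b) gs)
      residents-relocated i b []       = refl
      residents-relocated i b (g ∷ gs) with does (label g ℕ.≟ i)
      ... | true  = cong₂ _∷_ (cong (resident (label g) (size (who g)) b)
          (solve 3 (λ a b c → a :+ b :* c :+ c := a :+ ((con (+ 1)) :+ b) :* c) refl d k C))
          (residents-relocated i b gs)
        where
        d = departure (who g)
        k = fromℕ (moves g)
      ... | false = cong (toResident g ∷_) (residents-relocated i b gs)

      views-relocated : ∀ i b gs → map (rebin i b) (map toView gs) ≡ map toView (map (relocated i b) gs)
      views-relocated i b []       = refl
      views-relocated i b (g ∷ gs) with does (label g ℕ.≟ i)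
      ... | true  = cong (_ ∷_) (views-relocated i b gs)
      ... | false = cong (_ ∷_) (views-relocated i b gs)

      same-label : ∀ {gs g g′} → AllPairs (λ g g′ → label g ≢ label g′) gs → g ∈ gs → g′ ∈ gs → label g ≡ label g′ →
          g ≡ g′
      same-label _          (here refl) (here refl) _  = refl
      same-label (g≢ ∷ _)   (here refl) (there g′∈) eq = ⊥-elim (All.lookup g≢ g′∈ eq)
      same-label (g′≢ ∷ _)  (there g∈)  (here refl) eq = ⊥-elim (All.lookup g′≢ g∈ (sym eq))
      same-label (_ ∷ uniq) (there g∈)  (there g′∈) eq = same-label uniq g∈ g′∈ eq

      -- The step that migrates an item from a closed bin

      module Migrating {t gs xs n h sh lo fr cl H} (inv : Invariant (conf t gs nothing xs n h sh lo fr cl H))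
                       {g b₀ u} (g∈ : g ∈ gs) (p∈ : (b₀ , u) ∈ cl) (slot≡b₀ : slot g ≡ b₀) (u≤t : u ≤ t)
                       (chosen : find (due? t cl) (map toView gs) ≡ just (toView g)) where
        open Invariant inv
        open Welcome (All.lookup welcome g∈)
        c = conf t gs nothing xs n h sh lo fr cl H
        i = label g
        s = size (who g)
        a = arrival (who g)
        d = duration (who g)
        k = fromℕ (moves g)
        o = fromℕ (openBins (toState c))
        V = H - t + sweep ρ H xs
        W = ∑ cl (λ p → remaining t (proj₂ p))
        L₁ = loadIn sh gs
        L₂ = loadIn lo gs
        F = ∑ xs charge
        refund : Guest → ℝ
        refund g = fromℕ 4 * (size (who g) * spare g)
        toil : Guest → ℝ
        toil g = 1# + fromℕ 2 * spare g
        R = ∑ gs refund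
        N = ∑ xs (λ y → 1# + effort y)
        G = ∑ gs toil
        A = ∑ cl (λ p → ringing t (proj₂ p))

        overdue : ready (who g) (moves g) ≤ t
        overdue = ≤-trans (deadline p∈ slot≡b₀) u≤t

        -- With `k` migrations so far, `overdue` gives `t ≥ a + √C + 2 k C` and `stays` gives
        -- `t ≤ a + d + k C`. Hence `d ≥ √C + k C`, which is the premise of admissibility.
        affordable : fromℕ (suc (moves g)) * C ≤ (ρ - 1#) * d
        affordable = proj₁ fine (moves g)
          (≤-by (overdue ⊕ stays) (solve 6 (λ a b c d e f → a :+ (b :+ c :+ d :* e) :-
              (b :+ f :+ (num 2) :* e :* d :+ a) := c :- (f :+ d :* e)) refl t a d k C √C))

        slot≢lo : slot g ≢ lo
        slot≢lo eq = proj₂ (proj₂ (All.lookup closed< p∈)) (trans (sym slot≡b₀) eq)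

        found : find (λ r → name r ℕ.≟ i) (map toResident gs) ≡ just (toResident g)
        found with find-cases (λ r → name r ℕ.≟ i) (map toResident gs)
        ... | inj₂ (none , _) = ⊥-elim (none (∈-map⁺ toResident g∈) refl)
        ... | inj₁ (r , r∈ , name≡ , eq) with ∈-map⁻ toResident r∈
        ...   | g′ , g′∈ , refl = trans eq (cong (just ∘ toResident) (same-label distinct g′∈ g∈ name≡))

        busy : ¬ Over (toState c)
        busy (eq , _) = case subst (toResident g ∈_) eq (∈-map⁺ toResident g∈) of λ ()

        migration : ∀ b → slot g ≢ b → Fits s b (map toResident gs) →
                    migrate i (if does (fits? s lo (map toView gs)) then lo else fr) ≡ migrate i b →
                    step C strategy′ (toState c) ≡ next (state t (map toResident (map (relocated i b) gs)) nothing xs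
                        n (migrated i b ∷ h))
        migration b slot≢b fits eq =
          trans (goes-by busy (trans (cong decide remembers) (trans (cong (clear t (map toView gs) lo fr cl) chosen)
              eq)))
            (trans (migrateTo-next {st = toState c} found slot≢b fits)
              (cong (λ rs → next (state t rs nothing xs n (migrated i b ∷ h))) (residents-relocated i b gs)))

        labels′ : ∀ b → All (λ g → label g ℕ.< n) (map (relocated i b) gs)
        labels′ b = All.map⁺ (All.map (λ {g} → subst (ℕ._< n) (sym (relocated-label i b g))) labels)

        distinct′ : ∀ b → AllPairs (λ g g′ → label g ≢ label g′) (map (relocated i b) gs)
        distinct′ b = AllPairs.map⁺ (AllPairs.map (λ {g} {g′} neq eq →
          neq (trans (sym (relocated-label i b g)) (trans eq (relocated-label i b g′)))) distinct)

        welcome′ : ∀ {lo′ fr′ cl′} b → b ℕ.< fr′ → b ≡ lo′ → b ≢ sh → (∀ {b′ u} → (b′ , u) ∈ cl′ → b ≢ b′) →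
                   (∀ {g′} → Welcome t H sh lo fr cl g′ → Welcome t H sh lo′ fr′ cl′ g′) →
                   All (Welcome t H sh lo′ fr′ cl′) (map (relocated i b) gs)
        welcome′ {lo′} {fr′} {cl′} b b< b≡lo b≢sh open′ old = All.map⁺ (All.tabulate each)
          where
          each : ∀ {g′} → g′ ∈ gs → Welcome t H sh lo′ fr′ cl′ (relocated i b g′)
          each {g′} g′∈ with label g′ ℕ.≟ i
          ... | no neq = subst (Welcome t H sh lo′ fr′ cl′) (sym (relocated-other g′ neq))
              (old (All.lookup welcome g′∈))
          ... | yes eq with same-label distinct g′∈ g∈ eq
          ...   | refl = subst (Welcome t H sh lo′ fr′ cl′) (sym (relocated-same g refl)) (record
            { stays    = (≤-by (stays ⊕ 0≤C) (solve 5 (λ a b c d e → a :+ b :+ c :* d :+ d :- (e :+ (con (+ 0))) := a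
                :+ b :+ ((con (+ 1)) :+ c) :* d :- e) refl a d k C t))
            ; modest   = affordable
            ; within   = within
            ; fine     = fine
            ; known    = b<
            ; located  = there (here b≡lo)
            ; unmoved  = λ ()
            ; moved    = λ { refl → b≢sh , overdue }
            ; deadline = λ p∈ b≡ → ⊥-elim (open′ p∈ b≡)
            })

        ∑-relocated : ∀ b (f : Guest → ℝ) {Δ} → f (guest (who g) (suc (moves g)) i b) ≤ f g + Δ → ∑
            (map (relocated i b) gs) f ≤ ∑ gs f + Δ
        ∑-relocated b f {Δ} bound = ≡-≤-trans (∑-map f (relocated i b) gs) (∑-change-at label gs distinct g∈
          (λ {g′} _ neq → ≤-reflexive (cong f (relocated-other g′ neq)))
              (≡-≤-trans (cong f (relocated-same g refl)) bound))

        refund-drops : ∀ b → ∑ (map (relocated i b) gs) refund ≤ R + - (fromℕ 4 * (s * C))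
        refund-drops b = ∑-relocated b refund (≤-reflexive (solve 4
            (λ a b c d → (num 4) :* (a :* (b :- ((con (+ 1)) :+ c) :* d)) := (num 4) :* (a :* (b :- c :* d)) :+
            (:- ((num 4) :* (a :* d)))) refl s e k C))
          where e = (ρ - 1#) * d

        toil-drops : ∀ b → ∑ (map (relocated i b) gs) toil ≤ G + - (fromℕ 2 * C)
        toil-drops b = ∑-relocated b toil (≤-reflexive (solve 3 (λ a b c → (con (+ 1)) :+ (num 2) :*
            (a :- ((con (+ 1)) :+ b) :* c) := (con (+ 1)) :+ (num 2) :* (a :- b :* c) :+ (:- ((num 2) :* c))) refl e
            k C))
          where e = (ρ - 1#) * d

        short-load : ∀ {b} → b ≢ sh → loadIn sh (map (relocated i b) gs) ≤ L₁ + 0#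
        short-load {b} b≢sh = ∑-relocated b _ (≡-≤-trans (weightIn-other s b≢sh)
          (≤-by (0≤weightIn sh (slot g) (0≤size (who g))) (solve 1
              (λ a → a :- (con (+ 0)) := a :+ (con (+ 0)) :- (con (+ 0))) refl w)))
          where w = weightIn sh (slot g) s

        target-load : ∀ b → loadIn b (map (relocated i b) gs) ≤ loadIn b gs + s
        target-load b = ∑-relocated b _ (≡-≤-trans (weightIn-same b s)
          (≤-by (0≤weightIn b (slot g) (0≤size (who g))) (solve 2 (λ a b → a :- (con (+ 0)) := a :+ b :- b) refl w
              s)))
          where w = weightIn b (slot g) s

        current : loadIn lo gs + s ≤ 1# → Step c
        current fits = stepTo (conf t gs′ nothing xs n (migrated i lo ∷ h) sh lo fr cl H)
          (migration lo slot≢lo (fits-residents lo gs fits) (cong (migrate i)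
              (if-yes (fits? s lo (map toView gs)) (fits-views lo gs fits))))
          (record
            { remembers  = trans (cong (update (migrated i lo)) remembers)
                             (trans (if-yes (lo ℕ.≟ lo) refl) (cong (λ rs → memory t nothing n rs sh lo fr cl)
                                 (views-relocated i lo gs)))
            ; labels     = labels′ lo
            ; distinct   = distinct′ lo
            ; welcome    = welcome′ lo long< refl (short≢long ∘ sym)
                (λ q∈ b≡ → proj₂ (proj₂ (All.lookup closed< q∈)) (sym b≡)) id
            ; now≤H      = now≤H
            ; admitted   = admitted
            ; ordered    = ordered
            ; upcoming   = upcoming
            ; newcomer   = tt
            ; short<     = short<
            ; long<      = long<
            ; short≢long = short≢long
            ; closed<    = closed<
            })
          -- Of the `4 s C` released by the drop of `spare`, one half is kept as load and the other
          -- is surplus.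
          (≤-by (*-monoʳ-≤ 0≤T (short-load (short≢long ∘ sym)) ⊕ *-monoʳ-≤ 0≤2C (target-load lo) ⊕ refund-drops lo ⊕
              *-nonNegative (0≤size (who g)) 0≤2C) (solve 14 (λ a b c d e f g h i j k l m n → a :* (b :+ (con (+ 0)))
              :+ (num 2) :* c :* (d :+ e) :+ (f :+ (:- ((num 4) :* (e :* c)))) :+ e :* ((num 2) :* c) :-
              (a :* g :+ (num 2) :* c :* h :+ i :+ (con (+ 0))) := (num 2) :* j :+ k :+ a :* b :+ (num 2) :* c :* d
              :+ l :+ (con (+ 0)) :+ f :- ((m :- m) :* n :+ ((num 2) :* j :+ k :+ a :* g :+ (num 2) :* c :* h :+ l :+
              (con (+ 0)) :+ i))) refl T L₁ C L₂ s R l₁ l₂ r V W F t o))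
          (≤-by (toil-drops lo ⊕ 1≤C ⊕ 0≤C) (solve 5 (λ a b c d e → a :+ (:- ((num 2) :* b)) :+ b :+ b :-
              (c :+ (con (+ 1)) :+ (con (+ 0))) := d :+ (con (+ 0)) :+ a :+ e :-
              (d :+ (con (+ 0)) :+ c :+ e :+ (con (+ 1)))) refl G C m N A))
          where
          gs′ = map (relocated i lo) gs
          l₁ = loadIn sh gs′
          l₂ = loadIn lo gs′
          r = ∑ gs′ refund
          m = ∑ gs′ toil
          0≤2C : 0# ≤ fromℕ 2 * C
          0≤2C = *-nonNegative (0≤fromℕ 2) 0≤C

        overflow : ¬ (loadIn lo gs + s ≤ 1#) → Step c
        overflow full = stepTo (conf t gs′ nothing xs n (migrated i fr ∷ h) sh fr (suc fr)
            ((lo , t + fromℕ 2 * C) ∷ cl) H)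
          (migration fr (ℕ.<⇒≢ known) (fits-residents fr gs (≡-≤-trans (cong (_+ s) empty)
              (≡-≤-trans (+-identityˡ s) (size≤1 (who g)))))
            (cong (migrate i) (if-no (fits? s lo (map toView gs)) (full ∘ views-fit lo gs))))
          (record
            { remembers  = trans (cong (update (migrated i fr)) remembers)
                             (trans (if-no (fr ℕ.≟ lo) (ℕ.<⇒≢ long< ∘ sym))
                               (cong (λ rs → memory t nothing n rs sh fr (suc fr) ((lo , t + fromℕ 2 * C) ∷ cl))
                                   (views-relocated i fr gs)))
            ; labels     = labels′ fr
            ; distinct   = distinct′ fr
            ; welcome    = welcome′ fr (ℕ.n<1+n fr) refl (ℕ.<⇒≢ short< ∘ sym)
                             (λ { (here refl) fr≡lo → ℕ.<⇒≢ long< (sym fr≡lo) ; (there q∈) fr≡b → ℕ.<⇒≢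
                                 (proj₁ (All.lookup closed< q∈)) (sym fr≡b) })
                             old-welcome
            ; now≤H      = now≤H
            ; admitted   = admitted
            ; ordered    = ordered
            ; upcoming   = upcoming
            ; newcomer   = tt
            ; short<     = ℕ.m<n⇒m<1+n short<
            ; long<      = ℕ.n<1+n fr
            ; short≢long = ℕ.<⇒≢ short<
            ; closed<    = (ℕ.m<n⇒m<1+n long< , short≢long ∘ sym , ℕ.<⇒≢ long<)
                           ∷ All.map (λ { (b<fr , b≢sh , _) → ℕ.m<n⇒m<1+n b<fr , b≢sh , ℕ.<⇒≢ b<fr }) closed<
            })
          -- As in the overflow of new items, with `2 C` in place of `T`: the old load and half of
          -- the released `4 s C` exceed the `2 C` for the closed bin, and the other half is kept as
          -- load of the new bin.
          (≤-by (*-monoʳ-≤ 0≤T (short-load (ℕ.<⇒≢ short< ∘ sym)) ⊕ *-monoʳ-≤ 0≤2C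
              (≤-≡-trans (target-load fr) (cong (_+ s) empty)) ⊕ refund-drops fr ⊕ remaining-long t ⊕ *-nonNegative
              0≤2C (≤⇒0≤ (≰⇒≥ full))) (solve 15 (λ a b c d e f g h i j k l m n o → a :* (b :+ (con (+ 0))) :+ (num 2)
              :* c :* ((con (+ 0)) :+ d) :+ (e :+ (:- ((num 4) :* (d :* c)))) :+ (num 2) :* c :+ (num 2) :* c :*
              (f :+ d :- (con (+ 1))) :- (a :* g :+ (num 2) :* c :* h :+ i :+ j :+ (con (+ 0))) := (num 2) :* k :+ l
              :+ a :* b :+ (num 2) :* c :* f :+ m :+ (con (+ 0)) :+ e :-
              ((n :- n) :* o :+ ((num 2) :* k :+ (j :+ l) :+ a :* g :+ (num 2) :* c :* h :+ m :+ (con (+ 0)) :+ i)))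
              refl T L₁ C s R L₂ l₁ l₂ r q V W F t o))
          (≤-by (toil-drops fr ⊕ *-monoʳ-≤ (0≤fromℕ 2) 1≤C ⊕ ringing≤1 t (t + fromℕ 2 * C))
              (solve 6 (λ a b c d e f → a :+ (:- ((num 2) :* b)) :+ (num 2) :* b :+ (con (+ 1)) :-
              (c :+ (num 2) :* (con (+ 1)) :+ d) := e :+ (con (+ 0)) :+ a :+ f :-
              (e :+ (con (+ 0)) :+ c :+ (d :+ f) :+ (con (+ 1)))) refl G C m v N A))
          where
          gs′ = map (relocated i fr) gs
          l₁ = loadIn sh gs′
          l₂ = loadIn fr gs′
          r = ∑ gs′ refund
          m = ∑ gs′ toil
          q = remaining t (t + fromℕ 2 * C)
          v = ringing t (t + fromℕ 2 * C)
          0≤2C : 0# ≤ fromℕ 2 * C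
          0≤2C = *-nonNegative (0≤fromℕ 2) 0≤C
          empty : loadIn fr gs ≡ 0#
          empty = loadIn-fresh fr gs (All.map Welcome.known welcome)
          old-welcome : ∀ {g} → Welcome t H sh lo fr cl g → Welcome t H sh fr (suc fr) ((lo , t + fromℕ 2 * C) ∷ cl) g
          old-welcome {g} ok = record
            { stays    = O.stays
            ; modest   = O.modest
            ; within   = O.within
            ; fine     = O.fine
            ; known    = ℕ.m<n⇒m<1+n O.known
            ; located  = relocate O.located
            ; unmoved  = λ eq → ℕ.<⇒≢ O.known , proj₂ (O.unmoved eq)
            ; moved    = O.moved
            ; deadline = λ { (here refl) slot≡lo → long-deadline (moves g) refl slot≡lo ; (there q∈) → O.deadline q∈ }
            }
            where
            module O = Welcome ok
            relocate : slot g ∈ sh ∷ lo ∷ map proj₁ cl → slot g ∈ sh ∷ fr ∷ lo ∷ map proj₁ cl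
            relocate (here eq)         = here eq
            relocate (there slot∈)     = there (there slot∈)
            long-deadline : ∀ k → moves g ≡ k → slot g ≡ lo → ready (who g) (moves g) ≤ t + fromℕ 2 * C
            long-deadline zero    eq slot≡lo = ⊥-elim (proj₁ (O.unmoved eq) slot≡lo)
            long-deadline (suc k) eq slot≡lo = ≡-≤-trans (cong (ready (who g)) eq)
              (≤-by (proj₂ (O.moved eq)) (solve 5 (λ a b c d e → a :- (b :+ c :+ (num 2) :* d :* e) := a :+ (num 2)
                  :* d :- (b :+ c :+ (num 2) :* d :* ((con (+ 1)) :+ e))) refl t (arrival (who g)) √C C (fromℕ k)))

        proceed : Step c
        proceed with (loadIn lo gs + s) ≤? 1#
        ... | yes fits = current fits
        ... | no full  = overflow full

      ringing-anti : ∀ {t t′} u → t ≤ t′ → ringing t′ u ≤ ringing t u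
      ringing-anti {t} {t′} u t≤t′ with t′ <? u
      ... | yes t′<u = ≡-≤-trans (if-yes (t′ <? u) t′<u) (≤-reflexive (sym (if-yes (t <? u) (≤-<-trans t≤t′ t′<u))))
      ... | no t′≮u  = ≡-≤-trans (if-no (t′ <? u) t′≮u) (0≤ringing t u)

      -- The passage of time up to the next signal

      module Advancing {t gs xs n h sh lo fr cl H} (inv : Invariant (conf t gs nothing xs n h sh lo fr cl H)) {t′}
                       (t≤t′ : t ≤ t′) (t′≤leave : ∀ {g} → g ∈ gs → t′ ≤ leave g)
                           (t′≤arrival : All (λ x → t′ ≤ arrival x) xs)
                       (t′≤deadline : ∀ {b u} → (b , u) ∈ cl → t < u → t′ ≤ u)
                       (idle : ∀ {g} → g ∈ gs → ¬ Due t cl (toView g)) where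
        open Invariant inv
        c = conf t gs nothing xs n h sh lo fr cl H
        H′ = H ⊔ t′
        Δ = t′ - t
        F = ∑ xs charge
        W = ∑ cl (λ p → remaining t (proj₂ p))
        W′ = ∑ cl (λ p → remaining t′ (proj₂ p))

        0≤Δ : 0# ≤ Δ
        0≤Δ = ≤⇒0≤ t≤t′

        alive? : ∀ (p : ℕ × ℝ) → Dec (t′ ≤ proj₂ p - δ)
        alive? p = t′ ≤? (proj₂ p - δ)

        alive : ℕ
        alive = length (filter alive? cl)

        -- If `δ` is 0, the bin is not yet due, as nobody waits to be migrated, and the alarm stops
        -- the clock at its clearing time at the latest. Otherwise the guest leaves at most `T`
        -- after its arrival, whereas its bin is due no earlier than `√C` after that arrival.
        in-time : ∀ {g} → g ∈ gs → ∀ {p} → p ∈ cl → slot g ≡ proj₁ p → t′ ≤ proj₂ p - δ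
        in-time {g} g∈ {b , u} p∈ slot≡b with proj₂ (Welcome.fine (All.lookup welcome g∈))
        ... | inj₁ δ≡0 = ≤-≡-trans (t′≤deadline p∈ (≰⇒> λ u≤t → idle g∈ (Any.map (λ { refl → slot≡b , u≤t }) p∈)))
                           (trans (solve 1 (λ a → a := a :- (con (+ 0))) refl u) (cong (λ z → u - z) (sym δ≡0)))
        ... | inj₂ ρd≤T =
          (≤-by (t′≤leave g∈ ⊕ stretched ok ⊕ ρd≤T ⊕ Welcome.deadline ok p∈ slot≡b ⊕ *-nonNegative
              (*-nonNegative (0≤fromℕ 2) 0≤C) (0≤fromℕ (moves g)))
              (solve 10 (λ a b c d e f g h i j → a :+ (b :+ c :* d) :+ e :+ f :+ (num 2) :* g :* h :-
              (i :+ a :+ c :* d :+ (b :+ j :+ (num 2) :* g :* h) :+ (con (+ 0))) := f :- (j :- e) :- i) refl l a ρ d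
              T u C k t′ √C))
          where
          ok = All.lookup welcome g∈
          a = arrival (who g)
          d = duration (who g)
          k = fromℕ (moves g)
          l = leave g

        open-bound : openBins (toState c) ℕ.≤ suc (suc alive)
        open-bound = subst (λ l → openBins (toState c) ℕ.≤ suc (suc l)) (length-map proj₁ (filter alive? cl))
          (dedup-⊆-length {ys = sh ∷ lo ∷ map proj₁ (filter alive? cl)} covered)
          where
          covered : ∀ {b} → b ∈ map bin (map toResident gs) → b ∈ sh ∷ lo ∷ map proj₁ (filter alive? cl)
          covered b∈ with ∈-map⁻ bin b∈
          ... | _ , r∈ , refl with ∈-map⁻ toResident r∈
          ...   | g , g∈ , refl with Welcome.located (All.lookup welcome g∈)
          ...     | here eq          = here eq
          ...     | there (here eq)  = there (here eq)
          ...     | there (there q∈) with ∈-map⁻ proj₁ q∈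
          ...       | p , p∈ , eq = there (there (subst (_∈ map proj₁ (filter alive? cl)) (sym eq)
                                      (∈-map⁺ proj₁ (∈-filter⁺ alive? p∈ (in-time g∈ p∈ eq)))))

        closed-pays : Δ * fromℕ alive + W′ ≤ W
        closed-pays = ≡-≤-trans (cong (_+ W′) (trans (cong (Δ *_) (length-filter≡∑ alive? cl)) (sym (∑-* Δ _ cl))))
          (≡-≤-trans (sym (∑-+ _ _ cl)) (∑-mono cl (λ {p} _ → each p (alive? p))))
          where
          each : ∀ p (d : Dec (t′ ≤ proj₂ p - δ)) → Δ * (if does d then 1# else 0#) + remaining t′ (proj₂ p) ≤
              remaining t (proj₂ p)
          each (_ , u) (yes t′≤) = ≡-≤-trans (cong (λ r → Δ * 1# + r) (⊔-≤ (≤⇒0≤ t′≤)))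
            (≤-trans (≤-by (≤-refl) (solve 3 (λ a b c → a :- a := b :- a :- ((c :- a) :* (con (+ 1)) :+ (b :- c)))
                refl t z t′)) (y≤x⊔y 0# (z - t)))
            where z = u - δ
          each (_ , u) (no t′≰) = ≡-≤-trans (cong (λ r → Δ * 0# + r)
              (⊔-≥ (≤-by (≰⇒≥ t′≰) (solve 2 (λ a b → a :- b := (con (+ 0)) :- (b :- a)) refl t′ z))))
            (≡-≤-trans (solve 1 (λ a → a :* (con (+ 0)) :+ (con (+ 0)) := con (+ 0)) refl Δ) (x≤x⊔y 0# _))
            where z = u - δ

        pays : ∀ {h′} → Δ * fromℕ (openBins (toState c)) + potential (conf t′ gs nothing xs n h′ sh lo fr cl H′) ≤
            potential c
        pays = by-cases gs refl
          where
          X₁ = T * loadIn sh gs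
          X₂ = fromℕ 2 * C * loadIn lo gs
          R = ∑ gs (λ g → fromℕ 4 * (size (who g) * spare g))
          S = sweep ρ H xs
          S′ = sweep ρ H′ xs
          a = fromℕ alive
          o = fromℕ (openBins (toState c))
          -- If time runs past the horizon, no arrival lies in the gap, so that `sweep` is
          -- unaffected by moving the horizon up to the clock.
          idle-pays : H′ - t′ + S′ ≤ H - t + S
          idle-pays = by-order (≤-total t′ H)
            where
            by-order : t′ ≤ H ⊎ H ≤ t′ → H′ - t′ + S′ ≤ H - t + S
            by-order (inj₁ t′≤H) = ≡-≤-trans (cong (λ z → z - t′ + sweep ρ z xs) (⊔-≥ t′≤H))
                              (≤-by (t≤t′) (solve 4 (λ a b c d → a :- b := c :- b :+ d :- (c :- a :+ d)) refl t′ t H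
                                  S))
            by-order (inj₂ H≤t′) = ≡-≤-trans (trans (cong (λ z → z - t′ + sweep ρ z xs) (⊔-≤ H≤t′))
                                        (cong (λ z → t′ - t′ + z) (sweep-shift 0≤ρ xs H≤t′ t′≤arrival)))
                              (≤-by (now≤H) (solve 4 (λ a b c d → a :- b := a :- b :+ c :- (d :- d :+ c)) refl H t S
                                  t′))
          by-cases : ∀ gs₀ → gs ≡ gs₀ → Δ * o + (fromℕ 2 * (H′ - t′ + S′) + W′ + X₁ + X₂ + F + 0# + R) ≤ fromℕ 2 *
              (H - t + S) + W + X₁ + X₂ + F + 0# + R
          by-cases [] refl =
            (≤-by (*-monoʳ-≤ (0≤fromℕ 2) idle-pays ⊕ closed-pays ⊕ *-nonNegative 0≤Δ (0≤fromℕ alive))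
                (solve 14 (λ a b c d e f g h i j k l m n → (num 2) :* (a :- b :+ c) :+ d :+ e :* f :-
                ((num 2) :* (g :- h :+ i) :+ (e :* f :+ j) :+ (con (+ 0))) := (num 2) :* (a :- b :+ c) :+ d :+ k :+ l
                :+ m :+ (con (+ 0)) :+ n :- (e :* (con (+ 0)) :+ ((num 2) :* (g :- h :+ i) :+ j :+ k :+ l :+ m :+
                (con (+ 0)) :+ n))) refl H t S W Δ a H′ t′ S′ W′ X₁ X₂ F R))
          -- While a guest is present the clock stays below the horizon, so the first term of the
          -- potential pays in full for the two current bins.
          by-cases (g ∷ _) refl = ≡-≤-trans
            (cong (λ z → Δ * o + (fromℕ 2 * (z - t′ + sweep ρ z xs) + W′ + X₁ + X₂ + F + 0# + R)) (⊔-≥ t′≤H))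
            (≤-by (*-monoʳ-≤ 0≤Δ (fromℕ-mono-≤ open-bound) ⊕ closed-pays)
                (solve 12 (λ a b c d e f g h i j k l → (a :- b) :* ((con (+ 1)) :+ ((con (+ 1)) :+ c)) :+ d :-
                ((a :- b) :* e :+ ((a :- b) :* c :+ f)) := (num 2) :* (g :- b :+ h) :+ d :+ i :+ j :+ k :+
                (con (+ 0)) :+ l :- ((a :- b) :* e :+ ((num 2) :* (g :- a :+ h) :+ f :+ i :+ j :+ k :+ (con (+ 0)) :+
                l))) refl t′ t a W o W′ H S X₁ X₂ F R))
            where
            ok = All.lookup welcome (here refl)
            t′≤H : t′ ≤ H
            t′≤H = ≤-trans (t′≤leave (here refl)) (≤-trans (stretched ok) (Welcome.within ok))

        advanced : ∀ {H″} → H ≤ H″ → All (Welcome t′ H″ sh lo fr cl) gs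
        advanced H≤H″ = All.tabulate λ {g} g∈ → let open Welcome (All.lookup welcome g∈) in record
          { stays    = t′≤leave g∈
          ; modest   = modest
          ; within   = ≤-trans within H≤H″
          ; fine     = fine
          ; known    = known
          ; located  = located
          ; unmoved  = λ eq → proj₁ (unmoved eq) , ≤-trans (proj₂ (unmoved eq)) t≤t′
          ; moved    = λ eq → proj₁ (moved eq) , ≤-trans (proj₂ (moved eq)) t≤t′
          ; deadline = deadline
          }

        ringing-drops : ∑ cl (λ p → ringing t′ (proj₂ p)) ≤ ∑ cl (λ p → ringing t (proj₂ p))
        ringing-drops = ∑-mono cl (λ {p} _ → ringing-anti (proj₂ p) t≤t′)

      -- The effect of moving the clock to the time of the next signal, common to departures,
      -- arrivals and alarms; the signal itself has not yet changed the guests or the future.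
      record Advance (t : ℝ) (gs : List Guest) (xs : List Item) (n : ℕ) (h : List Observation) (sh lo fr : ℕ)
          (cl : List (ℕ × ℝ)) (H t′ : ℝ) : Set where
        field
          cheap    : (t′ - t) * fromℕ (openBins (toState (conf t gs nothing xs n h sh lo fr cl H))) + potential
              (conf t′ gs nothing xs n h sh lo fr cl (H ⊔ t′))
                     ≤ potential (conf t gs nothing xs n h sh lo fr cl H)
          advanced : ∀ {H″} → H ≤ H″ → All (Welcome t′ H″ sh lo fr cl) gs
          quieter  : ∑ cl (λ p → ringing t′ (proj₂ p)) ≤ ∑ cl (λ p → ringing t (proj₂ p))
          arrivals≥ : All (λ x → t′ ≤ arrival x) xs

      module Waiting {t gs xs n h sh lo fr cl H} (inv : Invariant (conf t gs nothing xs n h sh lo fr cl H))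
                     (idle : ∀ {g} → g ∈ gs → ¬ Due t cl (toView g))
                     (chosen : find (due? t cl) (map toView gs) ≡ nothing)
                     (busy : ¬ Over (state t (map toResident gs) nothing xs n h)) where
        open Invariant inv
        c = conf t gs nothing xs n h sh lo fr cl H
        alarm = soonest (deadlines t cl)

        waits : step C strategy′ (toState c) ≡ waitFor alarm (toState c)
        waits = goes-by busy (trans (cong decide remembers) (cong (clear t (map toView gs) lo fr cl) chosen))

        alarm-deadline : ∀ {u} → alarm ≡ just u → t < u × u ∈ map proj₂ cl
        alarm-deadline eq with soonest-cases (deadlines t cl)
        ... | inj₁ (_ , none) = case trans (sym none) eq of λ ()
        ... | inj₂ (v , some , v∈ , _) with trans (sym some) eq
        ...   | refl with ∈-filter⁻ (t <?_) {xs = map proj₂ cl} v∈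
        ...     | v∈cl , t<v = t<v , v∈cl

        alarm-first : ∀ {s b u} → Upcoming alarm (toState c) s → (b , u) ∈ cl → t < u → signalTime s ≤ u
        alarm-first {s} {b} {u} up p∈ t<u with soonest-cases (deadlines t cl)
        ... | inj₁ (empty , _) = ⊥-elim (¬Any[] (subst (u ∈_) empty (∈-filter⁺ (t <?_) (∈-map⁺ proj₂ p∈) t<u)))
        ... | inj₂ (v , some , _ , v≤) = ≤-trans (isFirst up (alarms some))
            (v≤ (∈-filter⁺ (t <?_) (∈-map⁺ proj₂ p∈) t<u))

        arrival-first : ∀ {s} → Upcoming alarm (toState c) s → ∀ ys → ys ≡ xs → InOrder ys → All
            (λ x → signalTime s ≤ arrival x) ys
        arrival-first up []       eq   _         = []
        arrival-first up (x ∷ ys) refl (x≤ys ∷ _) = first ∷ All.map (≤-trans first) x≤ys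
          where first = isFirst up (arrives refl)

        not-before : ∀ {s} → Candidate alarm (toState c) s → t ≤ signalTime s
        not-before (departs r∈) with ∈-map⁻ toResident r∈
        ... | g , g∈ , refl = Welcome.stays (All.lookup welcome g∈)
        not-before (arrives eq) = All.head (subst (All (λ x → t ≤ arrival x)) eq upcoming)
        not-before (alarms eq)  = proj₁ (proj₁ (alarm-deadline eq))

        advance : ∀ {s} → Upcoming alarm (toState c) s → Advance t gs xs n h sh lo fr cl H (signalTime s)
        advance {s} up = record { cheap = pays {h} ; advanced = λ {H″} → advanced {H″} ; quieter = ringing-drops ;
            arrivals≥ = arrivals≥ }
          where
          arrivals≥ : All (λ x → signalTime s ≤ arrival x) xs
          arrivals≥ = arrival-first up xs refl ordered
          stays-until : ∀ {g} → g ∈ gs → signalTime s ≤ leave g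
          stays-until g∈ = isFirst up (departs (∈-map⁺ toResident g∈))
          open Advancing inv {signalTime s} (not-before (isCandidate up)) stays-until arrivals≥ (alarm-first up) idle using (pays; advanced; ringing-drops)

        departing : ∀ {g t′} → g ∈ gs → leave g ≡ t′ → Advance t gs xs n h sh lo fr cl H t′ →
                    waitFor alarm (toState c) ≡ occur (departure! t′) (toState c) → Step c
        departing {g} {t′} g∈ l≡t′ adv eq = stepTo (conf t′ gs′ nothing xs n (departed t′ gone ∷ h) sh lo fr cl H′)
          (trans waits (trans eq (cong (λ rs → next (state t′ rs nothing xs n (departed t′ gone ∷ h)))
              (filter-map (λ r → t′ <? leaves r) toResident gs))))
          (record
            { remembers  = trans (cong (update (departed t′ gone)) remembers)
                (cong (λ rs → memory t′ nothing n rs sh lo fr cl) views-stay)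
            ; labels     = All.filter⁺ stays? labels
            ; distinct   = AllPairs.filter⁺ stays? distinct
            ; welcome    = All.filter⁺ stays? (advanced (x≤x⊔y H t′))
            ; now≤H      = y≤x⊔y H t′
            ; admitted   = admitted
            ; ordered    = ordered
            ; upcoming   = arrivals≥
            ; newcomer   = tt
            ; short<     = short<
            ; long<      = long<
            ; short≢long = short≢long
            ; closed<    = closed<
            })
          (≤-by (cheap ⊕ *-monoʳ-≤ 0≤T (∑-filter-≤ stays? gs (λ {g} _ → 0≤weightIn sh (slot g) (0≤size (who g)))) ⊕
              *-monoʳ-≤ (*-nonNegative (0≤fromℕ 2) 0≤C) (∑-filter-≤ stays? gs
              (λ {g} _ → 0≤weightIn lo (slot g) (0≤size (who g)))) ⊕ ∑-filter-≤ stays? gs 0≤refund)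
              (solve 15 (λ a b c d e f g h i j k l m n o → a :+ b :* c :+ (num 2) :* d :* e :+ f :-
              ((g :- h) :* i :+ (j :+ k :+ b :* c :+ (num 2) :* d :* e :+ l :+ (con (+ 0)) :+ f) :+ b :* m :+ (num 2)
              :* d :* n :+ o) := a :- ((g :- h) :* i :+ (j :+ k :+ b :* m :+ (num 2) :* d :* n :+ l :+ (con (+ 0)) :+
              o))) refl P T L₁ C L₂ R t′ t o Z W′ F l₁ l₂ r))
          (≤-by (∑-filter-drop stays? gs 0≤toil g∈ (λ t′<l → proj₂ t′<l (sym l≡t′)) (1≤toil g∈) ⊕ quieter)
              (solve 5 (λ a b c d e → a :+ b :- (c :+ (con (+ 1)) :+ d) := e :+ (con (+ 0)) :+ a :+ b :-
              (e :+ (con (+ 0)) :+ c :+ d :+ (con (+ 1)))) refl G A m A′ N))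
          where
          open Advance adv
          H′ = H ⊔ t′
          W′ = ∑ cl (λ p → remaining t′ (proj₂ p))
          F = ∑ xs charge
          N = ∑ xs (λ y → 1# + effort y)
          toil refund : Guest → ℝ
          toil g = 1# + fromℕ 2 * spare g
          refund g = fromℕ 4 * (size (who g) * spare g)
          G = ∑ gs toil
          A = ∑ cl (λ p → ringing t (proj₂ p))
          A′ = ∑ cl (λ p → ringing t′ (proj₂ p))
          gone = map name (filter (λ r → leaves r ≤? t′) (map toResident gs))
          stays? : ∀ g → Dec (t′ < leave g)
          stays? g = t′ <? leave g
          gs′ = filter stays? gs
          o = fromℕ (openBins (toState c))
          P = potential c
          Z = fromℕ 2 * (H′ - t′ + sweep ρ H′ xs)
          L₁ = loadIn sh gs
          L₂ = loadIn lo gs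
          R = ∑ gs refund
          l₁ = loadIn sh gs′
          l₂ = loadIn lo gs′
          r = ∑ gs′ refund
          m = ∑ gs′ toil
          0≤refund : ∀ {g} → g ∈ gs → 0# ≤ refund g
          0≤refund {g} g∈ = *-nonNegative (0≤fromℕ 4) (*-nonNegative (0≤size (who g))
              (0≤spare (All.lookup welcome g∈)))
          1≤toil : ∀ {g} → g ∈ gs → 1# ≤ toil g
          1≤toil {g} g∈ = (≤-by (*-nonNegative (0≤fromℕ 2) (0≤spare (All.lookup welcome g∈)))
              (solve 1 (λ a → (num 2) :* a :- (con (+ 0)) := (con (+ 1)) :+ (num 2) :* a :- (con (+ 1))) refl v))
            where v = spare g
          0≤toil : ∀ {g} → g ∈ gs → 0# ≤ toil g
          0≤toil g∈ = ≤-trans 0≤1 (1≤toil g∈)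
          gone⇒due : ∀ {g} → g ∈ gs → label g ∈ gone → leave g ≤ t′
          gone⇒due {g} g∈ label∈ with ∈-map⁻ name label∈
          ... | _ , r∈ , label≡ with ∈-filter⁻ (λ r → leaves r ≤? t′) {xs = map toResident gs} r∈
          ...   | r∈gs , l≤t′ with ∈-map⁻ toResident r∈gs
          ...     | g₁ , g₁∈ , refl with same-label distinct g∈ g₁∈ label≡
          ...       | refl = l≤t′
          views-stay : filter (λ r → ¬? (name r ∈? gone)) (map toView gs) ≡ map toView gs′
          views-stay = trans (filter-map _ toView gs) (cong (map toView) (filter-cong _ stays? gs
            (λ g∈ label∉ → ≰⇒> λ l≤t′ → label∉ (∈-map⁺ name (∈-filter⁺ (λ r → leaves r ≤? t′) (∈-map⁺ toResident g∈)
                l≤t′)))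
            (λ g∈ t′<l label∈ → <⇒≱ t′<l (gone⇒due g∈ label∈))))

        ringing-now : ∀ {u} → alarm ≡ just u → Advance t gs xs n h sh lo fr cl H u →
                      waitFor alarm (toState c) ≡ occur (alarm! u) (toState c) → Step c
        ringing-now {u} alarm≡ adv eq = stepTo (conf u gs nothing xs n (alarmed u ∷ h) sh lo fr cl (H ⊔ u))
          (trans waits (trans eq (if-yes (t <? u) t<u)))
          (record
            { remembers  = cong (update (alarmed u)) remembers
            ; labels     = labels
            ; distinct   = distinct
            ; welcome    = advanced (x≤x⊔y H u)
            ; now≤H      = y≤x⊔y H u
            ; admitted   = admitted
            ; ordered    = ordered
            ; upcoming   = arrivals≥
            ; newcomer   = tt
            ; short<     = short<
            ; long<      = long<
            ; short≢long = short≢long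
            ; closed<    = closed<
            })
          cheap
          (≤-by (silenced) (solve 4 (λ a b c d → a :- (b :+ (con (+ 1))) := c :+ (con (+ 0)) :+ d :+ a :-
              (c :+ (con (+ 0)) :+ d :+ b :+ (con (+ 1)))) refl A A′ N G))
          where
          open Advance adv
          N = ∑ xs (λ y → 1# + effort y)
          G = ∑ gs (λ g → 1# + fromℕ 2 * spare g)
          A = ∑ cl (λ p → ringing t (proj₂ p))
          A′ = ∑ cl (λ p → ringing u (proj₂ p))
          t<u = proj₁ (alarm-deadline alarm≡)
          silenced : A′ + 1# ≤ A
          silenced with ∈-map⁻ proj₂ (proj₂ (alarm-deadline alarm≡))
          ... | p , p∈ , refl = ∑-gap cl (λ {q} _ → ringing-anti (proj₂ q) (proj₁ t<u)) p∈
            (≡-≤-trans (trans (cong (_+ 1#) (if-no (u <? u) (λ u<u → proj₂ u<u refl))) (+-identityˡ 1#))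
              (≤-reflexive (sym (if-yes (t <? u) t<u))))

      -- The arrival moves the first term of `sweep` into the horizon and the charge of the item
      -- from the future to the newcomer, so that beyond the passage of time the potential does not
      -- change.
      arriving-now : ∀ {t gs x ys n h sh lo fr cl H} → Invariant (conf t gs nothing (x ∷ ys) n h sh lo fr cl H) →
                     Advance t gs (x ∷ ys) n h sh lo fr cl H (arrival x) →
                     let c = conf t gs nothing (x ∷ ys) n h sh lo fr cl H in
                     step C strategy′ (toState c) ≡ occur (arrival! x ys) (toState c) → Step c
      arriving-now {t} {gs} {x} {ys} {n} {h} {sh} {lo} {fr} {cl} {H} inv adv eq =
        stepTo (conf a gs (just x) ys n (arrived a (size x) ∷ h) sh lo fr cl H″)
          eq
          (record
            { remembers  = cong (update (arrived a (size x))) remembers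
            ; labels     = labels
            ; distinct   = distinct
            ; welcome    = advanced (≤-trans (x≤x⊔y H a) (x≤x⊔y H′ e))
            ; now≤H      = ≤-trans (y≤x⊔y H a) (x≤x⊔y H′ e)
            ; admitted   = All.tail admitted
            ; ordered    = later-order ordered
            ; upcoming   = after ordered
            ; newcomer   = All.head admitted , refl , y≤x⊔y H′ e
            ; short<     = short<
            ; long<      = long<
            ; short≢long = short≢long
            ; closed<    = closed<
            })
          (≤-by (paid) (solve 13 (λ a b c d e f g h i j k l m → a :-
              ((b :- c) :* d :+ ((num 2) :* (e :- b :+ (f :- e :+ g)) :+ h :+ i :+ j :+ (k :+ l) :+ (con (+ 0)) :+
              m)) := a :- ((b :- c) :* d :+ ((num 2) :* (f :- b :+ g) :+ h :+ i :+ j :+ l :+ k :+ m))) refl P a t o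
              H′ H″ S W′ X₁ X₂ q F′ R))
          (≤-by (quieter) (solve 5 (λ a b c d e → a :- b := (con (+ 1)) :+ c :+ d :+ (con (+ 0)) :+ e :+ a :-
              (d :+ c :+ e :+ b :+ (con (+ 1)))) refl A A′ f N′ G))
        where
        open Invariant inv
        open Advance adv
        c = conf t gs nothing (x ∷ ys) n h sh lo fr cl H
        a = arrival x
        e = reach ρ x
        H′ = H ⊔ a
        H″ = H′ ⊔ e
        W′ = ∑ cl (λ p → remaining a (proj₂ p))
        G = ∑ gs (λ g → 1# + fromℕ 2 * spare g)
        A = ∑ cl (λ p → ringing t (proj₂ p))
        A′ = ∑ cl (λ p → ringing a (proj₂ p))
        S = sweep ρ H″ ys
        o = fromℕ (openBins (toState c))
        X₁ = T * loadIn sh gs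
        X₂ = fromℕ 2 * C * loadIn lo gs
        F′ = ∑ ys charge
        q = charge x
        f = effort x
        N′ = ∑ ys (λ y → 1# + effort y)
        R = ∑ gs (λ g → fromℕ 4 * (size (who g) * spare g))
        P = potential c
        paid : (a - t) * o + (fromℕ 2 * (H′ - a + (H″ - H′ + S)) + W′ + X₁ + X₂ + (q + F′) + 0# + R) ≤ P
        paid = ≡-≤-trans (cong (λ z → (a - t) * o + (fromℕ 2 * (H′ - a + (H″ - z + S)) + W′ + X₁ + X₂ + (q + F′) + 0#
            + R)) (sym (⊔-≥ (y≤x⊔y H a)))) cheap
        later-order : InOrder (x ∷ ys) → InOrder ys
        later-order (_ ∷ iys) = iys
        after : InOrder (x ∷ ys) → All (λ y → a ≤ arrival y) ys
        after (x≤ys ∷ _) = x≤ys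

      waiting : ∀ {t gs xs n h sh lo fr cl H} (inv : Invariant (conf t gs nothing xs n h sh lo fr cl H)) →
                (∀ {g} → g ∈ gs → ¬ Due t cl (toView g)) → find (due? t cl) (map toView gs) ≡ nothing →
                ¬ Over (state t (map toResident gs) nothing xs n h) → Step (conf t gs nothing xs n h sh lo fr cl H)
      waiting {t} {gs} {xs} {n} {h} {sh} {lo} {fr} {cl} {H} inv idle chosen busy
        with waitFor-upcoming (soonest (deadlines t cl)) (state t (map toResident gs) nothing xs n h)
      ... | inj₂ (_ , none) = ⊥-elim (stuck gs xs refl refl)
        where
        stuck : ∀ gs₀ xs₀ → gs ≡ gs₀ → xs ≡ xs₀ → ⊥
        stuck (g ∷ _) _       refl _    = none (departs (here refl))
        stuck []      (x ∷ _) refl refl = none (arrives refl)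
        stuck []      []      refl refl = busy (refl , refl , refl)
      ... | inj₁ (s , up , eq) = by-kind (isCandidate up) up eq
        where
        open Waiting inv idle chosen busy using (c; alarm; waits; advance; departing; ringing-now)
        by-kind : ∀ {s} → Candidate alarm (toState c) s → Upcoming alarm (toState c) s → waitFor alarm (toState c) ≡
            occur s (toState c) → Step c
        by-kind (departs r∈) up eq with ∈-map⁻ toResident r∈
        ... | g , g∈ , refl = departing g∈ refl (advance up) eq
        by-kind (arrives refl) up eq = arriving-now inv (advance up) (trans waits eq)
        by-kind (alarms alarm≡) up eq = ringing-now alarm≡ (advance up) eq

      -- The whole run and its cost

      progress : ∀ c → Invariant c → ¬ Over (toState c) → Step c
      progress (conf t gs (just x) xs n h sh lo fr cl H) inv busy = Placing.proceed inv
      progress (conf t gs nothing xs n h sh lo fr cl H) inv busy with find-cases (due? t cl) (map toView gs)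
      ... | inj₂ (none , chosen) = waiting inv (λ g∈ → none (∈-map⁺ toView g∈)) chosen busy
      ... | inj₁ (r , r∈ , due , chosen) with ∈-map⁻ toView r∈
      ...   | g , g∈ , refl with locate due
      ...     | (b₀ , u) , p∈ , slot≡ , u≤t = Migrating.proceed inv g∈ p∈ slot≡ u≤t chosen

      0≤measure : ∀ c → Invariant c → 0# ≤ measure c
      0≤measure (conf t gs w xs n h sh lo fr cl H) inv =
        (≤-by (∑-nonNegative xs (λ {x} _ → 0≤1+effort x) ⊕ 0≤onItem w ⊕ ∑-nonNegative gs (λ g∈ → 0≤toil g∈) ⊕
            ∑-nonNegative cl (λ {p} _ → 0≤ringing t (proj₂ p))) (solve 4
            (λ a b c d → a :+ b :+ c :+ d :- ((con (+ 0)) :+ (con (+ 0)) :+ (con (+ 0)) :+ (con (+ 0))) := a :+ b :+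
            c :+ d :- (con (+ 0))) refl N f G A))
        where
        open Invariant inv
        N = ∑ xs (λ x → 1# + effort x)
        f = onItem effort w
        G = ∑ gs (λ g → 1# + fromℕ 2 * spare g)
        A = ∑ cl (λ p → ringing t (proj₂ p))
        0≤effort : ∀ x → 0# ≤ effort x
        0≤effort x = (≤-by (0≤fromℕ 3 ⊕ *-nonNegative (0≤fromℕ 2) (0≤spareItem x))
            (solve 1 (λ a → (num 3) :+ (num 2) :* a :- ((con (+ 0)) :+ (con (+ 0))) := (num 3) :+ (num 2) :* a :-
            (con (+ 0))) refl e))
          where e = (ρ - 1#) * duration x
        0≤1+effort : ∀ x → 0# ≤ 1# + effort x
        0≤1+effort x = ≡-≤-trans (sym (+-identityˡ 0#)) (0≤1 ⊕ 0≤effort x)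
        0≤onItem : ∀ w → 0# ≤ onItem effort w
        0≤onItem nothing  = ≤-refl
        0≤onItem (just x) = 0≤effort x
        0≤toil : ∀ {g} → g ∈ gs → 0# ≤ 1# + fromℕ 2 * spare g
        0≤toil g∈ = ≡-≤-trans (sym (+-identityˡ 0#)) (0≤1 ⊕ *-nonNegative (0≤fromℕ 2)
            (0≤spare (All.lookup welcome g∈)))

      0≤potential : ∀ c → Invariant c → Over (toState c) → 0# ≤ potential c
      0≤potential (conf t [] nothing [] n h sh lo fr cl H) inv (refl , refl , refl) =
        (≤-by (*-nonNegative (0≤fromℕ 2) (≤⇒0≤ (Invariant.now≤H inv)) ⊕ ∑-nonNegative cl (λ {p} _ → x≤x⊔y 0# _))
            (solve 5 (λ a b c d e → (num 2) :* (a :- b) :+ c :- ((con (+ 0)) :+ (con (+ 0))) := (num 2) :*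
            (a :- b :+ (con (+ 0))) :+ c :+ d :* (con (+ 0)) :+ (num 2) :* e :* (con (+ 0)) :+ (con (+ 0)) :+
            (con (+ 0)) :+ (con (+ 0)) :- (con (+ 0))) refl H t W T C))
        where W = ∑ cl (λ p → remaining t (proj₂ p))

      Solution : Configuration → Set
      Solution c = Σ (Run C strategy′ (toState c)) λ r → runCost r ≤ potential c

      mutual
        -- `measure` is real, so the recursion is on a natural number above it. At 0 another step is
        -- impossible, since it would make the measure negative.
        simulate : ∀ m c → Invariant c → measure c ≤ fromℕ m → Solution c
        simulate m c inv bound = unless-over (over? (toState c))
          where
          unless-over : Dec (Over (toState c)) → Solution c
          unless-over (yes over) = stop (step-over (toState c) over) , 0≤potential c inv over
          unless-over (no busy)  = continue m c (progress c inv busy) bound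

        continue : ∀ m c → Step c → measure c ≤ fromℕ m → Solution c
        continue zero c (stepTo c′ _ keeps _ shrinks) bound =
          ⊥-elim (<⇒≱ 0<1 (≤-by (0≤measure c′ keeps ⊕ shrinks ⊕ bound)
              (solve 2 (λ a b → a :+ b :+ (con (+ 0)) :- ((con (+ 0)) :+ (a :+ (con (+ 1))) :+ b) := (con (+ 0)) :-
              (con (+ 1))) refl x y)))
          where
          x = measure c′
          y = measure c
        continue (suc m) c (stepTo c′ goes keeps pays shrinks) bound =
          let r , cheap = simulate m c′ keeps (≤-by (shrinks ⊕ bound) (solve 3 (λ a b c → a :+ ((con (+ 1)) :+ b) :- (c :+ (con (+ 1)) :+ a) := b :- c) refl y (fromℕ m) x)) in
          (goes ▸ r) , ≤-trans (≤-refl ⊕ cheap) pays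
          where
          x = measure c′
          y = measure c

      start-of : Instance → Configuration
      start-of I = conf 0# [] nothing (items I) 0 [] 0 1 2 [] 0#

      start-invariant : ∀ I → All Admissible (items I) → Invariant (start-of I)
      start-invariant I adm = record
        { remembers  = refl
        ; labels     = []
        ; distinct   = []
        ; welcome    = []
        ; now≤H      = ≤-refl
        ; admitted   = adm
        ; ordered    = inOrder I
        ; upcoming   = All.universal 0≤arrival (items I)
        ; newcomer   = tt
        ; short<     = s≤s z≤n
        ; long<      = s≤s (s≤s z≤n)
        ; short≢long = λ ()
        ; closed<    = []
        }

      -- `2 ρ` for the two current bins, `2 T` for closed bins of new items and `4 (ρ - 1)` for
      -- closed bins of migrated ones.
      factor : ℝ
      factor = fromℕ 2 * ρ + fromℕ 2 * T + fromℕ 4 * (ρ - 1#)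

      start-potential : ∀ I → All (λ x → 1# ≤ duration x) (items I) → potential (start-of I) ≤ factor * OPT I
      start-potential I 1≤d =
        (≤-by (*-monoʳ-≤ (0≤fromℕ 2) swept ⊕ charged ⊕ *-monoʳ-≤ 0≤rate (volume≤OPT I))
            (solve 7 (λ a b c d e f g → (num 2) :* (a :* b :+ (con (+ 0))) :+
            ((num 2) :* c :+ (num 4) :* (a :- (con (+ 1)))) :* d :+ ((num 2) :* c :+ (num 4) :* (a :- (con (+ 1))))
            :* b :- ((num 2) :* e :+ f :+ ((num 2) :* c :+ (num 4) :* (a :- (con (+ 1)))) :* d) :=
            ((num 2) :* a :+ (num 2) :* c :+ (num 4) :* (a :- (con (+ 1)))) :* b :-
            ((num 2) :* ((con (+ 0)) :- (con (+ 0)) :+ e) :+ (con (+ 0)) :+ c :* (con (+ 0)) :+ (num 2) :* g :*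
            (con (+ 0)) :+ f :+ (con (+ 0)) :+ (con (+ 0)))) refl ρ O T v s f C))
        where
        O = OPT I
        s = sweep ρ 0# (items I)
        f = ∑ (items I) charge
        v = volume I
        rate = fromℕ 2 * T + fromℕ 4 * (ρ - 1#)
        0≤rate : 0# ≤ rate
        0≤rate = (≤-by (*-nonNegative (0≤fromℕ 2) 0≤T ⊕ *-nonNegative (0≤fromℕ 4) (≤⇒0≤ 1≤ρ))
            (solve 2 (λ a b → (num 2) :* a :+ (num 4) :* (b :- (con (+ 1))) :- ((con (+ 0)) :+ (con (+ 0))) :=
            (num 2) :* a :+ (num 4) :* (b :- (con (+ 1))) :- (con (+ 0))) refl T ρ))
        swept : s ≤ ρ * O + 0#
        swept = ≤-trans (sweep-stretch 1≤ρ (items I) (inOrder I) (All.universal 0≤arrival (items I)) ≤-refl ≤-refl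
            ≤-refl
                          (≤-reflexive (solve 1 (λ a → (con (+ 0)) :+ a :* ((con (+ 0)) :- (con (+ 0))) :=
                              (con (+ 0)) :+ (con (+ 0))) refl ρ)))
                        (*-monoʳ-≤ 0≤ρ (sweep≤OPT I) ⊕ ≤-refl)
        charged : f ≤ rate * v
        charged = ≤-≡-trans (∑-mono (items I) (λ {x} x∈ → each x (All.lookup 1≤d x∈))) (∑-* rate _ (items I))
          where
          each : ∀ x → 1# ≤ duration x → charge x ≤ rate * (size x * duration x)
          -- The part `2 T · size` does not involve the duration; durations of at least 1 turn it
          -- into volume.
          each x 1≤d = (≤-by (*-nonNegative (*-nonNegative (0≤fromℕ 2) (*-nonNegative 0≤T (0≤size x))) (≤⇒0≤ 1≤d))
              (solve 4 (λ a b c d → (num 2) :* (a :* b) :* (c :- (con (+ 1))) :- (con (+ 0)) :=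
              ((num 2) :* a :+ (num 4) :* (d :- (con (+ 1)))) :* (b :* c) :-
              ((num 2) :* (a :* b) :+ (num 4) :* (b :* ((d :- (con (+ 1))) :* c)))) refl T z d ρ))
            where
            z = size x
            d = duration x

      solution : ∀ I → All Admissible (items I) → All (λ x → 1# ≤ duration x) (items I) →
                 Σ (Run C strategy′ (initial I)) λ r → runCost r ≤ factor * OPT I
      solution I adm 1≤d =
        let m , bound = archimedean (measure (start-of I))
            r , cheap = simulate m (start-of I) (start-invariant I adm) bound
        in r , ≤-trans cheap (start-potential I 1≤d)

  -- The upper bound

  longest : ∀ x xs → ∃ λ L → All (λ y → duration y ≤ L) (x ∷ xs) × Any (λ y → duration y ≡ L) (x ∷ xs)
  longest x [] = duration x , (≤-refl ∷ []) , here refl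
  longest x (y ∷ ys) with longest y ys
  ... | L , below , attained with ≤-total (duration x) L
  ...   | inj₁ d≤L = L , (d≤L ∷ below) , there attained
  ...   | inj₂ L≤d = duration x , (≤-refl ∷ All.map (λ d′≤L → ≤-trans d′≤L L≤d) below) , here refl

  longest-of : ∀ I → MinDurationOne I → ∃ (LongestDuration I)
  longest-of I (_ , nonempty) with items I
  ... | x ∷ xs = longest x xs

  longest-unique : ∀ I {d d′} → LongestDuration I d → LongestDuration I d′ → d ≡ d′
  longest-unique I (below , attained) (below′ , attained′) with locate attained | locate attained′
  ... | x , x∈ , refl | y , y∈ , refl = ≤-antisym (All.lookup below′ x∈) (All.lookup below y∈)

  shortest-unique : ∀ I {d d′} → ShortestDuration I d → ShortestDuration I d′ → d ≡ d′
  shortest-unique I (above , attained) (above′ , attained′) with locate attained | locate attained′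
  ... | x , x∈ , refl | y , y∈ , refl = ≤-antisym (All.lookup above y∈) (All.lookup above′ x∈)

  ratio≡longest : ∀ I {L μ} → MinDurationOne I → LongestDuration I L → DurationRatio I μ → μ ≡ L
  ratio≡longest I {L} {μ} one longest (short , long , isShort , isLong , long≡μ*short) = begin
    μ         ≡⟨ sym (*-identityʳ μ) ⟩
    μ * 1#    ≡⟨ cong (μ *_) (shortest-unique I one isShort) ⟩
    μ * short ≡⟨ sym long≡μ*short ⟩
    long      ≡⟨ longest-unique I isLong longest ⟩
    L         ∎
    where open ≡-Reasoning

  upperBound : ∀ (C √C : ℝ) → 1# ≤ C → 0# ≤ √C → √C * √C ≡ C →
               ∃ λ (A : OnlineAlgorithm C MinDurationOne) →
                 ∀ (μ : ℝ) → Competitive A (λ I → DurationRatio I μ) (fromℕ 16 * (√C ⊓ μ))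
  upperBound C √C 1≤C 0≤√C √C²≡C =
    record { strategy = Algorithm.strategy′ C √C ; run = λ I one → proj₁ (result I one) } ,
    λ μ I one ratio → proj₂ (result I one) μ ratio
    where
    1≤√C = 1≤√ 1≤C 0≤√C √C²≡C
    Result : Instance → Set
    Result I = Σ (Run C (Algorithm.strategy′ C √C) (initial I)) λ r → ∀ μ → DurationRatio I μ → runCost r ≤ fromℕ 16
        * (√C ⊓ μ) * OPT I

    result : ∀ I → MinDurationOne I → Result I
    result I one@(1≤d , _) with longest-of I one
    ... | L , isLongest@(d≤L , attained) = by-cases (√C ≤? L)
      where
      1≤L : 1# ≤ L
      1≤L = let x , x∈ , d≡L = locate attained in ≤-≡-trans (All.lookup 1≤d x∈) d≡L
      finish : ∀ {k} m → √C ⊓ L ≡ m → k ≤ fromℕ 16 * m → (Σ (Run C (Algorithm.strategy′ C √C) (initial I)) λ r →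
          runCost r ≤ k * OPT I) → Result I
      finish {k} m eq k≤ (r , cheap) = r , λ μ ratio → ≤-trans cheap (≤-trans
        (subst₂ _≤_ (*-comm (OPT I) k) (*-comm (OPT I) (fromℕ 16 * m)) (*-monoʳ-≤ (0≤OPT I) k≤))
        (≤-reflexive (cong (λ z → fromℕ 16 * z * OPT I) (trans (sym eq)
            (cong (√C ⊓_) (sym (ratio≡longest I one isLongest ratio)))))))
      by-cases : Dec (√C ≤ L) → Result I
      -- Here `T = √C`, so `δ` is 0, and `factor` is `8 + 8 √C`, at most `16 √C`.
      by-cases (yes √C≤L) = finish √C (⊓-≤ √C≤L)
        (≤-by (*-monoʳ-≤ (0≤fromℕ 8) 1≤√C) (solve 1 (λ a → (num 8) :* a :- (num 8) :* (con (+ 1)) := (num 16) :* a :-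
            ((num 2) :* ((num 2) :+ a) :+ (num 2) :* a :+ (num 4) :* ((num 2) :+ a :- (con (+ 1))))) refl √C))
        (Algorithm.Analysis.solution C √C ρ √C 1≤C 0≤√C ≤-refl 1≤ρ I
            (All.map (λ {x} 1≤d → stretch x , inj₁ (-‿inverseʳ √C)) 1≤d) 1≤d)
        where
        ρ = fromℕ 2 + √C
        1≤ρ : 1# ≤ ρ
        1≤ρ = (≤-by (0≤√C ⊕ 0≤1) (solve 1 (λ a → a :+ (con (+ 1)) :- ((con (+ 0)) :+ (con (+ 0))) := (num 2) :+ a :-
            (con (+ 1))) refl √C))
        -- (1 + √C) d ≥ (1 + √C) (√C + k C) ≥ (k + 1) C
        stretch : ∀ x k → √C + fromℕ k * C ≤ duration x → fromℕ (suc k) * C ≤ (ρ - 1#) * duration x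
        stretch x k late = ≡-≤-trans (cong (fromℕ (suc k) *_) (sym √C²≡C))
          (≤-by (*-monoʳ-≤ (≤-trans 0≤1 (≤-by (0≤√C) (solve 1 (λ a → a :- (con (+ 0)) := (num 2) :+ a :- (con (+ 1))
              :- (con (+ 1))) refl √C))) (≡-≤-trans (cong (λ z → √C + fromℕ k * z) √C²≡C) late) ⊕ 0≤√C ⊕
              *-nonNegative 0≤√C (*-nonNegative (0≤fromℕ k) (*-nonNegative 0≤√C 0≤√C)))
              (solve 3 (λ a b c → ((num 2) :+ a :- (con (+ 1))) :* b :+ a :+ a :* (c :* (a :* a)) :-
              (((num 2) :+ a :- (con (+ 1))) :* (a :+ c :* (a :* a)) :+ (con (+ 0)) :+ (con (+ 0))) :=
              ((num 2) :+ a :- (con (+ 1))) :* b :- ((con (+ 1)) :+ c) :* (a :* a)) refl √C (duration x) (fromℕ k)))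
      -- Here `ρ = 1` and `T = L`: items are gone before the age `√C` at which they could be
      -- migrated, so the premise of the first part of `Admissible` is never met. `factor` is
      -- `2 + 2 L`.
      by-cases (no √C≰L) = finish L (⊓-≥ L≤√C)
        (≤-by (*-monoʳ-≤ (0≤fromℕ 2) 1≤L ⊕ *-nonNegative (0≤fromℕ 12) (≤-trans 0≤1 1≤L))
            (solve 1 (λ a → (num 2) :* a :+ (num 12) :* a :- ((num 2) :* (con (+ 1)) :+ (con (+ 0))) := (num 16) :* a
            :- ((num 2) :* (con (+ 1)) :+ (num 2) :* a :+ (num 4) :* ((con (+ 1)) :- (con (+ 1))))) refl L))
        (Algorithm.Analysis.solution C √C 1# L 1≤C (≤-trans 0≤1 1≤L) L≤√C ≤-refl I
            (All.map (λ {x} x≤L → stretch x x≤L , inj₂ (≡-≤-trans (*-identityˡ _) x≤L)) d≤L) 1≤d)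
        where
        L≤√C = ≰⇒≥ √C≰L
        stretch : ∀ x → duration x ≤ L → ∀ k → √C + fromℕ k * C ≤ duration x → fromℕ (suc k) * C ≤ (1# - 1#) *
            duration x
        stretch x x≤L k late = ⊥-elim (√C≰L (≤-by (late ⊕ x≤L ⊕ *-nonNegative (0≤fromℕ k) (≤-trans 0≤1 1≤C))
            (solve 5 (λ a b c d e → a :+ b :+ c :* d :- (e :+ c :* d :+ a :+ (con (+ 0))) := b :- e) refl
            (duration x) L (fromℕ k) C √C)))

  -- Averaging expected values

  module Averaging (P : ProbabilitySpace) where
    open ProbabilitySpace P hiding (Ω; MeasurableFunction; IsExpectation)

    Event : Set
    Event = Ω P → Bool

    ∅ : Event
    ∅ _ = false

    infixr 6 _∪_
    infixr 7 _∩_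
    _∪_ _∩_ : Event → Event → Event
    (A ∪ B) ω = A ω ∨ B ω
    (A ∩ B) ω = A ω ∧ B ω

    ∁ : Event → Event
    ∁ A ω = not (A ω)

    ∅-measurable : Measurable ∅
    ∅-measurable = complement whole

    -- The axioms speak of sequences of events; two events are padded with `∅`.
    pair : Event → Event → ℕ → Event
    pair A B 0             = A
    pair A B 1             = B
    pair A B (suc (suc _)) = ∅

    pair-measurable : ∀ {A B} → Measurable A → Measurable B → ∀ n → Measurable (pair A B n)
    pair-measurable mA mB 0             = mA
    pair-measurable mA mB 1             = mB
    pair-measurable mA mB (suc (suc _)) = ∅-measurable

    pair-union : ∀ {A B U} → (∀ ω → U ω ≡ (A ∪ B) ω) → IsUnion (pair A B) U
    pair-union {A} {B} {U} U≡ ω = mk⇔ to from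
      where
      split : ∀ a b → A ω ≡ a → B ω ≡ b → a ∨ b ≡ true → ∃ λ n → pair A B n ω ≡ true
      split true  b    A≡ B≡ _ = 0 , A≡
      split false true A≡ B≡ _ = 1 , B≡
      to : U ω ≡ true → ∃ λ n → pair A B n ω ≡ true
      to Uω = split (A ω) (B ω) refl refl (trans (sym (U≡ ω)) Uω)
      from : (∃ λ n → pair A B n ω ≡ true) → U ω ≡ true
      from (0 , Aω) = trans (U≡ ω) (cong (_∨ B ω) Aω)
      from (1 , Bω) = trans (U≡ ω) (trans (cong (A ω ∨_) Bω) (or-true (A ω)))
        where
        or-true : ∀ a → a ∨ true ≡ true
        or-true true  = refl
        or-true false = refl

    ∪-measurable : ∀ {A B} → Measurable A → Measurable B → Measurable (A ∪ B)
    ∪-measurable mA mB = union (pair-measurable mA mB) (pair-union (λ _ → refl))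

    ∩-measurable : ∀ {A B} → Measurable A → Measurable B → Measurable (A ∩ B)
    ∩-measurable {A} {B} mA mB = measurable-resp (λ ω → deMorgan (A ω) (B ω))
        (complement (∪-measurable (complement mA) (complement mB)))
      where
      deMorgan : ∀ a b → not (not a ∨ not b) ≡ a ∧ b
      deMorgan true  true  = refl
      deMorgan true  false = refl
      deMorgan false b     = refl

    -- The constant sequence `∅` is disjoint with union `∅`, so its partial sum `p + p` is at most
    -- `p`.
    Pr-∅ : Pr ∅ ≡ 0#
    Pr-∅ = ≤-antisym (≤-by (proj₁ sums (p + (p + 0#)) (2 , refl))
        (solve 1 (λ a → a :- (a :+ (a :+ (con (+ 0)))) := (con (+ 0)) :- a) refl p)) (Pr-nonNegative ∅-measurable)
      where
      p = Pr ∅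
      sums : HasSum (λ _ → p) p
      sums = Pr-additive {A = λ _ → ∅} (λ _ → ∅-measurable) (λ _ _ _ ()) (λ ω → mk⇔ (λ ()) (λ { (_ , ()) }))

    Pr-∪ : ∀ {A B U} → Measurable A → Measurable B → (∀ ω → A ω ≡ true → B ω ≡ true → ⊥) → (∀ ω → U ω ≡ (A ∪ B) ω) →
        Pr U ≡ Pr A + Pr B
    Pr-∪ {A} {B} {U} mA mB disjoint U≡ = ≤-antisym upper lower
      where
      sums : HasSum (λ n → Pr (pair A B n)) (Pr U)
      sums = Pr-additive (pair-measurable mA mB)
        (λ { 0 0 ω _ _ → refl ; 0 1 ω a b → ⊥-elim (disjoint ω a b) ; 1 0 ω b a → ⊥-elim (disjoint ω a b) ; 1 1 ω _ _
            → refl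
           ; (suc (suc _)) _ ω () _ ; 0 (suc (suc _)) ω _ () ; 1 (suc (suc _)) ω _ () })
        (pair-union U≡)
      rest : ∀ n → sum (applyUpTo (λ _ → Pr ∅) n) ≡ 0#
      rest zero    = refl
      rest (suc n) = trans (cong₂ _+_ Pr-∅ (rest n)) (+-identityˡ 0#)
      0≤A = Pr-nonNegative mA
      0≤B = Pr-nonNegative mB
      partial : ∀ n → sum (applyUpTo (λ n → Pr (pair A B n)) n) ≤ Pr A + Pr B
      partial 0             = (≤-by (0≤A ⊕ 0≤B) (solve 2 (λ a b → a :+ b :- ((con (+ 0)) :+ (con (+ 0))) := a :+ b :-
          (con (+ 0))) refl (Pr A) (Pr B)))
      partial 1             = (≤-by (0≤B) (solve 2 (λ a b → a :- (con (+ 0)) := b :+ a :- (b :+ (con (+ 0)))) refl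
          (Pr B) (Pr A)))
      partial (suc (suc n)) = ≤-reflexive (trans (cong (λ z → Pr A + (Pr B + z)) (rest n))
          (solve 2 (λ a b → a :+ (b :+ (con (+ 0))) := a :+ b) refl (Pr A) (Pr B)))
      upper : Pr U ≤ Pr A + Pr B
      upper with Pr U ≤? (Pr A + Pr B)
      ... | yes p = p
      ... | no ¬p with proj₂ sums (Pr A + Pr B) (≰⇒> ¬p)
      ...   | _ , (n , refl) , exceeds = ⊥-elim (<⇒≱ exceeds (partial n))
      lower : Pr A + Pr B ≤ Pr U
      lower = ≡-≤-trans (solve 2 (λ a b → a :+ b := a :+ (b :+ (con (+ 0)))) refl (Pr A) (Pr B))
          (proj₁ sums _ (2 , refl))

    Pr-split : ∀ {A B D} → Measurable A → Measurable B → Measurable D → Pr (D ∩ B) ≡ Pr (D ∩ A ∩ B) + Pr (D ∩ ∁ A ∩ B)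
    Pr-split {A} {B} {D} mA mB mD = Pr-∪ (∩-measurable mD (∩-measurable mA mB))
        (∩-measurable mD (∩-measurable (complement mA) mB))
      (λ ω → disjoint (A ω) (B ω) (D ω)) (λ ω → covers (A ω) (B ω) (D ω))
      where
      disjoint : ∀ a b d → d ∧ a ∧ b ≡ true → d ∧ not a ∧ b ≡ true → ⊥
      disjoint true  b true _ ()
      disjoint false b true () _
      covers : ∀ a b d → d ∧ b ≡ (d ∧ a ∧ b) ∨ (d ∧ not a ∧ b)
      covers true  true  true  = refl
      covers true  false true  = refl
      covers false b     true  = refl
      covers a     b     false = refl

    integralOn : Event → Simple → ℝ
    integralOn B φ = ∑ φ (λ cA → proj₁ cA * Pr (proj₂ cA ∩ B))

    integralOn-split : ∀ {A B} φ → IsSimple φ → Measurable A → Measurable B → integralOn B φ ≡ integralOn (A ∩ B) φ +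
        integralOn (∁ A ∩ B) φ
    integralOn-split []            []               mA mB = sym (+-identityˡ 0#)
    integralOn-split {A} {B} ((c , D) ∷ φ) ((_ , mD) ∷ simple) mA mB = trans
      (cong₂ (λ u v → c * u + v) (Pr-split mA mB mD) (integralOn-split φ simple mA mB))
      (solve 5 (λ a b c d e → a :* (b :+ c) :+ (d :+ e) := a :* b :+ d :+ (a :* c :+ e)) refl c (Pr (D ∩ A ∩ B))
          (Pr (D ∩ ∁ A ∩ B)) (integralOn (A ∩ B) φ) (integralOn (∁ A ∩ B) φ))

    -- Induction on the terms: inside `A` the other terms have to contribute `q - c`, outside it
    -- still `q`. Here `q` may become negative, and then the bound is trivial; if no term is left
    -- and `q` is positive, `B` is empty.
    bounded-below : ∀ {B} φ q → IsSimple φ → Measurable B → (∀ ω → B ω ≡ true → q ≤ value φ ω) → q * Pr B ≤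
        integralOn B φ
    bounded-below {B} [] q [] mB below with q ≤? 0#
    ... | yes q≤0 = (≤-by (*-nonNegative (≤⇒0≤ q≤0) (Pr-nonNegative mB))
        (solve 2 (λ a b → ((con (+ 0)) :- a) :* b :- (con (+ 0)) := (con (+ 0)) :- a :* b) refl q (Pr B)))
    ... | no  q≰0 = ≤-reflexive (trans (cong (q *_) (trans (Pr-resp (λ ω → empty (B ω) refl)) Pr-∅)) (zeroʳ q))
      where
      empty : ∀ {ω} b → B ω ≡ b → B ω ≡ false
      empty true  eq = ⊥-elim (q≰0 (below _ eq))
      empty false eq = eq
    bounded-below {B} ((c , A) ∷ φ) q ((0≤c , mA) ∷ simple) mB below = ≤-≡-trans
      (≤-by (≤-reflexive (cong (q *_) split) ⊕ inside ⊕ outside) (solve 7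
          (λ a b c d e f g → a :* (b :+ c) :+ d :+ e :- (a :* f :+ (a :- g) :* b :+ a :* c) := g :* b :+ (d :+ e) :-
          a :* f) refl q a b x y p c))
      (cong (λ z → c * a + z) (sym (integralOn-split φ simple mA mB)))
      where
      p = Pr B
      a = Pr (A ∩ B)
      b = Pr (∁ A ∩ B)
      x = integralOn (A ∩ B) φ
      y = integralOn (∁ A ∩ B) φ
      split : Pr B ≡ a + b
      split = Pr-split {D = λ _ → true} mA mB whole
      on : ∀ ω → A ω ∧ B ω ≡ true → A ω ≡ true × B ω ≡ true
      on ω eq with A ω
      ... | true = refl , eq
      off : ∀ ω → not (A ω) ∧ B ω ≡ true → A ω ≡ false × B ω ≡ true
      off ω eq with A ω
      ... | false = refl , eq
      inside : (q - c) * a ≤ x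
      inside = bounded-below φ (q - c) simple (∩-measurable mA mB) λ ω eq → let Aω , Bω = on ω eq in
        (≤-by (≤-≡-trans (below ω Bω) (cong (λ t → (if t then c else 0#) + value φ ω) Aω))
            (solve 3 (λ a b c → a :+ b :- c := b :- (c :- a)) refl c (value φ ω) q))
      outside : q * b ≤ y
      outside = bounded-below φ q simple (∩-measurable (complement mA) mB) λ ω eq → let Aω , Bω = off ω eq in
        ≤-≡-trans (below ω Bω) (trans (cong (λ t → (if t then c else 0#) + value φ ω) Aω) (+-identityˡ _))

    simpleIntegral-lower : ∀ φ q → IsSimple φ → (∀ ω → q ≤ value φ ω) → q ≤ simpleIntegral φ
    simpleIntegral-lower φ q simple below = ≤-trans
      (≤-reflexive (sym (trans (cong (q *_) Pr-whole) (*-identityʳ q))))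
      (≤-≡-trans (bounded-below φ q simple whole (λ ω _ → below ω)) (everywhere φ))
      where
      everywhere : ∀ φ → integralOn (λ _ → true) φ ≡ simpleIntegral φ
      everywhere []            = refl
      everywhere ((c , A) ∷ φ) = cong₂ (λ u v → c * u + v) (Pr-resp (λ ω → and-true (A ω))) (everywhere φ)
        where
        and-true : ∀ a → a ∧ true ≡ a
        and-true true  = refl
        and-true false = refl

    simpleIntegral-++ : ∀ φ ψ → simpleIntegral (φ ++ ψ) ≡ simpleIntegral φ + simpleIntegral ψ
    simpleIntegral-++ φ ψ = ∑-++ _ φ ψ

    value-++ : ∀ φ ψ ω → value (φ ++ ψ) ω ≡ value φ ω + value ψ ω
    value-++ φ ψ ω = ∑-++ _ φ ψ

    -- f truncated at δ n and rounded down to a multiple of δ.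
    layers : (Ω P → ℝ) → ℝ → ℕ → Simple
    layers f δ zero    = []
    layers f δ (suc n) = (δ , λ ω → not ⌊ f ω ≤? (δ * fromℕ (suc n)) ⌋) ∷ layers f δ n

    layers-simple : ∀ {f δ} n → MeasurableFunction P f → 0# ≤ δ → IsSimple (layers f δ n)
    layers-simple zero    mf 0≤δ = []
    layers-simple (suc n) mf 0≤δ = (0≤δ , complement (mf _)) ∷ layers-simple n mf 0≤δ

    module _ {f : Ω P → ℝ} {δ : ℝ} (0≤δ : 0# ≤ δ) (ω : Ω P) where

      layers-cap : ∀ n → value (layers f δ n) ω ≤ δ * fromℕ n
      layers-cap zero    = ≤-reflexive (sym (zeroʳ δ))
      layers-cap (suc n) with f ω ≤? (δ * fromℕ (suc n))
      ... | yes low  = ≡-≤-trans (+-identityˡ _) (≤-by (layers-cap n ⊕ 0≤δ)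
          (solve 3 (λ a b c → a :* b :+ a :- (c :+ (con (+ 0))) := a :* ((con (+ 1)) :+ b) :- c) refl δ k v))
        where
        v = value (layers f δ n) ω
        k = fromℕ n
      ... | no  high = (≤-by (layers-cap n) (solve 3 (λ a b c → a :* b :- c := a :* ((con (+ 1)) :+ b) :- (a :+ c))
          refl δ k v))
        where
        v = value (layers f δ n) ω
        k = fromℕ n

      layers-below : ∀ n → 0# ≤ f ω → value (layers f δ n) ω ≤ f ω
      layers-below zero    0≤f = 0≤f
      layers-below (suc n) 0≤f with f ω ≤? (δ * fromℕ (suc n))
      ... | yes low  = ≡-≤-trans (+-identityˡ _) (layers-below n 0≤f)
      ... | no  high = ≤-trans (≤-by (layers-cap n) (solve 3 (λ a b c → a :* b :- c := a :* ((con (+ 1)) :+ b) :-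
          (a :+ c)) refl δ k v)) (≰⇒≥ high)
        where
        v = value (layers f δ n) ω
        k = fromℕ n

      layers-close : ∀ n → f ω ≤ value (layers f δ n) ω + δ ⊎ value (layers f δ n) ω ≡ δ * fromℕ n
      layers-close zero = inj₂ (sym (zeroʳ δ))
      layers-close (suc n) with f ω ≤? (δ * fromℕ (suc n)) | layers-close n
      ... | yes low  | inj₁ close = inj₁ (≤-≡-trans close (cong (_+ δ) (sym (+-identityˡ _))))
      ... | yes low  | inj₂ eq    = inj₁ (≤-trans low (≤-reflexive
          (trans (trans (solve 2 (λ a b → a :* ((con (+ 1)) :+ b) := a :* b :+ a) refl δ (fromℕ n))
          (cong (_+ δ) (sym eq))) (cong (_+ δ) (sym (+-identityˡ _))))))
      ... | no  high | inj₁ close = inj₁ (≤-by (close ⊕ 0≤δ) (solve 3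
          (λ a b c → a :+ b :+ b :- (c :+ (con (+ 0))) := b :+ a :+ b :- c) refl v δ (f ω)))
        where v = value (layers f δ n) ω
      ... | no  high | inj₂ eq    = inj₂ (trans (cong (_+_ δ) eq)
          (solve 2 (λ a b → a :+ a :* b := a :* ((con (+ 1)) :+ b)) refl δ (fromℕ n)))

    -- A one-sided substitute for linearity of expectation. The layers of all `f i` together form
    -- one simple function that is everywhere at least `Q` minus `δ` per index: at each outcome
    -- either every `f i` is met within `δ`, or one of them is truncated at `δ n`, which alone
    -- reaches `Q`.
    average : {I : Set} (is : List I) (f : I → Ω P → ℝ) (e : I → ℝ) {δ Q : ℝ} (n : ℕ) → 0# ≤ δ → Q ≤ δ * fromℕ n →
              (∀ i → MeasurableFunction P (f i)) → (∀ i ω → 0# ≤ f i ω) → (∀ i → IsExpectation P (f i) (e i)) →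
              (∀ ω → Q ≤ ∑ is (λ i → f i ω)) → Q ≤ ∑ is e + δ * fromℕ (length is)
    average {I} is f e {δ} {Q} n 0≤δ Q≤δn mf 0≤f expects below =
      (≤-by (simpleIntegral-lower (stack is) (Q - D) (simple is) bound ⊕ ≡-≤-trans (integrals is)
          (∑-mono is (λ {i} _ → proj₁ (expects i) _ (φ i , layers-simple n (mf i) 0≤δ ,
          (λ ω → layers-below 0≤δ ω n (0≤f i ω)) , refl)))) (solve 4
          (λ a b c d → a :+ b :- (c :- d :+ a) := b :+ d :- c) refl s E Q D))
      where
      φ : I → Simple
      φ i = layers (f i) δ n
      stack : List I → Simple
      stack is = concatMap φ is
      E = ∑ is e
      D = δ * fromℕ (length is)
      s = simpleIntegral (stack is)
      simple : ∀ is → IsSimple (stack is)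
      simple []       = []
      simple (i ∷ is) = All.++⁺ (layers-simple n (mf i) 0≤δ) (simple is)
      integrals : ∀ is → simpleIntegral (stack is) ≡ ∑ is (λ i → simpleIntegral (φ i))
      integrals []       = refl
      integrals (i ∷ is) = trans (simpleIntegral-++ (φ i) (stack is))
          (cong (_+_ (simpleIntegral (φ i))) (integrals is))
      0≤value : ∀ {ψ} ω → IsSimple ψ → 0# ≤ value ψ ω
      0≤value ω []                         = ≤-refl
      0≤value ω (_∷_ {c , A} (0≤c , _) simple) = ≡-≤-trans (sym (+-identityˡ 0#)) (term (A ω) ⊕ 0≤value ω simple)
        where
        term : ∀ b → 0# ≤ (if b then c else 0#)
        term true  = 0≤c
        term false = ≤-refl
      close : ∀ ω is → ∑ is (λ i → f i ω) ≤ value (stack is) ω + δ * fromℕ (length is) ⊎ Q ≤ value (stack is) ω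
      close ω []       = inj₁ (≤-reflexive (solve 1 (λ a → con (+ 0) := (con (+ 0)) :+ a :* (con (+ 0))) refl δ))
      close ω (i ∷ is) with layers-close {f i} 0≤δ ω n | close ω is
      ... | inj₂ full | _          = inj₂ (≤-≡-trans (≤-trans (≤-trans Q≤δn (≤-reflexive (sym full)))
              (≤-by (0≤value ω (simple is)) (solve 2 (λ a b → a :- (con (+ 0)) := b :+ a :- b) refl
                  (value (stack is) ω) (value (φ i) ω)))) (sym (value-++ (φ i) (stack is) ω)))
      ... | inj₁ near | inj₂ full  = inj₂ (≤-≡-trans (≤-trans full
              (≤-by (0≤value ω (layers-simple {f i} n (mf i) 0≤δ))
                  (solve 2 (λ a b → a :- (con (+ 0)) := a :+ b :- b) refl (value (φ i) ω) (value (stack is) ω))))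
                  (sym (value-++ (φ i) (stack is) ω)))
      ... | inj₁ near | inj₁ nears = inj₁ (≤-≡-trans
              (≤-by (near ⊕ nears) (solve 6 (λ a b c d e f → a :+ b :+ (c :+ b :* d) :- (e :+ f) := a :+ c :+ b :*
                  ((con (+ 1)) :+ d) :- (e :+ f)) refl u δ v k (f i ω) S))
              (cong (_+ δ * fromℕ (suc (length is))) (sym (value-++ (φ i) (stack is) ω))))
        where
        S = ∑ is (λ i → f i ω)
        u = value (φ i) ω
        v = value (stack is) ω
        k = fromℕ (length is)
      bound : ∀ ω → Q - D ≤ value (stack is) ω
      bound ω with close ω is
      ... | inj₁ near = (≤-by (below ω ⊕ near) (solve 4 (λ a b c d → a :+ (b :+ c) :- (d :+ a) := b :- (d :- c)) refl
          F v D Q))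
        where
        v = value (stack is) ω
        F = ∑ is (λ i → f i ω)
      ... | inj₂ full = (≤-by (full ⊕ *-nonNegative 0≤δ (0≤fromℕ (length is)))
          (solve 3 (λ a b c → a :+ b :- (c :+ (con (+ 0))) := a :- (c :- b)) refl v D Q))
        where v = value (stack is) ω

  -- Cost after the last arrival

  migrateTo-inv : ∀ {C i b st st′} → migrateTo C i b st ≡ next st′ →
                  ∃ λ r → r ∈ active st × name r ≡ i × Fits (weight r) b (active st) ×
                  st′ ≡ record st { active = map (reassign C i b) (active st) ; history = migrated i b ∷ history st }
  migrateTo-inv {C} {i} {b} {st} {st′} eq with find-cases (λ r → name r ℕ.≟ i) (active st)
  ... | inj₂ (_ , none) rewrite none = case eq of λ ()
  ... | inj₁ (r , r∈ , name≡ , some) rewrite some = by-cases (bin r ℕ.≟ b) (fits? (weight r) b (active st)) eq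
    where
    st″ = record st { active = map (reassign C i b) (active st) ; history = migrated i b ∷ history st }
    by-cases : (d : Dec (bin r ≡ b)) (d′ : Dec (Fits (weight r) b (active st))) →
               (if does d then illegal else if does d′ then next st″ else illegal) ≡ next st′ →
               ∃ λ r → r ∈ active st × name r ≡ i × Fits (weight r) b (active st) × st′ ≡ st″
    by-cases (no _) (yes fits) refl = r , r∈ , name≡ , fits , refl

  placeIn-inv : ∀ {b x st st′} → placeIn b x st ≡ next st′ →
                Fits (size x) b (active st) ×
                st′ ≡ record st { active = resident (arrivals st) (size x) b (departure x) ∷ active st ; pending =
                    nothing
                                ; arrivals = suc (arrivals st) ; history = placed b ∷ history st }
  placeIn-inv {b} {x} {st} {st′} eq = by-cases (fits? (size x) b (active st)) eq
    where
    st″ = record st { active = resident (arrivals st) (size x) b (departure x) ∷ active st ; pending = nothing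
                    ; arrivals = suc (arrivals st) ; history = placed b ∷ history st }
    by-cases : (d : Dec (Fits (size x) b (active st))) → (if does d then next st″ else illegal) ≡ next st′ → Fits
        (size x) b (active st) × st′ ≡ st″
    by-cases (yes fits) refl = fits , refl

  alarm-inv : ∀ {t st st′} → occur (alarm! t) st ≡ next st′ → now st < t × st′ ≡ record st
      { now = t ; history = alarmed t ∷ history st }
  alarm-inv {t} {st} {st′} eq = by-cases (now st <? t) eq
    where
    by-cases : (d : Dec (now st < t)) → (if does d then next (record st
        { now = t ; history = alarmed t ∷ history st }) else illegal) ≡ next st′ →
               now st < t × st′ ≡ record st { now = t ; history = alarmed t ∷ history st }
    by-cases (yes now<t) refl = now<t , refl

  if-≢ : {P A : Set} (d : Dec P) {x y z : A} → x ≢ z → y ≢ z → (if does d then x else y) ≢ z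
  if-≢ (yes _) x≢z y≢z = x≢z
  if-≢ (no _)  x≢z y≢z = y≢z

  perform≢finished : ∀ {C} a st → perform C a st ≢ finished
  perform≢finished (place b) (state _ rs (just x) _ _ _) = if-≢ (fits? (size x) b rs) (λ ()) (λ ())
  perform≢finished (place b) (state _ _ nothing _ _ _) ()
  perform≢finished {C} (migrate i b) st eq with find-cases (λ r → name r ℕ.≟ i) (active st)
  ... | inj₂ (_ , none) rewrite none = case eq of λ ()
  ... | inj₁ (r , r∈ , name≡ , some) rewrite some =
    if-≢ (bin r ℕ.≟ b) (λ ()) (if-≢ (fits? (weight r) b (active st)) (λ ()) (λ ())) eq
  perform≢finished (wait alarm) (state _ _ (just _) _ _ _) ()
  perform≢finished (wait alarm) st@(state t _ nothing _ _ _) eq with waitFor-upcoming alarm st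
  ... | inj₂ (illegal≡ , _) = case trans (sym illegal≡) eq of λ ()
  ... | inj₁ (departure! _ , _ , occurs) = case trans (sym occurs) eq of λ ()
  ... | inj₁ (arrival! _ _ , _ , occurs) = case trans (sym occurs) eq of λ ()
  ... | inj₁ (alarm! u , _ , occurs) = if-≢ (t <? u) (λ ()) (λ ()) (trans (sym occurs) eq)

  reassign-same : ∀ {C i b} r → name r ≡ i → reassign C i b r ≡ record r { bin = b ; leaves = leaves r + C }
  reassign-same {i = i} r eq = if-yes (name r ℕ.≟ i) eq

  reassign-other : ∀ {C i b} r → name r ≢ i → reassign C i b r ≡ r
  reassign-other {i = i} r neq = if-no (name r ℕ.≟ i) neq

  reassign-name : ∀ C i b r → name (reassign C i b r) ≡ name r
  reassign-name C i b r with does (name r ℕ.≟ i)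
  ... | true  = refl
  ... | false = refl

  reassign-weight : ∀ C i b r → weight (reassign C i b r) ≡ weight r
  reassign-weight C i b r with does (name r ℕ.≟ i)
  ... | true  = refl
  ... | false = refl

  reassign-leaves : ∀ {C} i b r → 0# ≤ C → leaves r ≤ leaves (reassign C i b r)
  reassign-leaves {C} i b r 0≤C with does (name r ℕ.≟ i)
  ... | true  = (≤-by (0≤C) (solve 2 (λ a b → a :- (con (+ 0)) := b :+ a :- b) refl C (leaves r)))
  ... | false = ≤-refl

  Distinct : List Resident → Set
  Distinct = AllPairs (λ r r′ → name r ≢ name r′)

  same-name : ∀ {rs r r′} → Distinct rs → r ∈ rs → r′ ∈ rs → name r ≡ name r′ → r ≡ r′
  same-name _          (here refl) (here refl) _  = refl
  same-name (r≢ ∷ _)   (here refl) (there r′∈) eq = ⊥-elim (All.lookup r≢ r′∈ eq)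
  same-name (r′≢ ∷ _)  (there r∈)  (here refl) eq = ⊥-elim (All.lookup r′≢ r∈ (sym eq))
  same-name (_ ∷ uniq) (there r∈)  (there r′∈) eq = same-name uniq r∈ r′∈ eq

  record Tidy (w : ℝ) (rs : List Resident) : Set where
    field
      weights  : All (λ r → weight r ≡ w) rs
      loads    : ∀ b → guestLoad b rs ≤ 1#
      distinct : Distinct rs

  open Tidy

  module _ {w : ℝ} (0≤w : 0# ≤ w) where

    0≤weights : ∀ {rs} → Tidy w rs → ∀ {r} → r ∈ rs → 0# ≤ weight r
    0≤weights tidy r∈ = ≤-≡-trans 0≤w (sym (All.lookup (weights tidy) r∈))

    tidy-filter : ∀ {P : Resident → Set} (P? : ∀ r → Dec (P r)) {rs} → Tidy w rs → Tidy w (filter P? rs)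
    tidy-filter P? {rs} tidy = record
      { weights  = All.filter⁺ P? (weights tidy)
      ; loads    = λ b → ≤-trans (∑-filter-≤ P? rs (λ {r} r∈ → 0≤weightIn b (bin r) (0≤weights tidy r∈)))
          (loads tidy b)
      ; distinct = AllPairs.filter⁺ P? (distinct tidy)
      }

    tidy-reassign : ∀ {C i b rs r} → Tidy w rs → r ∈ rs → name r ≡ i → Fits (weight r) b rs → Tidy w
        (map (reassign C i b) rs)
    tidy-reassign {C} {i} {b} {rs} {r} tidy r∈ name≡ fits = record
      { weights  = All.map⁺ (All.map (λ {r} → trans (reassign-weight C i b r)) (weights tidy))
      ; loads    = loads′
      ; distinct = AllPairs.map⁺ (AllPairs.map (λ {r} {r′} neq eq →
          neq (trans (sym (reassign-name C i b r)) (trans eq (reassign-name C i b r′)))) (distinct tidy))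
      }
      where
      contribution : ℕ → Resident → ℝ
      contribution c r = weightIn c (bin r) (weight r)
      changed : ∀ c {Δ} → weightIn c b (weight r) ≤ contribution c r + Δ → guestLoad c (map (reassign C i b) rs) ≤
          guestLoad c rs + Δ
      changed c bound = ≡-≤-trans (∑-map (contribution c) (reassign C i b) rs) (∑-change-at name rs (distinct tidy) r∈
        (λ {r′} _ neq → ≤-reflexive (cong (contribution c) (reassign-other r′ (λ eq → neq (trans eq (sym name≡))))))
        (≡-≤-trans (cong (contribution c) (reassign-same r name≡)) bound))
      loads′ : ∀ c → guestLoad c (map (reassign C i b) rs) ≤ 1#
      loads′ c with c ℕ.≟ b
      ... | yes refl = ≤-trans (changed c (≡-≤-trans (weightIn-same c (weight r))
              (≤-by (0≤weightIn c (bin r) (0≤weights tidy r∈)) (solve 2 (λ a b → a :- (con (+ 0)) := a :+ b :- b)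
                  refl u v))))
              (≡-≤-trans (cong (_+ weight r) (sym (load≡guestLoad c rs))) fits)
        where
        u = contribution c r
        v = weight r
      ... | no c≢b = ≤-trans (changed c (≡-≤-trans (weightIn-other (weight r) (c≢b ∘ sym))
              (≤-by (0≤weightIn c (bin r) (0≤weights tidy r∈)) (solve 1
                  (λ a → a :- (con (+ 0)) := a :+ (con (+ 0)) :- (con (+ 0))) refl u))))
              (≡-≤-trans (+-identityʳ _) (loads tidy c))
        where u = contribution c r

  total-weight≤ : ∀ {w rs} → Tidy w rs → ∑ rs weight ≤ fromℕ (length (dedup (map bin rs)))
  total-weight≤ {w} {rs} tidy = ≡-≤-trans (sym (∑-map proj₂ (λ r → bin r , weight r) rs))
    (total-load≤ (DecUnique.deduplicate-! ℕ._≟_ (map bin rs)) (map (λ r → bin r , weight r) rs)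
      (All.map⁺ (All.tabulate (λ r∈ → ∈-deduplicate⁺ ℕ._≟_ (∈-map⁺ bin r∈))))
      (λ {b} _ → ≡-≤-trans (load≡guestLoad b rs) (loads tidy b)))

  module Accounting {C w m : ℝ} (1≤C : 1# ≤ C) (0≤w : 0# ≤ w) (0≤m : 0# ≤ m) (m≤2wC : m ≤ fromℕ 2 * (w * C)) where

    0≤C : 0# ≤ C
    0≤C = ≤-trans 0≤1 1≤C

    longBins : List Resident → List ℕ
    longBins rs = dedup (map bin (filter (λ r → m ≤? leaves r) rs))

    longBins-⊆ : ∀ {rs ys} → (∀ {r} → r ∈ rs → m ≤ leaves r → bin r ∈ ys) → length (longBins rs) ℕ.≤ length ys
    longBins-⊆ {rs} covered = dedup-⊆-length λ b∈ → let r , r∈ , b≡ = ∈-map⁻ bin b∈ in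
      let r∈rs , long = ∈-filter⁻ (λ r → m ≤? leaves r) {xs = rs} r∈ in subst (_∈ _) (sym b≡) (covered r∈rs long)

    ∈-longBins : ∀ {rs r} → r ∈ rs → m ≤ leaves r → bin r ∈ longBins rs
    ∈-longBins r∈ long = ∈-deduplicate⁺ ℕ._≟_ (∈-map⁺ bin (∈-filter⁺ (λ r → m ≤? leaves r) r∈ long))

    volumeLeft : ℝ → List Resident → ℝ
    volumeLeft t rs = ∑ rs (λ r → weight r * (leaves r - t))

    -- A migration that empties a long bin is paid for by the volume w C ≥ m / 2 it adds.
    potential : ℝ → List Resident → ℝ
    potential t rs = fromℕ 2 * volumeLeft t rs + (0# ⊔ (m - t)) * fromℕ (length (longBins rs))

    -- The factor is `3 = 2 + 1`. The volume shrinks at a rate equal to the total weight, hence at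
    -- most the number of open bins, and it is counted twice; the other term shrinks at a rate equal
    -- to the number of long bins. Before time `m` no long bin is lost, since the items that make it
    -- long stay until `m`.
    time-passes : ∀ {t t′ rs rs′} → Tidy w rs → t ≤ t′ →
                  (∀ {r} → r ∈ rs → t′ < leaves r → r ∈ rs′) → volumeLeft t′ rs ≤ volumeLeft t′ rs′ →
                  potential t rs ≤ fromℕ 3 * ((t′ - t) * fromℕ (length (dedup (map bin rs)))) + potential t′ rs′
    time-passes {t} {t′} {rs} {rs′} tidy t≤t′ kept volume≤ =
      (≤-by (*-monoʳ-≤ (0≤fromℕ 2) spent ⊕ *-monoʳ-≤ (0≤fromℕ 2) volume≤ ⊕ *-monoʳ-≤ (0≤fromℕ 2)
          (*-monoʳ-≤ 0≤Δ (total-weight≤ tidy)) ⊕ long-part) (solve 9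
          (λ a b c d e f g h i → (num 2) :* (a :+ (b :- c) :* d) :+ (num 2) :* e :+ (num 2) :* ((b :- c) :* f) :+
          ((b :- c) :* f :+ g) :- ((num 2) :* h :+ (num 2) :* a :+ (num 2) :* ((b :- c) :* d) :+ i) := (num 3) :*
          ((b :- c) :* f) :+ ((num 2) :* e :+ g) :- ((num 2) :* h :+ i)) refl v′ t′ t s v″ o X′ v X))
      where
      0≤Δ = ≤⇒0≤ t≤t′
      s = ∑ rs weight
      o = fromℕ (length (dedup (map bin rs)))
      v = volumeLeft t rs
      v′ = volumeLeft t′ rs
      v″ = volumeLeft t′ rs′
      D = fromℕ (length (longBins rs))
      D′ = fromℕ (length (longBins rs′))
      X = (0# ⊔ (m - t)) * D
      X′ = (0# ⊔ (m - t′)) * D′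
      spent : v ≤ v′ + (t′ - t) * s
      spent = ≤-reflexive (trans (∑-cong rs (λ {r} _ → (solve 4 (λ a b c d → a :* (b :- c) := a :* (b :- d) :+
          (d :- c) :* a) refl (weight r) (leaves r) t t′)))
        (trans (∑-+ _ _ rs) (cong (_+_ v′) (∑-* (t′ - t) weight rs))))
      D≤o : D ≤ o
      D≤o = fromℕ-mono-≤ (longBins-⊆ {rs} λ r∈ _ → ∈-deduplicate⁺ ℕ._≟_ (∈-map⁺ bin r∈))
      0≤D = 0≤fromℕ (length (longBins rs))
      long-part : X ≤ (t′ - t) * o + X′
      long-part with m ≤? t′
      ... | yes m≤t′ = ≤-trans
        (*-mono-≤ 0≤Δ 0≤D (⊔-lub 0≤Δ (≤-by (m≤t′) (solve 3 (λ a b c → a :- b := a :- c :- (b :- c)) refl t′ m t)))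
            D≤o)
        (≤-by (*-nonNegative (x≤x⊔y 0# (m - t′)) (0≤fromℕ (length (longBins rs′))))
            (solve 4 (λ a b c d → a :- (con (+ 0)) := (b :- c) :* d :+ a :- (b :- c) :* d) refl X′ t′ t o))
      ... | no m≰t′ = subst₂ (λ x x′ → x * D ≤ (t′ - t) * o + x′ * D′)
        (sym (⊔-≤ (≤⇒0≤ (≤-trans t≤t′ t′≤m)))) (sym (⊔-≤ (≤⇒0≤ t′≤m)))
        (≤-by (*-monoʳ-≤ 0≤Δ D≤o ⊕ *-monoʳ-≤ (≤⇒0≤ t′≤m) D≤D′) (solve 6
            (λ a b c d e f → (a :- b) :* c :+ (d :- a) :* e :- ((a :- b) :* f :+ (d :- a) :* f) := (a :- b) :* c :+
            (d :- a) :* e :- (d :- b) :* f) refl t′ t o m D′ D))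
        where
        t′≤m = ≰⇒≥ m≰t′
        D≤D′ : D ≤ D′
        D≤D′ = fromℕ-mono-≤ (longBins-⊆ {rs} λ r∈ long → ∈-longBins (kept r∈ (<-≤-trans (≰⇒> m≰t′) long)) long)

    migration-pays : ∀ {t i b rs r} → 0# ≤ t → Tidy w rs → r ∈ rs → name r ≡ i → potential t rs ≤ potential t
        (map (reassign C i b) rs)
    migration-pays {t} {i} {b} {rs} {r} 0≤t tidy r∈ name≡ =
      (≤-by (*-monoʳ-≤ (0≤fromℕ 2) gained ⊕ m≤2wC ⊕ *-monoʳ-≤ (x≤x⊔y 0# (m - t)) (fromℕ-mono-≤ D≤1+D′) ⊕ ⊔-lub 0≤m
          (≤-by (0≤t) (solve 2 (λ a b → a :- (con (+ 0)) := b :- (b :- a)) refl t m)))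
          (solve 8 (λ a b c d e f g h → (num 2) :* a :+ (num 2) :* (b :* c) :+ d :* ((con (+ 1)) :+ e) :+ f :-
          ((num 2) :* (g :+ b :* c) :+ f :+ d :* h :+ d) := (num 2) :* a :+ d :* e :- ((num 2) :* g :+ d :* h)) refl
          v′ w C x D′ m v D))
      where
      rs′ = map (reassign C i b) rs
      x = 0# ⊔ (m - t)
      v = volumeLeft t rs
      v′ = volumeLeft t rs′
      D = fromℕ (length (longBins rs))
      D′ = fromℕ (length (longBins rs′))
      gained : v + w * C ≤ v′
      gained = ≤-≡-trans (∑-gap rs later r∈ more) (sym (∑-map _ (reassign C i b) rs))
        where
        later : ∀ {r} → r ∈ rs → weight r * (leaves r - t) ≤ weight (reassign C i b r) *
            (leaves (reassign C i b r) - t)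
        later {r} r∈ = ≤-≡-trans (*-monoʳ-≤ (0≤weights 0≤w tidy r∈) (reassign-leaves i b r 0≤C ⊕ ≤-refl))
            (cong (_* (leaves (reassign C i b r) - t)) (sym (reassign-weight C i b r)))
        more : weight r * (leaves r - t) + w * C ≤ weight (reassign C i b r) * (leaves (reassign C i b r) - t)
        more = ≤-reflexive (trans (cong (λ w → weight r * (leaves r - t) + w * C)
            (sym (All.lookup (weights tidy) r∈)))
          (trans (solve 4 (λ a b c d → a :* (b :- c) :+ a :* d := a :* (b :+ d :- c)) refl (weight r) (leaves r) t C)
            (cong (λ r → weight r * (leaves r - t)) (sym (reassign-same r name≡)))))
      D≤1+D′ : length (longBins rs) ℕ.≤ suc (length (longBins rs′))
      D≤1+D′ = longBins-⊆ {rs} {ys = bin r ∷ longBins rs′} covered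
        where
        covered : ∀ {r′} → r′ ∈ rs → m ≤ leaves r′ → bin r′ ∈ bin r ∷ longBins rs′
        covered {r′} r′∈ long with name r′ ℕ.≟ i
        ... | yes eq = here (cong bin (same-name (distinct tidy) r′∈ r∈ (trans eq (sym name≡))))
        ... | no neq = there (∈-longBins (subst (_∈ rs′) (reassign-other r′ neq) (∈-map⁺ (reassign C i b) r′∈)) long)

    cost-bound : ∀ {σ t rs n h} (run : Run C σ (state t rs nothing [] n h)) → 0# ≤ t → Tidy w rs → All
        (λ r → t ≤ leaves r) rs →
                 potential t rs ≤ fromℕ 3 * runCost run
    cost-bound {t = t} {rs = []} (stop _) _ _ _ = ≤-reflexive (solve 1
        (λ a → (num 2) :* (con (+ 0)) :+ a :* (con (+ 0)) := (num 3) :* (con (+ 0))) refl x)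
      where x = 0# ⊔ (m - t)
    cost-bound {rs = []} (() ▸ _)
    cost-bound {σ} {t} {rs = r₀ ∷ rs₀} {n} {h} (stop eq) _ _ _ = ⊥-elim
        (perform≢finished (σ h) (state t (r₀ ∷ rs₀) nothing [] n h) eq)
    cost-bound {σ} {t} {rs = r₀ ∷ rs₀} {n} {h} (_▸_ {st′} eq run) 0≤t tidy stays with σ h
    cost-bound {rs = r₀ ∷ rs₀} (() ▸ run) 0≤t tidy stays | place b
    cost-bound {σ} {t} {rs = r₀ ∷ rs₀} {n} {h} (_▸_ {st′} eq run) 0≤t tidy stays | migrate i b
      with migrateTo-inv {C} {i} {b} {state t (r₀ ∷ rs₀) nothing [] n h} eq
    ... | r , r∈ , name≡ , fits , refl = ≤-trans (migration-pays {i = i} {b} 0≤t tidy r∈ name≡) (≤-trans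
      (cost-bound run 0≤t (tidy-reassign 0≤w {C} tidy r∈ name≡ fits)
        (All.map⁺ (All.map (λ {r} t≤ → ≤-trans t≤ (reassign-leaves i b r 0≤C)) stays)))
      (≤-reflexive (solve 3 (λ a b c → (num 3) :* a := (num 3) :* ((b :- b) :* c :+ a)) refl c t o)))
      where
      c = runCost run
      o = fromℕ (length (dedup (map bin (r₀ ∷ rs₀))))
    cost-bound {σ} {t} {rs = rs@(r₀ ∷ rs₀)} {n} {h} (_▸_ {st′} eq run) 0≤t tidy stays | wait alarm
      with waitFor-upcoming alarm (state t rs nothing [] n h)
    ... | inj₂ (illegal≡ , _) = case trans (sym illegal≡) eq of λ ()
    ... | inj₁ (s , up , occurs) with isCandidate up | trans (sym occurs) eq
    ...   | departs {r} r∈ | refl = ≤-trans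
      (time-passes {t} {t′} {rs} {rs′} tidy t≤t′ (λ r∈ t′<l → ∈-filter⁺ (λ r → t′ <? leaves r) r∈ t′<l) volume≤)
      (≤-trans (≤-refl ⊕ cost-bound run (≤-trans 0≤t t≤t′) (tidy-filter 0≤w (λ r → t′ <? leaves r) tidy)
          (All.filter⁺ (λ r → t′ <? leaves r) stays′))
        (≤-reflexive (solve 4 (λ a b c d → (num 3) :* ((a :- b) :* c) :+ (num 3) :* d := (num 3) :*
            ((a :- b) :* c :+ d)) refl t′ t o c)))
      where
      t′ = leaves r
      rs′ = filter (λ r → t′ <? leaves r) rs
      c = runCost run
      o = fromℕ (length (dedup (map bin rs)))
      t≤t′ = All.lookup stays r∈
      stays′ : All (λ r → t′ ≤ leaves r) rs
      stays′ = All.tabulate (λ r∈ → isFirst up (departs r∈))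
      volume≤ : volumeLeft t′ rs ≤ volumeLeft t′ rs′
      volume≤ = ≤-trans (∑-mono rs (λ {r′} r′∈ → each r′ r′∈ (t′ <? leaves r′)))
          (≤-reflexive (sym (∑-filter (λ r → t′ <? leaves r) _ rs)))
        where
        each : ∀ r′ → r′ ∈ rs → (d : Dec (t′ < leaves r′)) → weight r′ * (leaves r′ - t′) ≤
            (if does d then weight r′ * (leaves r′ - t′) else 0#)
        each r′ r′∈ (yes _) = ≤-refl
        each r′ r′∈ (no ¬p) = ≤-reflexive (trans (cong (λ l → weight r′ * (l - t′))
            (≤-antisym (≮⇒≥ ¬p) (All.lookup stays′ r′∈))) (solve 2 (λ a b → a :* (b :- b) := con (+ 0)) refl
            (weight r′) t′))
    ...   | alarms {t′} _ | eq′ with alarm-inv {t′} {state t rs nothing [] n h} eq′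
    ...     | t<t′ , refl = ≤-trans
      (time-passes {t} {t′} {rs} {rs} tidy (proj₁ t<t′) (λ r∈ _ → r∈) ≤-refl)
      (≤-trans (≤-refl ⊕ cost-bound run (≤-trans 0≤t (proj₁ t<t′)) tidy
          (All.tabulate (λ r∈ → isFirst up (departs r∈))))
        (≤-reflexive (solve 4 (λ a b c d → (num 3) :* ((a :- b) :* c) :+ (num 3) :* d := (num 3) :*
            ((a :- b) :* c :+ d)) refl t′ t o c)))
      where
      c = runCost run
      o = fromℕ (length (dedup (map bin rs)))

  -- Random choices in blocks

  choices : ∀ g k → List (Vec (Fin g) k)
  choices g zero    = [] ∷ []
  choices g (suc k) = concatMap (λ c → map (c ∷_) (choices g k)) (allFin g)

  ∑-choices-suc : ∀ g k (f : Vec (Fin g) (suc k) → ℝ) → ∑ (choices g (suc k)) f ≡ ∑ (allFin g)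
      (λ c → ∑ (choices g k) (λ v → f (c ∷ v)))
  ∑-choices-suc g k f = trans (∑-concatMap f (λ c → map (c ∷_) (choices g k)) (allFin g))
    (∑-cong (allFin g) (λ {c} _ → ∑-map f (c ∷_) (choices g k)))

  #choices : ℕ → ℕ → ℝ
  #choices g k = fromℕ (length (choices g k))

  ∑-allFin-const : ∀ g c → ∑ (allFin g) (λ _ → c) ≡ c * fromℕ g
  ∑-allFin-const g c = trans (∑-const c (allFin g)) (cong (λ n → c * fromℕ n) (length-tabulate {n = g} id))

  #choices-suc : ∀ g k → #choices g (suc k) ≡ #choices g k * fromℕ g
  #choices-suc g k = begin
    #choices g (suc k)                             ≡⟨ as-sum (choices g (suc k)) ⟩
    ∑ (choices g (suc k)) (λ _ → 1#)               ≡⟨ ∑-choices-suc g k (λ _ → 1#) ⟩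
    ∑ (allFin g) (λ _ → ∑ (choices g k) (λ _ → 1#)) ≡⟨ ∑-cong (allFin g) (λ _ → sym (as-sum (choices g k))) ⟩
    ∑ (allFin g) (λ _ → #choices g k)              ≡⟨ ∑-allFin-const g (#choices g k) ⟩
    #choices g k * fromℕ g                         ∎
    where
    open ≡-Reasoning
    as-sum : {A : Set} (xs : List A) → fromℕ (length xs) ≡ ∑ xs (λ _ → 1#)
    as-sum xs = sym (trans (∑-const 1# xs) (*-identityˡ _))

  0<#choices : ∀ g k → 0# < #choices (suc g) k
  0<#choices g zero    = subst (0# <_) (sym (+-identityʳ 1#)) 0<1
  0<#choices g (suc k) = subst (0# <_) (sym (#choices-suc (suc g) k))
    (*-positive (0<#choices g k) (<-≤-trans 0<1 (≤-by (0≤fromℕ g)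
        (solve 1 (λ a → a :- (con (+ 0)) := (con (+ 1)) :+ a :- (con (+ 1))) refl (fromℕ g)))))

  ∑-lookup : ∀ {g} (B : Vec ℕ g) (f : ℕ → ℝ) → ∑ (allFin g) (λ c → f (Vec.lookup B c)) ≡ ∑ (Vec.toList B) f
  ∑-lookup {g} B f = trans (cong sum (map-tabulate id (λ c → f (Vec.lookup B c)))) (expand B)
    where
    expand : ∀ {n} (B : Vec ℕ n) → sum (tabulate (λ c → f (Vec.lookup B c))) ≡ ∑ (Vec.toList B) f
    expand []      = refl
    expand (b ∷ B) = cong (_+_ (f b)) (expand B)

  flatten : ∀ {g k} → Vec (Vec ℕ g) k → List ℕ
  flatten []       = []
  flatten (B ∷ Bs) = Vec.toList B ++ flatten Bs

  select : ∀ {g k} → Vec (Fin g) k → Vec (Vec ℕ g) k → List ℕ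
  select []      []       = []
  select (c ∷ v) (B ∷ Bs) = Vec.lookup B c ∷ select v Bs

  isIn : List ℕ → ℕ → ℝ
  isIn S b = if does (b ∈? S) then 1# else 0#

  hits : List ℕ → List ℕ → ℝ
  hits S bs = ∑ bs (isIn S)

  occurrences : ℕ → List ℕ → ℝ
  occurrences x bs = ∑ bs (λ b → weightIn x b 1#)

  -- The number of distinct entries outside `S`, in a recursive form that follows the choices block
  -- by block and can be averaged over them.
  fresh : List ℕ → List ℕ → ℝ
  fresh S []       = 0#
  fresh S (b ∷ bs) = 1# - isIn S b + fresh (b ∷ S) bs

  isIn≤1 : ∀ S b → isIn S b ≤ 1#
  isIn≤1 S b with does (b ∈? S)
  ... | true  = ≤-refl
  ... | false = 0≤1

  0≤occurrences : ∀ x bs → 0# ≤ occurrences x bs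
  0≤occurrences x bs = ∑-nonNegative bs (λ {b} _ → 0≤weightIn x b 0≤1)

  hits-∷ : ∀ x S bs → hits (x ∷ S) bs ≤ hits S bs + (1# - isIn S x) * occurrences x bs
  hits-∷ x S bs = ≤-≡-trans (∑-mono bs (λ {b} _ → each b (b ∈? (x ∷ S)) (b ∈? S)))
    (trans (∑-+ _ _ bs) (cong (_+_ (hits S bs)) (∑-* (1# - isIn S x) _ bs)))
    where
    0≤new : ∀ b → 0# ≤ (1# - isIn S x) * weightIn x b 1#
    0≤new b = *-nonNegative (≤⇒0≤ (isIn≤1 S x)) (0≤weightIn x b 0≤1)
    each : ∀ b → Dec (b ∈ x ∷ S) → Dec (b ∈ S) → isIn (x ∷ S) b ≤ isIn S b + (1# - isIn S x) * weightIn x b 1#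
    each b _ (yes b∈S) = ≤-trans (isIn≤1 (x ∷ S) b) (≤-≡-trans (≤-by (0≤new b)
        (solve 1 (λ a → a :- (con (+ 0)) := (con (+ 1)) :+ a :- (con (+ 1))) refl y))
        (cong (_+ y) (sym (if-yes (b ∈? S) b∈S))))
      where y = (1# - isIn S x) * weightIn x b 1#
    each b (yes (there b∈S)) (no b∉S) = ⊥-elim (b∉S b∈S)
    each b (yes (here refl)) (no b∉S) = ≤-trans (isIn≤1 (x ∷ S) b) (≤-reflexive (begin
      1#                                      ≡⟨ (solve 0 (con (+ 1) := (con (+ 0)) :+ ((con (+ 1)) :- (con (+ 0)))
          :* (con (+ 1))) refl) ⟩
      0# + (1# - 0#) * 1#                     ≡⟨ cong₂ (λ i v → i + (1# - i) * v) (sym (if-no (b ∈? S) b∉S))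
          (sym (weightIn-same b 1#)) ⟩
      isIn S b + (1# - isIn S b) * weightIn b b 1# ∎))
      where open ≡-Reasoning
    each b (no b∉) (no b∉S) = ≡-≤-trans (if-no (b ∈? (x ∷ S)) b∉)
      (≤-≡-trans (≤-by (0≤new b) (solve 1 (λ a → a :- (con (+ 0)) := (con (+ 0)) :+ a :- (con (+ 0))) refl y))
          (cong (_+ y) (sym (if-no (b ∈? S) b∉S))))
      where y = (1# - isIn S x) * weightIn x b 1#

  -- Averaged over the choices, a block's choice is new unless it falls into one of
  -- the bins seen so far, and each new bin spoils at most g later choices.
  fresh-on-average : ∀ {g k} S (Bs : Vec (Vec ℕ g) k) → (∀ x → occurrences x (flatten Bs) ≤ fromℕ g) →
                     #choices g k * (fromℕ g * fromℕ k) ≤ fromℕ 2 *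
                         (fromℕ g * ∑ (choices g k) (λ v → fresh S (select v Bs))) + #choices g k * hits S
                         (flatten Bs)
  fresh-on-average {g} {zero} S [] few = ≤-reflexive (solve 1 (λ a → ((con (+ 1)) :+ (con (+ 0))) :*
      (a :* (con (+ 0))) := (num 2) :* (a :* ((con (+ 0)) :+ (con (+ 0)))) :+ ((con (+ 1)) :+ (con (+ 0))) :*
      (con (+ 0))) refl G)
    where G = fromℕ g
  fresh-on-average {g} {suc k} S (B ∷ Bs) few = subst₂ _≤_ (sym left) (sym right)
      (∑-mono (allFin g) (λ {c} _ → term c))
    where
    G = fromℕ g
    K = fromℕ k
    P = #choices g k
    rest = flatten Bs
    h = hits S rest
    i : Fin g → ℝ
    i c = isIn S (Vec.lookup B c)
    X : Fin g → ℝ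
    X c = ∑ (choices g k) (λ v → fresh (Vec.lookup B c ∷ S) (select v Bs))
    few-rest : ∀ x → occurrences x rest ≤ G
    few-rest x = ≤-trans (≤-≡-trans (≤-by (0≤occurrences x (Vec.toList B))
        (solve 2 (λ a b → a :- (con (+ 0)) := a :+ b :- b) refl v u)) (sym (∑-++ _ (Vec.toList B) rest))) (few x)
      where
      u = occurrences x rest
      v = occurrences x (Vec.toList B)
    term : ∀ c → P * (G * K) + P * G ≤ fromℕ 2 * (G * ((1# - i c) * P + X c)) + P * (h + G * i c)
    -- A new `b` contributes `2 g`: `g` for its own block and `g` for the at most `g` hits that it
    -- adds later. If `b` is not new, its own hit supplies the `g` of its block.
    term c = (≤-by (fresh-on-average (b ∷ S) Bs few-rest ⊕ *-monoʳ-≤ (0≤fromℕ (length (choices g k)))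
        (hits-∷ b S rest) ⊕ *-monoʳ-≤ (0≤fromℕ (length (choices g k))) (*-monoʳ-≤ (≤⇒0≤ (isIn≤1 S b)) (few-rest b)))
        (solve 8 (λ a b c d e f g h → (num 2) :* (a :* b) :+ c :* d :+ c :* (e :+ ((con (+ 1)) :- f) :* g) :+ c :*
        (((con (+ 1)) :- f) :* a) :- (c :* (a :* h) :+ c :* d :+ c :* (((con (+ 1)) :- f) :* g)) := (num 2) :*
        (a :* (((con (+ 1)) :- f) :* c :+ b)) :+ c :* (e :+ a :* f) :- (c :* (a :* h) :+ c :* a)) refl G Y P h′ h j n
        K))
      where
      b = Vec.lookup B c
      j = i c
      Y = X c
      h′ = hits (b ∷ S) rest
      n = occurrences b rest
    left : #choices g (suc k) * (G * fromℕ (suc k)) ≡ ∑ (allFin g) (λ _ → P * (G * K) + P * G)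
    left = trans (cong (_* (G * fromℕ (suc k))) (#choices-suc g k))
      (trans (solve 3 (λ a b c → a :* b :* (b :* ((con (+ 1)) :+ c)) := (a :* (b :* c) :+ a :* b) :* b) refl P G K)
          (sym (∑-allFin-const g _)))
    total : ∑ (choices g (suc k)) (λ v → fresh S (select v (B ∷ Bs))) ≡ ∑ (allFin g) (λ c → (1# - i c) * P + X c)
    total = trans (∑-choices-suc g k _) (∑-cong (allFin g) (λ {c} _ →
      trans (∑-+ (λ _ → 1# - i c) _ (choices g k)) (cong (_+ X c) (∑-const (1# - i c) (choices g k)))))
    blockHits : hits S (flatten (B ∷ Bs)) ≡ ∑ (allFin g) i + h
    blockHits = trans (∑-++ (isIn S) (Vec.toList B) rest) (cong (_+ h) (sym (∑-lookup B (isIn S))))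
    A = ∑ (allFin g) (λ c → (1# - i c) * P + X c)
    U = ∑ (allFin g) i
    right : fromℕ 2 * (G * ∑ (choices g (suc k)) (λ v → fresh S (select v (B ∷ Bs)))) + #choices g (suc k) * hits S
        (flatten (B ∷ Bs))
            ≡ ∑ (allFin g) (λ c → fromℕ 2 * (G * ((1# - i c) * P + X c)) + P * (h + G * i c))
    right = begin
      _ ≡⟨ cong₂ (λ a b → fromℕ 2 * (G * a) + b) total (cong₂ _*_ (#choices-suc g k) blockHits) ⟩
      fromℕ 2 * (G * A) + P * G * (U + h) ≡⟨ (solve 5 (λ a b c d e → (num 2) :* (a :* b) :+ c :* a :* (d :+ e) :=
          (num 2) :* (a :* b) :+ c :* (e :* a :+ a :* d)) refl G A P U h) ⟩
      fromℕ 2 * (G * A) + P * (h * G + G * U)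
        ≡⟨ cong₂ (λ a b → a + P * b)
             (sym (trans (∑-* (fromℕ 2) _ (allFin g)) (cong (fromℕ 2 *_) (∑-* G _ (allFin g)))))
             (sym (trans (∑-+ (λ _ → h) _ (allFin g)) (cong₂ _+_ (∑-allFin-const g h) (∑-* G i (allFin g))))) ⟩
      ∑ (allFin g) (λ c → fromℕ 2 * (G * ((1# - i c) * P + X c))) + P * ∑ (allFin g) (λ c → h + G * i c)
        ≡⟨ cong (_+_ _) (sym (∑-* P _ (allFin g))) ⟩
      ∑ (allFin g) (λ c → fromℕ 2 * (G * ((1# - i c) * P + X c))) + ∑ (allFin g) (λ c → P * (h + G * i c))
        ≡⟨ sym (∑-+ _ _ (allFin g)) ⟩
      _ ∎
      where open ≡-Reasoning

  firsts : List ℕ → List ℕ → List ℕ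
  firsts S []       = []
  firsts S (b ∷ bs) = if does (b ∈? S) then firsts (b ∷ S) bs else b ∷ firsts (b ∷ S) bs

  fresh≡length : ∀ S bs → fresh S bs ≡ fromℕ (length (firsts S bs))
  fresh≡length S []       = refl
  fresh≡length S (b ∷ bs) with does (b ∈? S)
  ... | true  = trans (cong (λ z → 1# - 1# + z) (fresh≡length (b ∷ S) bs))
      (solve 1 (λ a → (con (+ 1)) :- (con (+ 1)) :+ a := a) refl n)
    where n = fromℕ (length (firsts (b ∷ S) bs))
  ... | false = trans (cong (λ z → 1# - 0# + z) (fresh≡length (b ∷ S) bs))
      (solve 1 (λ a → (con (+ 1)) :- (con (+ 0)) :+ a := (con (+ 1)) :+ a) refl n)
    where n = fromℕ (length (firsts (b ∷ S) bs))

  firsts-∈ : ∀ S bs {x} → x ∈ firsts S bs → x ∈ bs × x ∉ S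
  firsts-∈ S (b ∷ bs) x∈ with b ∈? S
  firsts-∈ S (b ∷ bs) x∈          | yes _ = let x∈bs , x∉ = firsts-∈ (b ∷ S) bs x∈ in there x∈bs , x∉ ∘ there
  firsts-∈ S (b ∷ bs) (here refl) | no b∉ = here refl , b∉
  firsts-∈ S (b ∷ bs) (there x∈)  | no b∉ = let x∈bs , x∉ = firsts-∈ (b ∷ S) bs x∈ in there x∈bs , x∉ ∘ there

  firsts-unique : ∀ S bs → Unique (firsts S bs)
  firsts-unique S []       = []
  firsts-unique S (b ∷ bs) with does (b ∈? S)
  ... | true  = firsts-unique (b ∷ S) bs
  ... | false = All.tabulate (λ x∈ b≡x → proj₂ (firsts-∈ (b ∷ S) bs x∈) (here (sym b≡x))) ∷ firsts-unique (b ∷ S) bs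

  fresh≤length : ∀ bs {ys} → (∀ {b} → b ∈ bs → b ∈ ys) → fresh [] bs ≤ fromℕ (length ys)
  fresh≤length bs bs⊆ys = ≡-≤-trans (fresh≡length [] bs)
    (fromℕ-mono-≤ (Unique-⊆-length (firsts-unique [] bs) (bs⊆ys ∘ proj₁ ∘ firsts-∈ [] bs)))

  split-off : ∀ g (xs : List ℕ) → g ℕ.≤ length xs → ∃₂ λ (B : Vec ℕ g) ys → xs ≡ Vec.toList B ++ ys
  split-off zero    xs       _         = [] , xs , refl
  split-off (suc g) (x ∷ xs) (s≤s g≤) with split-off g xs g≤
  ... | B , ys , eq = (x ∷ B) , ys , cong (x ∷_) eq

  into-blocks : ∀ g k (xs : List ℕ) → length xs ≡ k ℕ.* g → ∃ λ (Bs : Vec (Vec ℕ g) k) → flatten Bs ≡ xs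
  into-blocks g zero    []  _  = [] , refl
  into-blocks g (suc k) xs  eq with split-off g xs (subst (g ℕ.≤_) (sym eq) (ℕ.m≤m+n g (k ℕ.* g)))
  ... | B , ys , refl with into-blocks g k ys (ℕ.+-cancelˡ-≡ g _ _
      (trans (trans (cong (ℕ._+ length ys) (sym (Vec.length-toList B))) (sym (length-++ (Vec.toList B)))) eq))
  ...   | Bs , refl = (B ∷ Bs) , refl

  -- The arrival phase

  -- A resident without its leaving time, which is all that runs on instances with different
  -- durations have in common.
  Shape : Set
  Shape = ℕ × ℝ × ℕ

  shape : Resident → Shape
  shape r = name r , weight r , bin r

  -- The assignment of items to bins once all items have been placed.
  settle : ∀ {C σ st} → Run C σ st → List Shape
  settle {st = state _ rs nothing [] _ _}       _        = map shape rs
  settle {st = state _ _  (just _) _ _ _}       (stop _) = []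
  settle {st = state _ _  (just _) _ _ _}       (_ ▸ r)  = settle r
  settle {st = state _ _  nothing (_ ∷ _) _ _}  (stop _) = []
  settle {st = state _ _  nothing (_ ∷ _) _ _}  (_ ▸ r)  = settle r

  reshape : ℕ → ℕ → Shape → Shape
  reshape i b (n , w , b′) = n , w , (if does (n ℕ.≟ i) then b else b′)

  shape-reassign : ∀ C i b rs → map shape (map (reassign C i b) rs) ≡ map (reshape i b) (map shape rs)
  shape-reassign C i b []       = refl
  shape-reassign C i b (r ∷ rs) = cong₂ _∷_ head≡ (shape-reassign C i b rs)
    where
    head≡ : shape (reassign C i b r) ≡ reshape i b (shape r)
    head≡ with does (name r ℕ.≟ i)
    ... | true  = refl
    ... | false = refl

  -- `top` makes the longest duration exactly `μ`, also when `m` is smaller; `brief` attains the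
  -- shortest duration 1; `mid` is the lasting item of a block.
  data Kind : Set where
    brief mid top : Kind

  module Gadget {w m μ : ℝ} (0≤w : 0# ≤ w) (w≤1 : w ≤ 1#) (1≤m : 1# ≤ m) (m≤μ : m ≤ μ) where

    stay : Kind → ℝ
    stay brief = 1#
    stay mid   = m
    stay top   = μ

    1≤stay : ∀ κ → 1# ≤ stay κ
    1≤stay brief = ≤-refl
    1≤stay mid   = 1≤m
    1≤stay top   = ≤-trans 1≤m m≤μ

    stay≤μ : ∀ κ → stay κ ≤ μ
    stay≤μ brief = ≤-trans 1≤m m≤μ
    stay≤μ mid   = m≤μ
    stay≤μ top   = ≤-refl

    item : Kind → Item
    item κ = record
      { arrival = 0# ; size = w ; duration = stay κ
      ; 0≤arrival = ≤-refl ; 0≤size = 0≤w ; size≤1 = w≤1 ; 0<duration = <-≤-trans 0<1 (1≤stay κ) }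

    -- Only a lower bound on the leaving time, because an item may already be migrated at time 0.
    Aligned : List Resident → List Kind → Set
    Aligned = Pointwise (λ r κ → stay κ ≤ leaves r)

    Aligned⇒1≤ : ∀ {rs ks} → Aligned rs ks → ∀ {r} → r ∈ rs → 1# ≤ leaves r
    Aligned⇒1≤ (_∷_ {y = κ} κ≤r _) (here refl) = ≤-trans (1≤stay κ) κ≤r
    Aligned⇒1≤ (_ ∷ al)            (there r∈)  = Aligned⇒1≤ al r∈

    record Board (n : ℕ) (rs : List Resident) (done : List Kind) : Set where
      constructor board
      field
        tidy    : Tidy w rs
        below   : All (λ r → name r ℕ.< n) rs
        aligned : Aligned rs done

    board-place : ∀ {n rs done} κ b → Board n rs done → Fits w b rs →
                  Board (suc n) (resident n w b (departure (item κ)) ∷ rs) (κ ∷ done)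
    board-place {n} {rs} κ b (board tidy below aligned) fits = board
      (record { weights = refl ∷ weights tidy ; loads = loads′ ; distinct = All.map (λ r<n → ℕ.<⇒≢ r<n ∘ sym) below ∷
          distinct tidy })
      (ℕ.n<1+n n ∷ All.map ℕ.m<n⇒m<1+n below)
      (≤-reflexive (sym (+-identityˡ _)) ∷ aligned)
      where
      loads′ : ∀ c → weightIn c b w + guestLoad c rs ≤ 1#
      loads′ c with b ℕ.≟ c
      ... | yes refl = ≡-≤-trans (trans (cong (_+ guestLoad c rs) (weightIn-same c w)) (+-comm _ _))
                         (≡-≤-trans (cong (_+ w) (sym (load≡guestLoad c rs))) fits)
      ... | no b≢c   = ≡-≤-trans (trans (cong (_+ guestLoad c rs) (weightIn-other w b≢c)) (+-identityˡ _))
          (loads tidy c)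

    aligned-reassign : ∀ {C} i b {rs done} → 0# ≤ C → Aligned rs done → Aligned (map (reassign C i b) rs) done
    aligned-reassign i b 0≤C []                  = []
    aligned-reassign i b 0≤C (_∷_ {x = r} κ≤r al) = ≤-trans κ≤r (reassign-leaves i b r 0≤C) ∷ aligned-reassign i b
        0≤C al

    board-reassign : ∀ {C i b n rs done r} → 0# ≤ C → Board n rs done → r ∈ rs → name r ≡ i → Fits (weight r) b rs →
                     Board n (map (reassign C i b) rs) done
    board-reassign {C} {i} {b} {n} 0≤C (board tidy below aligned) r∈ name≡ fits = board
      (tidy-reassign 0≤w tidy r∈ name≡ fits)
      (All.map⁺ (All.map (λ {r} → subst (ℕ._< n) (sym (reassign-name C i b r))) below))
      (aligned-reassign i b 0≤C aligned)

    module Opening {C : ℝ} (0≤C : 0# ≤ C) (σ : Strategy) where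

      -- The run from the moment at which all items have been placed. The clock still shows 0, so
      -- the arrival phase has cost nothing and `cost≡` equates the whole cost with that of the
      -- rest.
      record Settled (S : List Shape) (ks : List Kind) (cost : ℝ) : Set where
        constructor settled
        field
          {rs}    : List Resident
          {n}     : ℕ
          {h}     : List Observation
          rest    : Run C σ (state 0# rs nothing [] n h)
          cost≡   : cost ≡ runCost rest
          shapes  : map shape rs ≡ S
          tidy    : Tidy w rs
          aligned : Aligned rs ks

      carry : ∀ {S ks c} o → Settled S ks c → Settled S ks ((0# - 0#) * o + c)
      carry {c = c} o (settled rest cost≡ shapes tidy aligned) =
        settled rest (trans (solve 2 (λ a b → ((con (+ 0)) :- (con (+ 0))) :* a :+ b := b) refl o c) cost≡) shapes
            tidy aligned

      -- Residents leave at time 1 or later and legal alarms lie strictly after 0, so that waiting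
      -- leads to the next arrival, whatever the alarm.
      wait-arrival : ∀ {alarm n rs done κ ks h st′} → Board n rs done →
                     waitFor alarm (state 0# rs nothing (item κ ∷ map item ks) n h) ≡ next st′ →
                     st′ ≡ state 0# rs (just (item κ)) (map item ks) n (arrived 0# w ∷ h)
      wait-arrival {alarm} {n} {rs} {done} {κ} {ks} {h} bd eq with waitFor-upcoming alarm
          (state 0# rs nothing (item κ ∷ map item ks) n h)
      ... | inj₂ (illegal≡ , _) = case trans (sym illegal≡) eq of λ ()
      ... | inj₁ (s , up , occurs) with isCandidate up | trans (sym occurs) eq
      ...   | departs r∈ | _ = ⊥-elim (<⇒≱ 0<1 (≤-trans (Aligned⇒1≤ (Board.aligned bd) r∈)
          (isFirst up (arrives refl))))
      ...   | arrives refl | refl = refl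
      ...   | alarms {t} _ | eq′ = ⊥-elim (<⇒≱ (proj₁ (alarm-inv {t} {state 0# rs nothing (item κ ∷ map item ks) n h}
          eq′)) (isFirst up (arrives refl)))

      shapes-reassign : ∀ {i b rs₁ rs₂} → map shape rs₁ ≡ map shape rs₂ → map shape (map (reassign C i b) rs₁) ≡ map
          shape (map (reassign C i b) rs₂)
      shapes-reassign {i} {b} {rs₁} {rs₂} eq = trans (shape-reassign C i b rs₁)
          (trans (cong (map (reshape i b)) eq) (sym (shape-reassign C i b rs₂)))

      awaiting pended : List Resident → Kind → List Kind → ℕ → List Observation → State
      awaiting rs κ ks n h = state 0# rs nothing (item κ ∷ map item ks) n h
      pended   rs κ ks n h = state 0# rs (just (item κ)) (map item ks) n h

      awaiting-step : ∀ rs κ ks n h → step C σ (awaiting rs κ ks n h) ≡ perform C (σ h) (awaiting rs κ ks n h)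
      awaiting-step rs κ ks n h = step-busy (awaiting rs κ ks n h) λ { (_ , _ , ()) }

      pended-step : ∀ rs κ ks n h → step C σ (pended rs κ ks n h) ≡ perform C (σ h) (pended rs κ ks n h)
      pended-step rs κ ks n h = step-busy (pended rs κ ks n h) λ { (_ , () , _) }

      -- While items are still arriving, at time 0, nothing the strategy observes or
      -- is allowed to do depends on the durations.
      mutual
        lockstep : ∀ {n h rs₁ rs₂ done₁ done₂} ks₁ ks₂ (r₁ : Run C σ (state 0# rs₁ nothing (map item ks₁) n h))
            (r₂ : Run C σ (state 0# rs₂ nothing (map item ks₂) n h)) →
                   Board n rs₁ done₁ → Board n rs₂ done₂ → map shape rs₁ ≡ map shape rs₂ → length ks₁ ≡ length ks₂ →
                   Settled (settle r₁) (ks₂ ʳ++ done₂) (runCost r₂)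
        lockstep [] [] r₁ r₂ bd₁ bd₂ shapes _ = settled r₂ refl (sym shapes) (Board.tidy bd₂) (Board.aligned bd₂)
        lockstep {n} {h} {rs₁} (κ ∷ ks) _ (stop e) _ _ _ _ _ =
          ⊥-elim (perform≢finished (σ h) (awaiting rs₁ κ ks n h) (trans (sym (awaiting-step rs₁ κ ks n h)) e))
        lockstep {n} {h} {_} {rs₂} (_ ∷ _) (κ ∷ ks) (_ ▸ _) (stop e) _ _ _ _ =
          ⊥-elim (perform≢finished (σ h) (awaiting rs₂ κ ks n h) (trans (sym (awaiting-step rs₂ κ ks n h)) e))
        lockstep {n} {h} {rs₁} {rs₂} (κ₁ ∷ ks₁) (κ₂ ∷ ks₂) (e₁ ▸ r₁) (e₂ ▸ r₂) bd₁ bd₂ shapes lengths =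
          idle-step {κ₁ = κ₁} {κ₂} {ks₁} {ks₂} (σ h) (trans (sym (awaiting-step rs₁ κ₁ ks₁ n h)) e₁)
              (trans (sym (awaiting-step rs₂ κ₂ ks₂ n h)) e₂) r₁ r₂ bd₁ bd₂ shapes (ℕ.suc-injective lengths)

        idle-step : ∀ {n h rs₁ rs₂ done₁ done₂ κ₁ κ₂ ks₁ ks₂ st₁ st₂} a →
                    perform C a (awaiting rs₁ κ₁ ks₁ n h) ≡ next st₁ → perform C a (awaiting rs₂ κ₂ ks₂ n h) ≡ next
                        st₂ →
                    (r₁ : Run C σ st₁) (r₂ : Run C σ st₂) → Board n rs₁ done₁ → Board n rs₂ done₂ → map shape rs₁ ≡
                        map shape rs₂ → length ks₁ ≡ length ks₂ →
                    Settled (settle r₁) (ks₂ ʳ++ κ₂ ∷ done₂) ((now st₂ - 0#) * fromℕ (length (dedup (map bin rs₂))) +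
                        runCost r₂)
        idle-step {n} {h} {rs₁} {rs₂} {κ₁ = κ₁} {κ₂} {ks₁} {ks₂} (migrate i b) e₁ e₂ r₁ r₂ bd₁ bd₂ shapes lengths
          with migrateTo-inv {C} {i} {b} {awaiting rs₁ κ₁ ks₁ n h} e₁ | migrateTo-inv {C} {i} {b}
              {awaiting rs₂ κ₂ ks₂ n h} e₂
        ... | _ , r∈₁ , name≡₁ , fits₁ , refl | _ , r∈₂ , name≡₂ , fits₂ , refl =
          carry _ (lockstep (κ₁ ∷ ks₁) (κ₂ ∷ ks₂) r₁ r₂ (board-reassign 0≤C bd₁ r∈₁ name≡₁ fits₁)
              (board-reassign 0≤C bd₂ r∈₂ name≡₂ fits₂) (shapes-reassign shapes) (cong suc lengths))
        idle-step {κ₁ = κ₁} {κ₂} {ks₁} {ks₂} (wait alarm) e₁ e₂ r₁ r₂ bd₁ bd₂ shapes lengths with wait-arrival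
            {κ = κ₁} {ks₁} bd₁ e₁ | wait-arrival {κ = κ₂} {ks₂} bd₂ e₂
        ... | refl | refl = carry _ (lockstep-pending κ₁ κ₂ ks₁ ks₂ r₁ r₂ bd₁ bd₂ shapes lengths)

        lockstep-pending : ∀ {n h rs₁ rs₂ done₁ done₂} κ₁ κ₂ ks₁ ks₂ (r₁ : Run C σ (pended rs₁ κ₁ ks₁ n h))
            (r₂ : Run C σ (pended rs₂ κ₂ ks₂ n h)) →
                           Board n rs₁ done₁ → Board n rs₂ done₂ → map shape rs₁ ≡ map shape rs₂ → length ks₁ ≡
                               length ks₂ →
                           Settled (settle r₁) (ks₂ ʳ++ κ₂ ∷ done₂) (runCost r₂)
        lockstep-pending {n} {h} {rs₁} κ _ ks _ (stop e) _ _ _ _ _ =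
          ⊥-elim (perform≢finished (σ h) (pended rs₁ κ ks n h) (trans (sym (pended-step rs₁ κ ks n h)) e))
        lockstep-pending {n} {h} {_} {rs₂} _ κ _ ks (_ ▸ _) (stop e) _ _ _ _ =
          ⊥-elim (perform≢finished (σ h) (pended rs₂ κ ks n h) (trans (sym (pended-step rs₂ κ ks n h)) e))
        lockstep-pending {n} {h} {rs₁} {rs₂} κ₁ κ₂ ks₁ ks₂ (e₁ ▸ r₁) (e₂ ▸ r₂) bd₁ bd₂ shapes lengths =
          pending-step {κ₁ = κ₁} {κ₂} {ks₁} {ks₂} (σ h) (trans (sym (pended-step rs₁ κ₁ ks₁ n h)) e₁)
              (trans (sym (pended-step rs₂ κ₂ ks₂ n h)) e₂) r₁ r₂ bd₁ bd₂ shapes lengths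

        pending-step : ∀ {n h rs₁ rs₂ done₁ done₂ κ₁ κ₂ ks₁ ks₂ st₁ st₂} a →
                       perform C a (pended rs₁ κ₁ ks₁ n h) ≡ next st₁ → perform C a (pended rs₂ κ₂ ks₂ n h) ≡ next
                           st₂ →
                       (r₁ : Run C σ st₁) (r₂ : Run C σ st₂) → Board n rs₁ done₁ → Board n rs₂ done₂ → map shape rs₁
                           ≡ map shape rs₂ → length ks₁ ≡ length ks₂ →
                       Settled (settle r₁) (ks₂ ʳ++ κ₂ ∷ done₂) ((now st₂ - 0#) * fromℕ
                           (length (dedup (map bin rs₂))) + runCost r₂)
        pending-step {n} {h} {rs₁} {rs₂} {κ₁ = κ₁} {κ₂} {ks₁} {ks₂} (migrate i b) e₁ e₂ r₁ r₂ bd₁ bd₂ shapes lengths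
          with migrateTo-inv {C} {i} {b} {pended rs₁ κ₁ ks₁ n h} e₁ | migrateTo-inv {C} {i} {b}
              {pended rs₂ κ₂ ks₂ n h} e₂
        ... | _ , r∈₁ , name≡₁ , fits₁ , refl | _ , r∈₂ , name≡₂ , fits₂ , refl =
          carry _ (lockstep-pending κ₁ κ₂ ks₁ ks₂ r₁ r₂ (board-reassign 0≤C bd₁ r∈₁ name≡₁ fits₁)
              (board-reassign 0≤C bd₂ r∈₂ name≡₂ fits₂) (shapes-reassign shapes) lengths)
        pending-step {n} {h} {rs₁} {rs₂} {κ₁ = κ₁} {κ₂} {ks₁} {ks₂} (place b) e₁ e₂ r₁ r₂ bd₁ bd₂ shapes lengths
          with placeIn-inv {b} {item κ₁} {pended rs₁ κ₁ ks₁ n h} e₁ | placeIn-inv {b} {item κ₂}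
              {pended rs₂ κ₂ ks₂ n h} e₂
        ... | fits₁ , refl | fits₂ , refl =
          carry _ (lockstep ks₁ ks₂ r₁ r₂ (board-place κ₁ b bd₁ fits₁) (board-place κ₂ b bd₂ fits₂)
              (cong ((n , w , b) ∷_) shapes) lengths)

  -- The lower bound

  ∑-reverse : {A : Set} (f : A → ℝ) (xs : List A) → ∑ (reverse xs) f ≡ ∑ xs f
  ∑-reverse f []       = refl
  ∑-reverse f (x ∷ xs) = begin
    ∑ (reverse (x ∷ xs)) f      ≡⟨ cong (λ ys → ∑ ys f) (unfold-reverse x xs) ⟩
    ∑ (reverse xs ++ x ∷ []) f  ≡⟨ ∑-++ f (reverse xs) (x ∷ []) ⟩
    ∑ (reverse xs) f + (f x + 0#) ≡⟨ cong₂ _+_ (∑-reverse f xs) (+-identityʳ (f x)) ⟩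
    ∑ xs f + f x                ≡⟨ +-comm _ _ ⟩
    f x + ∑ xs f                ∎
    where open ≡-Reasoning

  block : ∀ {n} → Fin n → List Kind
  block {suc n} zero    = mid ∷ replicate n brief
  block {suc n} (suc c) = brief ∷ block c

  blocks : ∀ {g k} → Vec (Fin g) k → List Kind
  blocks []      = []
  blocks (c ∷ v) = block c ++ blocks v

  kinds : ∀ {g k} → Vec (Fin g) k → List Kind
  kinds v = top ∷ blocks v

  length-block : ∀ {n} (c : Fin n) → length (block c) ≡ n
  length-block {suc n} zero    = cong suc (length-replicate n)
  length-block {suc n} (suc c) = cong suc (length-block c)

  length-blocks : ∀ {g k} (v : Vec (Fin g) k) → length (blocks v) ≡ k ℕ.* g
  length-blocks []      = refl
  length-blocks (c ∷ v) = trans (length-++ (block c)) (cong₂ ℕ._+_ (length-block c) (length-blocks v))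

  module Family {w m μ : ℝ} (0≤w : 0# ≤ w) (w≤1 : w ≤ 1#) (1≤m : 1# ≤ m) (m≤μ : m ≤ μ)
                (g′ k′ : ℕ) (gw≡1 : fromℕ (suc (suc g′)) * w ≡ 1#) where
    open Gadget 0≤w w≤1 1≤m m≤μ

    g k : ℕ
    g = suc (suc g′)
    k = suc k′

    items-in-order : ∀ ks → Linked (λ x y → arrival x ≤ arrival y) (map item ks)
    items-in-order []            = []
    items-in-order (_ ∷ [])      = [-]
    items-in-order (_ ∷ κ ∷ ks)  = ≤-refl ∷ items-in-order (κ ∷ ks)

    -- The items arrive in reverse order because residents are prepended: after the last placement
    -- the list of residents is aligned with `kinds v`.
    instanceOf : Vec (Fin g) k → Instance
    instanceOf v = record { items = map item (reverse (kinds v)) ; sorted = items-in-order (reverse (kinds v)) }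

    item∈ : ∀ {v κ} → κ ∈ kinds v → item κ ∈ items (instanceOf v)
    item∈ κ∈ = ∈-map⁺ item (reverse⁺ κ∈)

    brief∈block : (c : Fin g) → brief ∈ block c
    brief∈block zero    = there (here refl)
    brief∈block (suc c) = here refl

    in-class : ∀ v → MinDurationOneWithRatio μ (instanceOf v)
    in-class v@(c ∷ _) = isShortest , 1# , μ , isShortest , isLongest , sym (*-identityʳ μ)
      where
      isShortest : ShortestDuration (instanceOf v) 1#
      isShortest = All.map⁺ (All.universal 1≤stay _) , Any.map (λ { refl → refl })
          (item∈ {v} (there (∈-++⁺ˡ (brief∈block c))))
      isLongest : LongestDuration (instanceOf v) μ
      isLongest = All.map⁺ (All.universal stay≤μ _) , Any.map (λ { refl → refl }) (item∈ {v} (here refl))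

    ∑-block : ∀ {n} (c : Fin n) → ∑ (block c) stay ≤ m + fromℕ n
    ∑-block {suc n} zero = ≤-trans (≤-refl ⊕ ≤-reflexive (all-brief n))
        (≤-by (0≤1) (solve 2 (λ a b → (con (+ 1)) :- (con (+ 0)) := a :+ ((con (+ 1)) :+ b) :- (a :+ b)) refl m
        (fromℕ n)))
      where
      all-brief : ∀ n → ∑ (replicate n brief) stay ≡ fromℕ n
      all-brief zero    = refl
      all-brief (suc n) = cong (_+_ 1#) (all-brief n)
    ∑-block {suc n} (suc c) = (≤-by (∑-block c) (solve 3 (λ a b c → a :+ b :- c := a :+ ((con (+ 1)) :+ b) :-
        ((con (+ 1)) :+ c)) refl m (fromℕ n) (∑ (block c) stay)))

    ∑-blocks : ∀ {n} (v : Vec (Fin g) n) → ∑ (blocks v) stay ≤ fromℕ n * (m + fromℕ g)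
    ∑-blocks []              = ≤-reflexive (sym (zeroˡ _))
    ∑-blocks {suc n} (c ∷ v) = ≡-≤-trans (∑-++ stay (block c) (blocks v))
      (≤-by (∑-block c ⊕ ∑-blocks v) (solve 5 (λ a b c d e → a :+ b :+ c :* (a :+ b) :- (d :+ e) :=
          ((con (+ 1)) :+ c) :* (a :+ b) :- (d :+ e)) refl m G (fromℕ n) a b))
      where
      G = fromℕ g
      a = ∑ (block c) stay
      b = ∑ (blocks v) stay

    module Offline (v : Vec (Fin g) k) where
      I = instanceOf v
      xs = items I

      -- For `n` items of size `w = 1 / g`, `1 + w n` bins are enough. The bar of height 1 pays for
      -- rounding `w n` up, and it is needed up to time `μ`.
      bars : List Bar
      bars = bar 1# 0# μ ∷ map (itemBar (λ _ → w)) xs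

      bars-wellPlaced : All (WellPlaced I) bars
      bars-wellPlaced = (≤-trans 0≤1 (≤-trans 1≤m m≤μ) , arrival-breakpoint I (item∈ {v} (here refl)) ,
        subst (_∈ breakpoints I) (+-identityˡ μ) (departure-breakpoint I (item∈ {v} (here refl))))
        ∷ All.map⁺ (All.tabulate (itemBar-wellPlaced I (λ _ → w)))

      bars-above : ∀ t → fromℕ (optAt I t) ≤ heightAt bars t
      bars-above t = ≤-≡-trans (by-cases (present t xs) refl)
        (cong (λ z → 1# * indicator 0# μ t + z) (sym (trans (heightAt-items (λ _ → w) t xs)
            (∑-const w (present t xs)))))
        where
        by-cases : ∀ ps → present t xs ≡ ps → fromℕ (optAt I t) ≤ 1# * indicator 0# μ t + w * fromℕ
            (length (present t xs))
        by-cases [] eq = ≡-≤-trans (cong (λ ps → fromℕ (minBins (map size ps))) eq)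
          (≡-≤-trans (sym (+-identityˡ 0#)) (*-nonNegative 0≤1 0≤indicator ⊕ *-nonNegative 0≤w
              (0≤fromℕ (length (present t xs)))))
          where
          0≤indicator : 0# ≤ indicator 0# μ t
          0≤indicator with does (0# ≤? t) | does (t <? μ)
          ... | true  | true  = 0≤1
          ... | true  | false = ≤-refl
          ... | false | _     = ≤-refl
        by-cases (x ∷ _) eq = ≤-trans (fromℕ-mono-≤ (minBins-minimal (sizesAt I t) packed))
          (≤-≡-trans (≤-by (j≤wn) (solve 3 (λ a b c → a :* b :- c := (con (+ 1)) :* (con (+ 1)) :+ a :* b :-
              ((con (+ 1)) :+ c)) refl w (fromℕ n) (fromℕ j)))
            (cong (λ i → 1# * i + w * fromℕ n) (sym (indicator-in 0≤t t<μ))))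
          where
          n = length (present t xs)
          j = n ℕ./ g
          x∈ : x ∈ present t xs
          x∈ = subst (x ∈_) (sym eq) (here refl)
          x∈′ = ∈-filter⁻ (λ x → t <? departure x) {xs = filter (λ x → arrival x ≤? t) xs} x∈
          x∈″ = ∈-filter⁻ (λ x → arrival x ≤? t) {xs = xs} (proj₁ x∈′)
          0≤t : 0# ≤ t
          0≤t = ≤-trans (0≤arrival x) (proj₂ x∈″)
          t<μ : t < μ
          t<μ with ∈-map⁻ item (proj₁ x∈″)
          ... | κ , _ , refl = <-≤-trans (proj₂ x∈′) (≡-≤-trans (+-identityˡ _) (stay≤μ κ))
          sizes : All (_≡ w) (sizesAt I t)
          sizes = All.map⁺ (All.filter⁺ (λ x → t <? departure x) (All.filter⁺ (λ x → arrival x ≤? t)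
              (All.map⁺ (All.universal (λ _ → refl) (reverse (kinds v))))))
          n≤ : n ℕ.≤ suc j ℕ.* g
          n≤ = subst (ℕ._≤ suc j ℕ.* g) (sym (ℕ.m≡m%n+[m/n]*n n g)) (ℕ.+-monoˡ-≤ (j ℕ.* g) (ℕ.<⇒≤ (ℕ.m%n<n n g)))
          packed : Packable (suc j) (sizesAt I t)
          packed = Packable-equal 0≤w (suc g′) j (sizesAt I t) sizes (≤-reflexive gw≡1)
            (subst (ℕ._≤ suc j ℕ.* g) (sym (length-map size (present t xs))) n≤)
          j≤wn : fromℕ j ≤ w * fromℕ n
          j≤wn = ≡-≤-trans (trans (sym (*-identityˡ _)) (trans (cong (_* fromℕ j) (sym gw≡1))
              (solve 3 (λ a b c → a :* b :* c := b :* (c :* a)) refl G w (fromℕ j))))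
            (*-monoʳ-≤ 0≤w (≡-≤-trans (sym (fromℕ-* j g)) (fromℕ-mono-≤ (ℕ.m/n*n≤m n g))))
            where G = fromℕ g

      -- The rounding bar costs `μ`, the `top` item at most `μ`, and the blocks `w k (m + g) ≤ 2 k`
      -- because `m ≤ g` and `w g = 1`; finally `μ ≤ k`.
      OPT-small : m ≤ fromℕ g → μ ≤ fromℕ k → OPT I ≤ fromℕ 4 * fromℕ k
      OPT-small m≤g μ≤k = ≤-trans (OPT≤area I bars bars-wellPlaced bars-above) (≡-≤-trans
        (cong (_+_ _) (trans (area-items (λ _ → w) xs) (trans (∑-map (λ x → w * duration x) item (reverse (kinds v)))
          (trans (∑-reverse (λ κ → w * stay κ) (kinds v)) (∑-* w stay (kinds v))))))
        (≤-by (*-monoʳ-≤ 0≤w (∑-blocks v) ⊕ *-nonNegative (*-nonNegative 0≤w (0≤fromℕ k)) (≤⇒0≤ m≤g) ⊕ *-nonNegative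
            (≤⇒0≤ w≤1) (≤-trans 0≤1 (≤-trans 1≤m m≤μ)) ⊕ ≤-reflexive (cong (λ z → fromℕ 2 * (K * z)) gw≡1) ⊕
            *-monoʳ-≤ (0≤fromℕ 2) μ≤k) (solve 6 (λ a b c d e f → a :* (b :* (c :+ d)) :+ a :* b :* (d :- c) :+
            ((con (+ 1)) :- a) :* e :+ (num 2) :* (b :* (con (+ 1))) :+ (num 2) :* b :-
            (a :* f :+ (con (+ 0)) :+ (con (+ 0)) :+ (num 2) :* (b :* (d :* a)) :+ (num 2) :* e) := (num 4) :* b :-
            ((con (+ 1)) :* (e :- (con (+ 0))) :+ a :* (e :+ f))) refl w K m G μ s)))
        where
        G = fromℕ g
        K = fromℕ k
        s = ∑ (blocks v) stay

    Residue : List Resident → List ℕ → List Kind → Set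
    Residue rs xs ks = ∃ λ rs′ → (∀ {r} → r ∈ rs′ → r ∈ rs) × map bin rs′ ≡ xs × Aligned rs′ ks

    widen : ∀ {r rs xs ks} → Residue rs xs ks → Residue (r ∷ rs) xs ks
    widen (rs′ , rs′⊆ , bins≡ , al) = rs′ , there ∘ rs′⊆ , bins≡ , al

    skip-briefs : ∀ {n} (B : Vec ℕ n) {xs ks rs} → map bin rs ≡ Vec.toList B ++ xs → Aligned rs
        (replicate n brief ++ ks) → Residue rs xs ks
    skip-briefs []      {rs = rs} eq al       = rs , id , eq , al
    skip-briefs (b ∷ B)           eq (_ ∷ al) = widen (skip-briefs B (∷-injectiveʳ eq) al)

    pick : ∀ {n} (c : Fin n) (B : Vec ℕ n) {xs ks rs} → map bin rs ≡ Vec.toList B ++ xs → Aligned rs (block c ++ ks) →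
           (∃ λ r → r ∈ rs × bin r ≡ Vec.lookup B c × m ≤ leaves r) × Residue rs xs ks
    pick zero    (b ∷ B) eq (m≤r ∷ al) = (_ , here refl , ∷-injectiveˡ eq , m≤r) , widen
        (skip-briefs B (∷-injectiveʳ eq) al)
    pick (suc c) (b ∷ B) eq (_ ∷ al) with pick c B (∷-injectiveʳ eq) al
    ... | (r , r∈ , bin≡ , m≤r) , residue = (r , there r∈ , bin≡ , m≤r) , widen residue

    long-resident : ∀ {n} (v : Vec (Fin g) n) Bs {rs} → map bin rs ≡ flatten Bs → Aligned rs (blocks v) → ∀ {b} → b ∈
        select v Bs →
                    ∃ λ r → r ∈ rs × bin r ≡ b × m ≤ leaves r
    long-resident []      []       eq al ()
    long-resident (c ∷ v) (B ∷ Bs) eq al b∈ with pick c B eq al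
    long-resident (c ∷ v) (B ∷ Bs) eq al (here refl) | found , _ = found
    long-resident (c ∷ v) (B ∷ Bs) eq al (there b∈)  | _ , (rs′ , rs′⊆ , eq′ , al′) with long-resident v Bs eq′ al′ b∈
    ... | r , r∈ , bin≡ , m≤r = r , rs′⊆ r∈ , bin≡ , m≤r

    few-per-bin : ∀ {rs} → Tidy w rs → ∀ x → occurrences x (map bin rs) ≤ fromℕ g
    few-per-bin {rs} tidy x = ≡-≤-trans
      (trans (∑-map _ bin rs) (trans (∑-cong rs (λ {r} r∈ → scale r (All.lookup (weights tidy) r∈)))
          (∑-* (fromℕ g) _ rs)))
      (≤-≡-trans (*-monoʳ-≤ (0≤fromℕ g) (loads tidy x)) (*-identityʳ _))
      where
      scale : ∀ r → weight r ≡ w → weightIn x (bin r) 1# ≡ fromℕ g * weightIn x (bin r) (weight r)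
      scale r weight≡ with does (bin r ℕ.≟ x)
      ... | true  = sym (trans (cong (fromℕ g *_) weight≡) gw≡1)
      ... | false = sym (zeroʳ _)

    hits-[] : ∀ bs → hits [] bs ≡ 0#
    hits-[] bs = trans (∑-const 0# bs) (zeroˡ _)

    module Online {C : ℝ} (1≤C : 1# ≤ C) (m≤2wC : m ≤ fromℕ 2 * (w * C))
        (A : OnlineAlgorithm C (MinDurationOneWithRatio μ)) where
      σ = strategy A
      open Opening (≤-trans 0≤1 1≤C) σ
      open Accounting 1≤C 0≤w (≤-trans 0≤1 1≤m) m≤2wC hiding (0≤C)

      costOf : Vec (Fin g) k → ℝ
      costOf v = cost A (instanceOf v) (in-class v)

      -- An arbitrary reference choice: its assignment of items to bins is that of all choices.
      v₀ : Vec (Fin g) k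
      v₀ = Vec.replicate k zero

      S₀ : List Shape
      S₀ = settle (run A (instanceOf v₀) (in-class v₀))

      length-kinds : ∀ (v : Vec (Fin g) k) → length (reverse (kinds v)) ≡ suc (k ℕ.* g)
      length-kinds v = trans (length-reverse (kinds v)) (cong suc (length-blocks v))

      start-board : Board 0 [] []
      start-board = board (record { weights = [] ; loads = λ _ → 0≤1 ; distinct = [] }) [] []

      outcome : ∀ v → Settled S₀ (kinds v) (costOf v)
      outcome v = subst (λ ks → Settled S₀ ks (costOf v)) (reverse-involutive (kinds v))
        (lockstep (reverse (kinds v₀)) (reverse (kinds v)) (run A (instanceOf v₀) (in-class v₀))
            (run A (instanceOf v) (in-class v))
          start-board start-board refl (trans (length-kinds v₀) (sym (length-kinds v))))

      bins₀ : List ℕ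
      bins₀ = map (proj₂ ∘ proj₂) S₀

      bins≡ : ∀ v → map bin (Settled.rs (outcome v)) ≡ bins₀
      bins≡ v = trans (map-∘ (Settled.rs (outcome v))) (cong (map (proj₂ ∘ proj₂)) (Settled.shapes (outcome v)))

      volume-left : ∀ {rs ks} → Tidy w rs → Aligned rs ks → 0# ≤ volumeLeft 0# rs
      volume-left {rs} tidy al = ∑-nonNegative rs (λ {r} r∈ → *-nonNegative (0≤weights 0≤w tidy r∈)
          (≤⇒0≤ (≤-trans 0≤1 (Aligned⇒1≤ al r∈))))

      cost-lower : ∀ v → m * fromℕ (length (longBins (Settled.rs (outcome v)))) ≤ fromℕ 3 * costOf v
      cost-lower v = from (outcome v)
        where
        from : (o : Settled S₀ (kinds v) (costOf v)) → m * fromℕ (length (longBins (Settled.rs o))) ≤ fromℕ 3 *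
            costOf v
        from (settled {rs} rest cost≡ shapes tidy aligned) = ≤-trans
          (≤-by (*-nonNegative (0≤fromℕ 2) (volume-left tidy aligned) ⊕ *-nonNegative
              (0≤fromℕ (length (longBins rs))) (≤⇒0≤ (y≤x⊔y 0# (m - 0#))))
              (solve 4 (λ a b c d → (num 2) :* a :+ b :* (c :- (d :- (con (+ 0)))) :- ((con (+ 0)) :+ (con (+ 0))) :=
              (num 2) :* a :+ c :* b :- d :* b) refl V D x m))
          (≤-trans (cost-bound rest ≤-refl tidy (All.tabulate (λ r∈ → ≤-trans 0≤1 (Aligned⇒1≤ aligned r∈))))
              (≤-reflexive (cong (fromℕ 3 *_) (sym cost≡))))
          where
          D = fromℕ (length (longBins rs))
          V = volumeLeft 0# rs
          x = 0# ⊔ (m - 0#)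

      0≤costOf : ∀ v → 0# ≤ costOf v
      0≤costOf v = *-cancelˡ-≤ {c = fromℕ 3} (0<fromℕ 2) (≡-≤-trans (zeroʳ _)
        (≤-trans (*-nonNegative (≤-trans 0≤1 1≤m) (0≤fromℕ (length (longBins (Settled.rs (outcome v))))))
            (cost-lower v)))

      -- The bins are fixed before the choice shows. Averaged over the choices, the lasting items
      -- occupy at least `k / 2` different bins, and each of these accounts for a cost of `m / 3`;
      -- hence 6.
      total-cost : #choices g k * (m * fromℕ k) ≤ fromℕ 6 * ∑ (choices g k) costOf
      total-cost = from (Settled.rs (outcome v₀)) (Settled.tidy (outcome v₀)) (Settled.aligned (outcome v₀))
          (bins≡ v₀)
        where
        from : ∀ rs → Tidy w rs → Aligned rs (kinds v₀) → map bin rs ≡ bins₀ → #choices g k * (m * fromℕ k) ≤ fromℕ 6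
            * ∑ (choices g k) costOf
        -- The first resident is the `top` item, which belongs to no block.
        from (r₀ ∷ rs₀) tidy (_ ∷ aligned) bins₀≡ = *-cancelˡ-≤ {c = G} (0<fromℕ (suc g′))
          (≤-by (*-monoʳ-≤ (≤-trans 0≤1 1≤m) (fresh-on-average [] Bs few) ⊕ ≤-reflexive
              (cong (λ z → m * (P * z)) (hits-[] (flatten Bs))) ⊕ *-monoʳ-≤ (*-nonNegative (0≤fromℕ 2) (0≤fromℕ g))
              fresh≤cost) (solve 7 (λ a b c d e f g → a :* ((num 2) :* (b :* c) :+ d :* e) :+ a :* (d :* (con (+ 0)))
              :+ (num 2) :* b :* ((num 3) :* f) :- (a :* (d :* (b :* g)) :+ a :* (d :* e) :+ (num 2) :* b :*
              (a :* c)) := b :* ((num 6) :* f) :- b :* (d :* (a :* g))) refl m G f P h c K))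
          where
          cut : ∃ λ (Bs : Vec (Vec ℕ g) k) → flatten Bs ≡ map bin rs₀
          cut = into-blocks g k (map bin rs₀) (trans (length-map bin rs₀)
              (trans (Pointwise-length aligned) (length-blocks v₀)))
          Bs = proj₁ cut
          flat≡ = proj₂ cut
          G = fromℕ g
          K = fromℕ k
          P = #choices g k
          f = ∑ (choices g k) (λ v → fresh [] (select v Bs))
          h = hits [] (flatten Bs)
          c = ∑ (choices g k) costOf
          few : ∀ x → occurrences x (flatten Bs) ≤ fromℕ g
          few x = ≡-≤-trans (cong (occurrences x) flat≡) (≤-trans
            (≤-by (0≤weightIn x (bin r₀) 0≤1) (solve 2 (λ a b → a :- (con (+ 0)) := a :+ b :- b) refl v u))
                (few-per-bin tidy x))
            where
            u = occurrences x (map bin rs₀)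
            v = weightIn x (bin r₀) 1#
          aligned-bins : ∀ {rs ks} → map bin rs ≡ bin r₀ ∷ flatten Bs → Aligned rs (top ∷ ks) →
                         ∃₂ λ r rs′ → rs ≡ r ∷ rs′ × map bin rs′ ≡ flatten Bs × Aligned rs′ ks
          aligned-bins eq (_ ∷ al) = _ , _ , refl , ∷-injectiveʳ eq , al
          selected : ∀ v {b} → b ∈ select v Bs → b ∈ longBins (Settled.rs (outcome v))
          selected v b∈ with aligned-bins (trans (bins≡ v) (trans (sym bins₀≡) (cong (bin r₀ ∷_) (sym flat≡))))
              (Settled.aligned (outcome v))
          ... | r , rs′ , rs≡ , eq , al with long-resident v Bs eq al b∈
          ...   | r′ , r′∈ , bin≡ , m≤r′ = subst (_∈ longBins (Settled.rs (outcome v))) bin≡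
                    (∈-longBins (subst (r′ ∈_) (sym rs≡) (there r′∈)) m≤r′)
          fresh≤cost : m * f ≤ fromℕ 3 * c
          fresh≤cost = subst₂ _≤_ (∑-* m _ (choices g k)) (∑-* (fromℕ 3) costOf (choices g k))
            (∑-mono (choices g k) (λ {v} _ → ≤-trans (*-monoʳ-≤ (≤-trans 0≤1 1≤m)
                (fresh≤length (select v Bs) (selected v))) (cost-lower v)))

    module Randomized {C c β : ℝ} (1≤C : 1# ≤ C) (m≤2wC : m ≤ fromℕ 2 * (w * C)) (m≤G : m ≤ fromℕ g)
        (μ≤K : μ ≤ fromℕ k)
                      (0<c : 0# < c) (48c≡1 : fromℕ 48 * c ≡ 1#)
                      (A : RandomizedAlgorithm C (MinDurationOneWithRatio μ))
                          (competitive : CompetitiveInExpectation A β) where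
      vs = choices g k
      P = #choices g k
      K = fromℕ k
      -- This is `m K / 12`, half of the average cost `m K / 6` given by `total-cost`. The other
      -- half absorbs the error of the step functions, and the factor 4 cancels against `OPT ≤ 4 K`.
      u = fromℕ 4 * c * (m * K)

      0<u : 0# < u
      0<u = *-positive (*-positive (0<fromℕ 3) 0<c) (*-positive (<-≤-trans 0<1 1≤m) (0<fromℕ k′))

      0<P : 0# < P
      0<P = 0<#choices (suc g′) k

      expected : Vec (Fin g) k → ℝ
      expected v = proj₁ (competitive (instanceOf v) (in-class v))

      expected≤ : ∀ v → expected v ≤ β * OPT (instanceOf v)
      expected≤ v = proj₂ (proj₂ (competitive (instanceOf v) (in-class v)))

      costs : Vec (Fin g) k → Ω (space A) → ℝ
      costs v ω = cost (algorithm A ω) (instanceOf v) (in-class v)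

      pointwise : ∀ ω → fromℕ 2 * (u * P) ≤ ∑ vs (λ v → costs v ω)
      pointwise ω = *-cancelˡ-≤ (0<fromℕ 5) (≡-≤-trans
        (trans (solve 4 (λ a b c d → (num 6) :* ((num 2) :* ((num 4) :* a :* (b :* c) :* d)) := (num 48) :* a :*
            (d :* (b :* c))) refl c m K P) (trans (cong (_* (P * (m * K))) 48c≡1) (*-identityˡ _)))
        (Online.total-cost 1≤C m≤2wC (algorithm A ω)))

      averaged : fromℕ 2 * (u * P) ≤ ∑ vs expected + u * P
      -- The precision is `u` per instance; twice as many layers as there are instances make the
      -- truncation level `2 u P`, which is the sum to be reached.
      averaged = Averaging.average (space A) vs costs expected (2 ℕ.* length vs) (proj₁ 0<u)
        (≤-reflexive (trans (solve 2 (λ a b → (num 2) :* (a :* b) := a :* ((num 2) :* b)) refl u P)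
            (cong (u *_) (sym (fromℕ-* 2 (length vs))))))
        (λ v → measurable A (instanceOf v) (in-class v))
        (λ v ω → Online.0≤costOf 1≤C m≤2wC (algorithm A ω) v)
        (λ v → proj₁ (proj₂ (competitive (instanceOf v) (in-class v))))
        pointwise

      bounded : ∀ {e} → (∀ v → expected v ≤ e) → u * P ≤ e * P
      bounded {e} below = (≤-by (averaged ⊕ ≤-≡-trans (∑-mono vs (λ {v} _ → below v)) (∑-const e vs))
          (solve 4 (λ a b c d → a :+ b :* c :+ d :* c :- ((num 2) :* (b :* c) :+ a) := d :* c :- b :* c) refl s u P
          e))
        where s = ∑ vs expected

      conclusion : c * m ≤ β
      conclusion = by-sign (0# ≤? β)
        where
        nonPositive : ¬ (0# ≤ β) → ∀ v → expected v ≤ 0#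
        nonPositive β<0 v = ≤-trans (expected≤ v)
          (≤-by (*-nonNegative (≤⇒0≤ (≰⇒≥ β<0)) (0≤OPT (instanceOf v)))
              (solve 2 (λ a b → ((con (+ 0)) :- a) :* b :- (con (+ 0)) := (con (+ 0)) :- a :* b) refl β
              (OPT (instanceOf v))))
        small : 0# ≤ β → ∀ v → expected v ≤ β * (fromℕ 4 * K)
        small 0≤β v = ≤-trans (expected≤ v) (*-monoʳ-≤ 0≤β (Offline.OPT-small v m≤G μ≤K))
        by-sign : Dec (0# ≤ β) → c * m ≤ β
        by-sign (no β<0)  = ⊥-elim (<⇒≱ (*-positive 0<u 0<P) (≤-≡-trans (bounded (nonPositive β<0)) (zeroˡ P)))
        by-sign (yes 0≤β) = *-cancelˡ-≤ (*-positive (0<fromℕ 3) (0<fromℕ k′)) (*-cancelˡ-≤ 0<P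
          (≤-by (bounded (small 0≤β)) (solve 5 (λ a b c d e → a :* ((num 4) :* b) :* c :- (num 4) :* d :* (e :* b) :*
              c := c :* ((num 4) :* b :* a) :- c :* ((num 4) :* b :* (d :* e))) refl β K P c m)))

  module _ {c C √C μ : ℝ} (0<c : 0# < c) (48c≡1 : fromℕ 48 * c ≡ 1#) (1≤C : 1# ≤ C) (0≤√C : 0# ≤ √C)
      (√C²≡C : √C * √C ≡ C)
           (A : RandomizedAlgorithm C (MinDurationOneWithRatio μ)) {β : ℝ}
               (competitive : CompetitiveInExpectation A β) where

    lowerBound-blocks : ∀ {m w} g′ k′ → 1# ≤ m → m ≤ √C → m ≤ μ → m ≤ fromℕ (suc (suc g′)) → fromℕ (suc g′) ≤ m → μ ≤
        fromℕ k′ →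
                        0# ≤ w → fromℕ (suc (suc g′)) * w ≡ 1# → c * m ≤ β
    lowerBound-blocks {m} {w} g′ k′ 1≤m m≤√C m≤μ m≤g g-1≤m μ≤k′ 0≤w gw≡1 =
      Family.Randomized.conclusion 0≤w w≤1 1≤m m≤μ g′ k′ gw≡1 1≤C m≤2wC m≤g μ≤K 0<c 48c≡1 A competitive
      where
      0≤m = ≤-trans 0≤1 1≤m
      w≤1 : w ≤ 1#
      w≤1 = ≤-≡-trans (≤-by (*-nonNegative (0≤fromℕ (suc g′)) 0≤w)
          (solve 2 (λ a b → ((con (+ 1)) :+ a) :* b :- (con (+ 0)) := ((con (+ 1)) :+ ((con (+ 1)) :+ a)) :* b :- b)
          refl (fromℕ g′) w)) gw≡1
      m≤2wC : m ≤ fromℕ 2 * (w * C)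
      -- From `g ≤ m + 1 ≤ 2 m` and `m · m ≤ C` it follows that `C / g` is at least `m / 2`.
      m≤2wC = ≡-≤-trans (trans (sym (*-identityˡ m)) (cong (_* m) (sym gw≡1)))
        (≤-by (*-monoʳ-≤ (*-nonNegative 0≤w 0≤m) g-1≤m ⊕ *-monoʳ-≤ (*-nonNegative 0≤w 0≤m) 1≤m ⊕ *-monoʳ-≤
            (*-nonNegative (0≤fromℕ 2) 0≤w) (≤-≡-trans (*-mono-≤ 0≤√C 0≤m m≤√C m≤√C) √C²≡C))
            (solve 4 (λ a b c d → a :* b :* b :+ a :* b :* b :+ (num 2) :* a :* c :-
            (a :* b :* ((con (+ 1)) :+ d) :+ a :* b :* (con (+ 1)) :+ (num 2) :* a :* (b :* b)) := (num 2) :*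
            (a :* c) :- ((con (+ 1)) :+ ((con (+ 1)) :+ d)) :* a :* b) refl w m C (fromℕ g′)))
      μ≤K : μ ≤ fromℕ (suc k′)
      μ≤K = (≤-by (μ≤k′ ⊕ 0≤1) (solve 2 (λ a b → a :+ (con (+ 1)) :- (b :+ (con (+ 0))) := (con (+ 1)) :+ a :- b)
          refl (fromℕ k′) μ))

    lowerBound-duration : ∀ {m} → 1# ≤ m → m ≤ √C → m ≤ μ → c * m ≤ β
    lowerBound-duration {m} 1≤m m≤√C m≤μ = choose (ceiling m (≤-trans 0≤1 1≤m)) (archimedean μ)
      where
      choose : (∃ λ n → m < fromℕ (suc n) × fromℕ n ≤ m) → (∃ λ n → μ ≤ fromℕ n) → c * m ≤ β
      -- The floor of `m` is at least 1, so `g` is at least 2 and every block contains an item of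
      -- duration 1, as the class of instances demands.
      choose (zero , m<1 , _) _ = ⊥-elim (<⇒≱ m<1 (≡-≤-trans (+-identityʳ 1#) 1≤m))
      choose (suc g′ , m<g , g-1≤m) (k′ , μ≤k′) = let w , 0<w , gw≡1 = positiveInverse (0<fromℕ (suc g′)) in
        lowerBound-blocks g′ k′ 1≤m m≤√C m≤μ (proj₁ m<g) g-1≤m μ≤k′ (proj₁ 0<w) gw≡1

    lowerBound : 1# ≤ μ → c * (√C ⊓ μ) ≤ β
    lowerBound 1≤μ with ≤-total √C μ
    ... | inj₁ √C≤μ = lowerBound-duration (1≤√ 1≤C 0≤√C √C²≡C) ≤-refl √C≤μ
    ... | inj₂ μ≤√C = lowerBound-duration 1≤μ μ≤√C ≤-refl

theorem5 : (𝓡 : CompleteOrderedField) →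
    let open DynamicBinPacking 𝓡 in
    (∃ λ (K : ℝ) → 0# < K ×
    (∀ (C √C : ℝ) → 1# ≤ C → 0# ≤ √C → √C * √C ≡ C →
    ∃ λ (A : OnlineAlgorithm C MinDurationOne) →
    ∀ (μ : ℝ) → Competitive A (λ I → DurationRatio I μ) (K * (√C ⊓ μ))))
    ×
    (∃ λ (c : ℝ) → 0# < c ×
    (∀ (C √C : ℝ) → 1# ≤ C → 0# ≤ √C → √C * √C ≡ C →
    ∀ (μ : ℝ) → 1# ≤ μ →
    ∀ (A : RandomizedAlgorithm C (MinDurationOneWithRatio μ)) (β : ℝ) →
    CompetitiveInExpectation A β → c * (√C ⊓ μ) ≤ β))
theorem5 𝓡 =
  (fromℕ 16 , 0<fromℕ 𝓡 15 , upperBound 𝓡) ,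
  (let c , 0<c , 48c≡1 = positiveInverse 𝓡 (0<fromℕ 𝓡 47) in
   c , 0<c , λ C √C 1≤C 0≤√C √C²≡C μ 1≤μ A β competitive → lowerBound 𝓡 0<c 48c≡1 1≤C 0≤√C √C²≡C A competitive 1≤μ)
  where open DynamicBinPacking 𝓡
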